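{- Let $v>1$ be an integer such that every component $q$ of $v$ satisfies $q\equiv19\pmod{36}$. Then there exists an S$(2,\{3,6\},3v)$ which is harmonious under $\mathbb Z_3\times\mathbb F_v$.
   Context: The components of an integer $v$ are the maximal prime power divisors of $v$; $\mathbb F_v$ denotes the ring which is the direct product of the finite fields whose orders are the components of $v$ (its additive group is used). A linear space S$(2,K,v)$: $v$ points, blocks with sizes in $K$ (every element of $K$ occurring), every pair of points in exactly one block; a resolution partitions the blocks into parallel classes each partitioning the points. A linear space is harmonious under an additive group $\Gamma$ if it has point set $\Gamma$ and a resolution such that the group of translations of $\Gamma$ is an automorphism group of the resolved linear space acting sharply transitively on points and transitively on parallel classes. -}

module Defs where

open import Data.Nat using (ℕ; zero; suc; _+_; _^_; _<_; _≤_; _%_)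
open import Data.Nat.DivMod using (_mod_)
open import Data.Nat.Primality using (Prime)
open import Data.Fin using (Fin; toℕ)
open import Data.Vec using (Vec; zipWith)
open import Data.List using (List; []; _∷_; length; map)
open import Data.Nat.ListAction using (product)
open import Data.List.Membership.Propositional using (_∈_)
open import Data.List.Relation.Unary.All using (All)
open import Data.List.Relation.Unary.AllPairs using (AllPairs)
open import Data.List.Relation.Unary.Unique.Propositional using (Unique)
open import Data.Product using (Σ; _×_; _,_; proj₁; proj₂; ∃)
open import Data.Sum using (_⊎_)
open import Data.Unit using (⊤; tt)
open import Relation.Binary.PropositionalEquality using (_≡_; _≢_)
open import Function.Bundles using (_⇔_)

addFin : ∀ {n} → Fin n → Fin n → Fin n
addFin {suc m} a b = (toℕ a + toℕ b) mod suc m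

component : ℕ × ℕ → ℕ
component (p , e) = p ^ e

IsComponentFactorisation : ℕ → List (ℕ × ℕ) → Set
IsComponentFactorisation v fs =
  All (λ pe → Prime (proj₁ pe) × 1 ≤ proj₂ pe) fs
  × AllPairs (λ a b → proj₁ a ≢ proj₁ b) fs
  × v ≡ product (map component fs)

-- Additive group of F_v = ∏ F_{p^e}; the additive group of F_{p^e}
-- is (Z_p)^e.

Fv : List (ℕ × ℕ) → Set
Fv [] = ⊤
Fv ((p , e) ∷ fs) = Vec (Fin p) e × Fv fs

addFv : ∀ fs → Fv fs → Fv fs → Fv fs
addFv [] _ _ = tt
addFv ((p , e) ∷ fs) (x , xs) (y , ys) = zipWith addFin x y , addFv fs xs ys

Γ : List (ℕ × ℕ) → Set
Γ fs = Fin 3 × Fv fs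

_⊕_ : ∀ {fs} → Γ fs → Γ fs → Γ fs
_⊕_ {fs} (a , x) (b , y) = addFin a b , addFv fs x y

-- A resolved linear space S(2,{3,6},|G|) on point set G, harmonious
-- under the additive group (G, _+_).
-- Blocks are indexed by Fin nb; block j is the duplicate-free list
-- blk j of its points; cls j is the parallel class containing block j.

record HarmoniousS236 (G : Set) (_+G_ : G → G → G) : Set₁ where
  field
    nb  : ℕ
    nc  : ℕ
    blk : Fin nb → List G
    cls : Fin nb → Fin nc
    blk-unique : ∀ j → Unique (blk j)
    blk-size   : ∀ j → length (blk j) ≡ 3 ⊎ length (blk j) ≡ 6
    size3-occurs : ∃ λ j → length (blk j) ≡ 3
    size6-occurs : ∃ λ j → length (blk j) ≡ 6
    pair-exists : ∀ x y → x ≢ y → ∃ λ j → x ∈ blk j × y ∈ blk j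
    pair-unique : ∀ x y → x ≢ y → ∀ j j' →
                  x ∈ blk j → y ∈ blk j → x ∈ blk j' → y ∈ blk j' → j ≡ j'
    class-covers  : ∀ c x → ∃ λ j → cls j ≡ c × x ∈ blk j
    class-disjoint : ∀ x j j' → cls j ≡ cls j' → x ∈ blk j → x ∈ blk j' → j ≡ j'
    σ : G → Fin nb → Fin nb
    ρ : G → Fin nc → Fin nc
    σ-blocks  : ∀ g j x → (x ∈ blk j) ⇔ ((x +G g) ∈ blk (σ g j))
    σ-classes : ∀ g j → cls (σ g j) ≡ ρ g (cls j)
    ρ-transitive : ∀ c c' → ∃ λ g → ρ g c ≡ c'

{-# OPTIONS --safe #-}

-- Let θ = ω − 1 for a primitive cube root of unity ω of a field of order q ≡ 19 (mod 36), and let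
-- T represent the sixth powers modulo ⟨ω⟩. For t ∈ T the blocks {(j , t ωʲ) , (j , t b ωʲ)},
-- {(0 , t x ωʲ)} for x = e, f and {(j , t x ωʲ)} for x = d₁, d₂ (j = 0, 1, 2), with
-- θe = bω − 1, θf = 1 − bω² and θg = b − 1, have second coordinates {1, b, e, f, d₁, d₂} T ⟨ω⟩ and
-- differences θ{± e, ± f, ± g} T ⟨ω⟩, θ{1, b, e, f, d₁, d₂} T ⟨ω⟩ and the negatives of the latter.
-- As −1 is a cube but no square, together with their translates and the cosets of ℤ₃ they form the
-- design if 1, b, e, f lie in distinct sextic classes (d₁, d₂ being chosen in the remaining two)
-- and e, f, g in distinct cubic classes. If b − 1, b − ω, b − ω² have distinct cubic classes and b
-- is no sixth power, this holds for b, ωb or ω²b. Such a b exists because the relations between the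
-- cyclotomic numbers of order 3 yield more than (q − 1)/6 − 3 elements with the first property.
-- The components q are p ≡ 19 (mod 36) or p³ with p ≡ 7, 31 (mod 36), up to taking powers, and
-- products of groups are handled with a difference matrix.

module Submission where

open import Defs
open import Data.Nat as ℕ using (ℕ; zero; suc; _<_; _≤_; _%_; z≤n; s≤s; NonZero)
import Data.Nat.Properties as ℕ
open import Data.Nat.DivMod as ℕ using (_mod_)
open import Data.List as List using (List; []; _∷_)
open import Data.List.Relation.Unary.All using (All; []; _∷_)
open import Data.List.Membership.Propositional using (_∈_)
open import Data.Product as Product using (Σ; ∃; ∃₂; _×_; _,_; proj₁; proj₂)
open import Data.Sum as Sum using (_⊎_; inj₁; inj₂; [_,_]′)
open import Data.Empty using (⊥; ⊥-elim)
open import Data.Unit using (⊤; tt)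
open import Data.Fin as Fin using (Fin; zero; suc; toℕ)
import Data.Fin.Properties as Fin
open import Data.Fin.Patterns
open import Data.Vec as Vec using (Vec; []; _∷_)
open import Data.Maybe using (Maybe; just; nothing)
open import Function using (_∘_; id; case_of_)
open import Function.Bundles using (_↔_; _⇔_; Equivalence; Inverse; mk↔ₛ′; mk⇔)
open import Relation.Nullary using (¬_; Dec; yes; no)
open import Relation.Nullary.Decidable as Dec using (toWitness; _×-dec_; _⊎-dec_; _→-dec_; ¬?)
open import Relation.Binary.PropositionalEquality as ≡ using (_≡_; _≢_; refl; sym; trans; cong; cong₂; subst; subst₂; module ≡-Reasoning)
open import Algebra using (CommutativeMonoid; CommutativeRing; Group; RawRing)
open import Algebra.Structures using (IsCommutativeRing; IsAbelianGroup)
open import Level using (0ℓ)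
open import Function.Properties.Inverse using (↔⇒↣; ↔-sym; ↔-trans)
import Data.Fin.Permutation as Perm
open import Data.Nat.Tactic.RingSolver using (solve-∀)
import Data.Product.Properties as ProductProperties
import Algebra.Properties.Group
open import Data.Product.Function.NonDependent.Propositional using (_×-↔_)
open import Data.Sum.Function.Propositional using (_⊎-↔_)
open import Data.List.Membership.Propositional.Properties using (∈-tabulate⁺; ∈-tabulate⁻)
open import Data.List.Properties using (length-tabulate)
import Data.List.Relation.Unary.Unique.Propositional.Properties as Unique
import Data.Vec.Properties as Vec
open import Data.Nat.Divisibility using (_∣_; m%n≡0⇒n∣m; >⇒∤)
open import Data.Nat.Primality using (Prime; euclidsLemma; ¬prime[0]; ¬prime[1])

-- A ring solver with integer coefficients, and finite fields

-- The modulus 36 is what the classes require: `ω` is a sixth power because 18 divides q - 1, and -1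
-- is no square because q ≡ 3 modulo 4. The definition of e and f makes one condition serve twice.
-- Consecutive points of an orbit x⟨ω⟩ differ by θx, and the block of size 6 also has the mixed
-- differences bω - 1 and 1 - bω² with label 1. Once their quotients by θ are taken as second
-- coordinates of the triples with constant label, the differences with label 1 are θ times the
-- second coordinates, and all that remains is a condition on b. Those triples only add differences
-- with label 0, where otherwise just ± (b - 1) occurs. The obstacle is to find b for every q, small
-- ones included. A Möbius transformation turns the cubic condition on b into a count of 2d
-- elements, d being the cyclotomic number (1, 2). Counting solutions of x + y = x′ + y′ in two ways
-- then replaces Gauss sums: it amounts to 4q = L² + 27M². Only additive groups matter, so of the
-- non-prime fields only those of order p³ have to be constructed.

module RingSolver (R : CommutativeRing 0ℓ 0ℓ) where
  open CommutativeRing R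
    using (Carrier; _≈_; _+_; _*_; -_; 0#; 1#; setoid; +-cong; *-cong; +-congˡ; +-congʳ;
           semiring; commutativeSemiring; ring; +-abelianGroup; -‿cong; -‿inverseʳ; +-assoc; +-comm)
    renaming (refl to ≈-refl; sym to ≈-sym; trans to ≈-trans; reflexive to ≈-reflexive)
  open import Algebra.Properties.Semiring.Mult semiring using (×-homo-+; ×1-homo-*) renaming (_×_ to _·_)
  open import Algebra.Properties.Ring ring using (-‿distribˡ-*; -‿distribʳ-*; -‿involutive; -0#≈0#)
  open import Algebra.Properties.AbelianGroup +-abelianGroup using (⁻¹-∙-comm)
  open import Algebra.Solver.Ring.AlmostCommutativeRing
  import Algebra.Solver.Ring.NaturalCoefficients.Default commutativeSemiring as N
  open import Relation.Binary.Reasoning.Setoid setoid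

  cancel : ℕ → ℕ → ℕ × ℕ
  cancel (suc a) (suc b) = cancel a b
  cancel a b = a , b

  -- The pair (a , b) stands for the integer a − b; results are kept canonical, as the solver
  -- compares normal forms syntactically.
  Coefficient : RawRing 0ℓ 0ℓ
  Coefficient = record
    { Carrier = ℕ × ℕ
    ; _≈_ = _≡_
    ; _+_ = λ { (a , b) (c , d) → cancel (a ℕ.+ c) (b ℕ.+ d) }
    ; _*_ = λ { (a , b) (c , d) → cancel (a ℕ.* c ℕ.+ b ℕ.* d) (a ℕ.* d ℕ.+ b ℕ.* c) }
    ; -_ = λ { (a , b) → b , a }
    ; 0# = 0 , 0
    ; 1# = 1 , 0
    }

  ⟦_⟧ᶜ : ℕ × ℕ → Carrier
  ⟦ a , b ⟧ᶜ = a · 1# + - (b · 1#)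

  -- The solver with natural coefficients suffices because negatives enter it as independent
  -- variables; only `D + - D` has to be inserted and `B + - B` removed by hand.
  ⟦⟧ᶜ-cong : ∀ a b c d → a ℕ.+ d ≡ c ℕ.+ b → ⟦ a , b ⟧ᶜ ≈ ⟦ c , d ⟧ᶜ
  ⟦⟧ᶜ-cong a b c d eq = begin
    A + - B                 ≈⟨ N.solve 2 (λ p q → p N.:+ q N.:= p N.:+ N.con 0 N.:+ q) ≈-refl A (- B) ⟩
    A + 0# + - B            ≈⟨ +-congʳ (+-congˡ (≈-sym (-‿inverseʳ D))) ⟩
    A + (D + - D) + - B     ≈⟨ N.solve 4 (λ p q r s → p N.:+ (q N.:+ r) N.:+ s N.:= (p N.:+ q) N.:+ (r N.:+ s)) ≈-refl A D (- D) (- B) ⟩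
    (A + D) + (- D + - B)   ≈⟨ +-congʳ (≈-trans (≈-sym (×-homo-+ 1# a d)) (≈-trans (≈-reflexive (cong (_· 1#) eq)) (×-homo-+ 1# c b))) ⟩
    (C + B) + (- D + - B)   ≈⟨ N.solve 4 (λ p q r s → (p N.:+ q) N.:+ (r N.:+ s) N.:= (p N.:+ (q N.:+ s)) N.:+ r) ≈-refl C B (- D) (- B) ⟩
    C + (B + - B) + - D     ≈⟨ +-congʳ (+-congˡ (-‿inverseʳ B)) ⟩
    C + 0# + - D            ≈⟨ N.solve 2 (λ p q → p N.:+ N.con 0 N.:+ q N.:= p N.:+ q) ≈-refl C (- D) ⟩
    C + - D                 ∎
    where
    A = a · 1#
    B = b · 1#
    C = c · 1#
    D = d · 1#

  cancel-≡ : ∀ a b → proj₁ (cancel a b) ℕ.+ b ≡ a ℕ.+ proj₂ (cancel a b)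
  cancel-≡ zero b = refl
  cancel-≡ (suc a) zero = refl
  cancel-≡ (suc a) (suc b) = trans (ℕ.+-suc _ b) (cong suc (cancel-≡ a b))

  ⟦⟧ᶜ-cancel : ∀ a b → ⟦ cancel a b ⟧ᶜ ≈ ⟦ a , b ⟧ᶜ
  ⟦⟧ᶜ-cancel a b = ⟦⟧ᶜ-cong _ _ a b (cancel-≡ a b)

  ⟦⟧ᶜ-+ : ∀ x y → ⟦ RawRing._+_ Coefficient x y ⟧ᶜ ≈ ⟦ x ⟧ᶜ + ⟦ y ⟧ᶜ
  ⟦⟧ᶜ-+ (a , b) (c , d) = begin
    ⟦ cancel (a ℕ.+ c) (b ℕ.+ d) ⟧ᶜ
      ≈⟨ ⟦⟧ᶜ-cancel (a ℕ.+ c) (b ℕ.+ d) ⟩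
    (a ℕ.+ c) · 1# + - ((b ℕ.+ d) · 1#)
      ≈⟨ +-cong (×-homo-+ 1# a c) (-‿cong (×-homo-+ 1# b d)) ⟩
    (a · 1# + c · 1#) + - (b · 1# + d · 1#)
      ≈⟨ +-congˡ (≈-sym (⁻¹-∙-comm (b · 1#) (d · 1#))) ⟩
    (a · 1# + c · 1#) + (- (b · 1#) + - (d · 1#))
      ≈⟨ N.solve 4 (λ p q r s → (p N.:+ q) N.:+ (r N.:+ s) N.:= (p N.:+ r) N.:+ (q N.:+ s)) ≈-refl
           (a · 1#) (c · 1#) (- (b · 1#)) (- (d · 1#)) ⟩
    ⟦ a , b ⟧ᶜ + ⟦ c , d ⟧ᶜ ∎

  neg-*-neg : ∀ x y → (- x) * (- y) ≈ x * y
  neg-*-neg x y = begin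
    (- x) * (- y)   ≈⟨ ≈-sym (-‿distribˡ-* x (- y)) ⟩
    - (x * - y)     ≈⟨ -‿cong (≈-sym (-‿distribʳ-* x y)) ⟩
    - (- (x * y))   ≈⟨ -‿involutive (x * y) ⟩
    x * y           ∎

  ⟦⟧ᶜ-* : ∀ x y → ⟦ RawRing._*_ Coefficient x y ⟧ᶜ ≈ ⟦ x ⟧ᶜ * ⟦ y ⟧ᶜ
  ⟦⟧ᶜ-* (a , b) (c , d) = begin
    ⟦ cancel (a ℕ.* c ℕ.+ b ℕ.* d) (a ℕ.* d ℕ.+ b ℕ.* c) ⟧ᶜ
      ≈⟨ ⟦⟧ᶜ-cancel (a ℕ.* c ℕ.+ b ℕ.* d) (a ℕ.* d ℕ.+ b ℕ.* c) ⟩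
    (a ℕ.* c ℕ.+ b ℕ.* d) · 1# + - ((a ℕ.* d ℕ.+ b ℕ.* c) · 1#)
      ≈⟨ +-cong (mult a c b d) (-‿cong (mult a d b c)) ⟩
    (A * C + B * D) + - (A * D + B * C)
      ≈⟨ +-congˡ (≈-sym (⁻¹-∙-comm (A * D) (B * C))) ⟩
    (A * C + B * D) + (- (A * D) + - (B * C))
      ≈⟨ +-cong (+-congˡ (≈-sym (neg-*-neg B D))) (+-cong (-‿distribʳ-* A D) (-‿distribˡ-* B C)) ⟩
    (A * C + (- B) * (- D)) + (A * (- D) + (- B) * C)
      ≈⟨ N.solve 4 (λ p q r s → (p N.:* q N.:+ r N.:* s) N.:+ (p N.:* s N.:+ r N.:* q)
                       N.:= (p N.:+ r) N.:* (q N.:+ s)) ≈-refl A C (- B) (- D) ⟩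
    (A + - B) * (C + - D) ∎
    where
    A = a · 1#
    B = b · 1#
    C = c · 1#
    D = d · 1#
    mult : ∀ k l m n → (k ℕ.* l ℕ.+ m ℕ.* n) · 1# ≈ (k · 1#) * (l · 1#) + (m · 1#) * (n · 1#)
    mult k l m n = ≈-trans (×-homo-+ 1# (k ℕ.* l) (m ℕ.* n)) (+-cong (×1-homo-* k l) (×1-homo-* m n))

  ⟦⟧ᶜ-neg : ∀ x → ⟦ RawRing.-_ Coefficient x ⟧ᶜ ≈ - ⟦ x ⟧ᶜ
  ⟦⟧ᶜ-neg (a , b) = begin
    b · 1# + - (a · 1#)       ≈⟨ +-comm _ _ ⟩
    - (a · 1#) + b · 1#       ≈⟨ +-congˡ (≈-sym (-‿involutive _)) ⟩
    - (a · 1#) + - - (b · 1#) ≈⟨ ⁻¹-∙-comm _ _ ⟩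
    - ⟦ a , b ⟧ᶜ              ∎

  -- The solver interprets its constants through this function, so it should send 0 to 0# and 1 to 1# definitionally.
  ⟦_⟧ : ℕ × ℕ → Carrier
  ⟦ 0 , 0 ⟧ = 0#
  ⟦ 1 , 0 ⟧ = 1#
  ⟦ x ⟧ = ⟦ x ⟧ᶜ

  ⟦⟧-⟦⟧ᶜ : ∀ x → ⟦ x ⟧ ≈ ⟦ x ⟧ᶜ
  ⟦⟧-⟦⟧ᶜ (0 , 0) = ≈-sym (-‿inverseʳ 0#)
  ⟦⟧-⟦⟧ᶜ (0 , suc _) = ≈-refl
  ⟦⟧-⟦⟧ᶜ (1 , 0) = ≈-sym (≈-trans (+-congˡ -0#≈0#)
    (N.solve 1 (λ x → (x N.:+ N.con 0) N.:+ N.con 0 N.:= x) ≈-refl 1#))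
  ⟦⟧-⟦⟧ᶜ (1 , suc _) = ≈-refl
  ⟦⟧-⟦⟧ᶜ (suc (suc _) , _) = ≈-refl

  morphism : Coefficient -Raw-AlmostCommutative⟶ fromCommutativeRing R
  morphism = record
    { ⟦_⟧ = ⟦_⟧
    ; +-homo = λ x y → ≈-trans (⟦⟧-⟦⟧ᶜ (RawRing._+_ Coefficient x y)) (≈-trans (⟦⟧ᶜ-+ x y) (+-cong (≈-sym (⟦⟧-⟦⟧ᶜ x)) (≈-sym (⟦⟧-⟦⟧ᶜ y))))
    ; *-homo = λ x y → ≈-trans (⟦⟧-⟦⟧ᶜ (RawRing._*_ Coefficient x y)) (≈-trans (⟦⟧ᶜ-* x y) (*-cong (≈-sym (⟦⟧-⟦⟧ᶜ x)) (≈-sym (⟦⟧-⟦⟧ᶜ y))))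
    ; -‿homo = λ x → ≈-trans (⟦⟧-⟦⟧ᶜ (RawRing.-_ Coefficient x)) (≈-trans (⟦⟧ᶜ-neg x) (-‿cong (≈-sym (⟦⟧-⟦⟧ᶜ x))))
    ; 0-homo = ≈-refl
    ; 1-homo = ≈-refl
    }

  _coeff≟_ : ∀ x y → Maybe (⟦ x ⟧ ≈ ⟦ y ⟧)
  (a , b) coeff≟ (c , d) with a ℕ.≟ c | b ℕ.≟ d
  ... | yes refl | yes refl = just ≈-refl
  ... | _ | _ = nothing

  open import Algebra.Solver.Ring Coefficient (fromCommutativeRing R) morphism _coeff≟_ public
    using (Polynomial; solve; _:+_; _:*_; :-_; _:-_; _:=_; con)

  :0 :1 : ∀ {n} → Polynomial n
  :0 = con (0 , 0)
  :1 = con (1 , 0)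

record FiniteField : Set₁ where
  infix  8 -_
  infixl 7 _*_
  infixl 6 _+_
  field
    Carrier : Set
    _+_ _*_ : Carrier → Carrier → Carrier
    -_ : Carrier → Carrier
    0# 1# : Carrier
    isCommutativeRing : IsCommutativeRing _≡_ _+_ _*_ -_ 0# 1#
    1≢0 : 1# ≢ 0#
    inverse : ∀ x → x ≢ 0# → ∃ λ y → x * y ≡ 1#
    order : ℕ
    enum : Carrier ↔ Fin order

  commutativeRing : CommutativeRing 0ℓ 0ℓ
  commutativeRing = record { isCommutativeRing = isCommutativeRing }

module FieldProperties (K : FiniteField) where
  open FiniteField K public
  open CommutativeRing commutativeRing public
    using (_-_; +-assoc; +-comm; +-identityˡ; +-identityʳ; -‿inverseˡ; -‿inverseʳ; *-assoc; *-comm;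
           *-identityˡ; *-identityʳ; zeroˡ; zeroʳ; semiring; commutativeSemiring; ring)
  open import Algebra.Properties.Ring ring public
    using (-‿distribˡ-*; -‿distribʳ-*; -‿involutive; -0#≈0#; +-cancelʳ)
  open import Algebra.Properties.CommutativeSemiring.Exp commutativeSemiring public
    using (_^_; ^-homo-*; ^-assocʳ; ^-distrib-*)
  open RingSolver commutativeRing public using (solve; _:+_; _:*_; :-_; _:-_; _:=_; :0; :1)

  infix 4 _≟_
  abstract
    _≟_ : (x y : Carrier) → Dec (x ≡ y)
    x ≟ y = Dec.via-injection (↔⇒↣ enum) Fin._≟_ x y

  abstract
    -- The value `0#` at `0#` makes `inv` a permutation of the whole carrier, along which sums over
    -- the field can be reindexed.
    inv : Carrier → Carrier
    inv x with x ≟ 0#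
    ... | yes _ = 0#
    ... | no x≢0 = proj₁ (inverse x x≢0)

    inv-0 : inv 0# ≡ 0#
    inv-0 with 0# ≟ 0#
    ... | yes _ = refl
    ... | no 0≢0 = ⊥-elim (0≢0 refl)

    *-inverseʳ : ∀ {x} → x ≢ 0# → x * inv x ≡ 1#
    *-inverseʳ {x} x≢0 with x ≟ 0#
    ... | yes x≡0 = ⊥-elim (x≢0 x≡0)
    ... | no x≢0′ = proj₂ (inverse x x≢0′)

  *-inverseˡ : ∀ {x} → x ≢ 0# → inv x * x ≡ 1#
  *-inverseˡ x≢0 = trans (*-comm _ _) (*-inverseʳ x≢0)

  *-cancelˡ : ∀ {x} → x ≢ 0# → ∀ {y z} → x * y ≡ x * z → y ≡ z
  *-cancelˡ {x} x≢0 {y} {z} eq = begin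
    y               ≡⟨ unscale y ⟨
    inv x * (x * y) ≡⟨ cong (inv x *_) eq ⟩
    inv x * (x * z) ≡⟨ unscale z ⟩
    z               ∎
    where
    open ≡-Reasoning
    unscale : ∀ u → inv x * (x * u) ≡ u
    unscale u = trans (sym (*-assoc _ _ _)) (trans (cong (_* u) (*-inverseˡ x≢0)) (*-identityˡ u))

  x*[x⁻¹*y] : ∀ {x} → x ≢ 0# → ∀ y → x * (inv x * y) ≡ y
  x*[x⁻¹*y] {x} x≢0 y = trans (sym (*-assoc _ _ _)) (trans (cong (_* y) (*-inverseʳ x≢0)) (*-identityˡ y))

  *-nonzero : ∀ {x y} → x ≢ 0# → y ≢ 0# → x * y ≢ 0#
  *-nonzero {x} {y} x≢0 y≢0 eq = y≢0 (*-cancelˡ x≢0 (trans eq (sym (zeroʳ x))))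

  nonzeroˡ : ∀ {x y} → x * y ≢ 0# → x ≢ 0#
  nonzeroˡ {x} {y} xy≢0 x≡0 = xy≢0 (trans (cong (_* y) x≡0) (zeroˡ y))

  nonzeroʳ : ∀ {x y} → x * y ≢ 0# → y ≢ 0#
  nonzeroʳ {x} {y} xy≢0 y≡0 = xy≢0 (trans (cong (x *_) y≡0) (zeroʳ x))

  inv-nonzero : ∀ {x} → x ≢ 0# → inv x ≢ 0#
  inv-nonzero x≢0 = nonzeroʳ (λ eq → 1≢0 (trans (sym (*-inverseʳ x≢0)) eq))

  neg-nonzero : ∀ {x} → x ≢ 0# → - x ≢ 0#
  neg-nonzero x≢0 eq = x≢0 (trans (sym (-‿involutive _)) (trans (cong -_ eq) -0#≈0#))

  inv-involutive : ∀ x → inv (inv x) ≡ x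
  inv-involutive x with x ≟ 0#
  ... | yes refl = trans (cong inv inv-0) inv-0
  ... | no x≢0 = *-cancelˡ (inv-nonzero x≢0) (trans (*-inverseʳ (inv-nonzero x≢0)) (sym (*-inverseˡ x≢0)))

  x-y≡0⇒x≡y : ∀ {x y} → x - y ≡ 0# → x ≡ y
  x-y≡0⇒x≡y {x} {y} eq = begin
    x           ≡⟨ solve 2 (λ x y → x := (x :- y) :+ y) refl x y ⟩
    (x - y) + y ≡⟨ cong (_+ y) eq ⟩
    0# + y      ≡⟨ +-identityˡ y ⟩
    y           ∎
    where open ≡-Reasoning

  zero-product : ∀ {x y} → x * y ≡ 0# → x ≡ 0# ⊎ y ≡ 0#
  zero-product {x} {y} eq with x ≟ 0# | y ≟ 0#
  ... | yes x≡0 | _ = inj₁ x≡0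
  ... | no _ | yes y≡0 = inj₂ y≡0
  ... | no x≢0 | no y≢0 = ⊥-elim (*-nonzero x≢0 y≢0 eq)

  ^-nonzero : ∀ {x} n → x ≢ 0# → x ^ n ≢ 0#
  ^-nonzero zero _ = 1≢0
  ^-nonzero (suc n) x≢0 = *-nonzero x≢0 (^-nonzero n x≢0)

  1^ : ∀ n → 1# ^ n ≡ 1#
  1^ zero = refl
  1^ (suc n) = trans (*-identityˡ _) (1^ n)

-- Fermat’s theorem and power residues

-- The monoid is a parameter because both cases are needed: products over the field for Fermat's
-- theorem, sums in ℕ for counting solutions.
module FieldSums (K : FiniteField) (M : CommutativeMonoid 0ℓ 0ℓ) where
  open FieldProperties K using (enum; order; _≟_) renaming (Carrier to F)
  open CommutativeMonoid M
    using (_∙_; ε; _≈_; setoid; ∙-congˡ; identityʳ)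
    renaming (Carrier to A; refl to ≈-refl; sym to ≈-sym; trans to ≈-trans; reflexive to ≈-reflexive)
  import Algebra.Properties.CommutativeMonoid.Sum M as S
  import Algebra.Properties.CommutativeMonoid.Mult M as Mult

  private
    at : Fin order → F
    at = Inverse.from enum

    index : F → Fin order
    index = Inverse.to enum

    index-at : ∀ i → index (at i) ≡ i
    index-at i = Inverse.inverseˡ enum refl

    at-index : ∀ x → at (index x) ≡ x
    at-index x = Inverse.inverseʳ enum refl

  total : (F → A) → A
  total h = S.sum (h ∘ at)

  total-cong : ∀ {h h′} → (∀ x → h x ≈ h′ x) → total h ≈ total h′
  total-cong eq = S.sum-cong-≋ (eq ∘ at)

  total-distrib : ∀ h h′ → total (λ x → h x ∙ h′ x) ≈ total h ∙ total h′
  total-distrib h h′ = S.∑-distrib-+ (h ∘ at) (h′ ∘ at)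

  total-swap : ∀ (h : F → F → A) → total (λ x → total (h x)) ≈ total (λ y → total (λ x → h x y))
  total-swap h = S.∑-comm (λ i j → h (at i) (at j))

  total-ε : total (λ _ → ε) ≈ ε
  total-ε = S.sum-replicate-zero order

  total-permute : ∀ h (f g : F → F) → (∀ x → f (g x) ≡ x) → (∀ x → g (f x) ≡ x) →
                  total h ≈ total (h ∘ f)
  total-permute h f g fg gf = ≈-trans (S.sum-permute (h ∘ at) π)
    (S.sum-cong-≋ {order} (λ i → ≈-reflexive (cong h (at-index (f (at i))))))
    where
    conj-inverse : ∀ f g → (∀ x → f (g x) ≡ x) → ∀ i → index (f (at (index (g (at i))))) ≡ i
    conj-inverse f g fg i = trans (cong (index ∘ f) (at-index _)) (trans (cong index (fg _)) (index-at i))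
    π : Perm.Permutation order order
    π = Perm.permutation (index ∘ f ∘ at) (index ∘ g ∘ at) (conj-inverse f g fg) (conj-inverse g f gf)

  private
    sum-single : ∀ {n} (i : Fin n) a (t : Fin n → A) → t i ≈ a → (∀ j → j ≢ i → t j ≈ ε) → S.sum t ≈ a
    sum-single {suc n} i a t tᵢ rest =
      ≈-trans (S.sum-remove {i = i} t)
        (≈-trans (∙-congˡ (≈-trans (S.sum-cong-≋ (λ j → rest _ (Fin.punchInᵢ≢i i j))) (S.sum-replicate-zero n)))
          (≈-trans (identityʳ _) tᵢ))

  total-single : ∀ x a (h : F → A) → h x ≈ a → (∀ y → y ≢ x → h y ≈ ε) → total h ≈ a
  total-single x a h hx rest = sum-single (index x) a (h ∘ at)
    (≈-trans (≈-reflexive (cong h (at-index x))) hx)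
    (λ j j≢ → rest _ (λ eq → j≢ (trans (sym (index-at j)) (cong index eq))))

  total-const : ∀ a → total (λ _ → a) ≈ Mult._×_ order a
  total-const a = S.sum-replicate order

module PowerResidues (K : FiniteField) where
  open ≡-Reasoning
  open FieldProperties K
  open FieldSums K (CommutativeRing.*-commutativeMonoid commutativeRing)

  search : ∀ {P : Carrier → Set} → (∀ x → Dec (P x)) → Dec (∃ P)
  search {P} P? with Fin.any? (λ i → P? (Inverse.from enum i))
  ... | yes (i , p) = yes (Inverse.from enum i , p)
  ... | no ¬p = no (λ { (x , p) → ¬p (Inverse.to enum x , subst P (sym (Inverse.inverseʳ enum refl)) p) })

  replaceZero : Carrier → Carrier → Carrier
  replaceZero a x with x ≟ 0#
  ... | yes _ = a
  ... | no _ = x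

  replaceZero-nonzero : ∀ a x → a ≢ 0# → replaceZero a x ≢ 0#
  replaceZero-nonzero a x a≢0 with x ≟ 0#
  ... | yes _ = a≢0
  ... | no x≢0 = x≢0

  total-nonzero : ∀ {h} → (∀ x → h x ≢ 0#) → total h ≢ 0#
  total-nonzero {h} h≢0 = go order (h ∘ Inverse.from enum) (h≢0 ∘ Inverse.from enum)
    where
    import Algebra.Properties.CommutativeMonoid.Sum (CommutativeRing.*-commutativeMonoid commutativeRing) as S
    go : ∀ n (t : Fin n → Carrier) → (∀ i → t i ≢ 0#) → S.sum t ≢ 0#
    go zero t _ = 1≢0
    go (suc n) t t≢0 = *-nonzero (t≢0 zero) (go n (t ∘ suc) (t≢0 ∘ suc))

  -- Multiplication by a permutes the field, so the product of all nonzero elements (with the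
  -- zero replaced by 1 on one side and by a on the other) is multiplied by a ^ order.
  fermat : ∀ {a} → a ≢ 0# → a ^ order ≡ a
  fermat {a} a≢0 = *-cancelˡ P≢0 (begin
    P * a ^ order                                     ≡⟨ cong (P *_) (total-const a) ⟨
    P * total (λ _ → a)                               ≡⟨ total-distrib (replaceZero 1#) (λ _ → a) ⟨
    total (λ x → replaceZero 1# x * a)                ≡⟨ total-cong step ⟩
    total (λ x → replaceZero 1# (x * a) * spike x)    ≡⟨ total-distrib (λ x → replaceZero 1# (x * a)) spike ⟩
    total (λ x → replaceZero 1# (x * a)) * total spike
      ≡⟨ cong₂ _*_ (sym (total-permute (replaceZero 1#) (_* a) (_* inv a) cancel₁ cancel₂)) total-spike ⟩
    P * a                                             ∎)
    where
    P : Carrier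
    P = total (replaceZero 1#)
    P≢0 : P ≢ 0#
    P≢0 = total-nonzero (λ x → replaceZero-nonzero 1# x 1≢0)
    spike : Carrier → Carrier
    spike x with x ≟ 0#
    ... | yes _ = a
    ... | no _ = 1#
    spike-0 : spike 0# ≡ a
    spike-0 with 0# ≟ 0#
    ... | yes _ = refl
    ... | no 0≢0 = ⊥-elim (0≢0 refl)
    spike-≢0 : ∀ y → y ≢ 0# → spike y ≡ 1#
    spike-≢0 y y≢0 with y ≟ 0#
    ... | yes y≡0 = ⊥-elim (y≢0 y≡0)
    ... | no _ = refl
    total-spike : total spike ≡ a
    total-spike = total-single 0# a spike spike-0 spike-≢0
    step : ∀ x → replaceZero 1# x * a ≡ replaceZero 1# (x * a) * spike x
    step x with x ≟ 0# | x * a ≟ 0#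
    ... | yes _ | yes _ = refl
    ... | yes refl | no xa≢0 = ⊥-elim (xa≢0 (zeroˡ a))
    ... | no x≢0 | yes xa≡0 = ⊥-elim (*-nonzero x≢0 a≢0 xa≡0)
    ... | no _ | no _ = sym (*-identityʳ _)
    cancel₁ : ∀ x → x * inv a * a ≡ x
    cancel₁ x = trans (*-assoc _ _ _) (trans (cong (x *_) (*-inverseˡ a≢0)) (*-identityʳ x))
    cancel₂ : ∀ x → x * a * inv a ≡ x
    cancel₂ x = trans (*-assoc _ _ _) (trans (cong (x *_) (*-inverseʳ a≢0)) (*-identityʳ x))

  fermat-pred : ∀ {a n} → order ≡ suc n → a ≢ 0# → a ^ n ≡ 1#
  fermat-pred {a} {n} eq a≢0 = *-cancelˡ a≢0 (trans (cong (a ^_) (sym eq)) (trans (fermat a≢0) (sym (*-identityʳ a))))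

  -- A polynomial is a function that comes with a Horner scheme. Leading coefficient 1 fixes the
  -- degree and survives division by a linear factor.
  data Monic : ℕ → (Carrier → Carrier) → Set where
    one : ∀ {f} → (∀ x → f x ≡ 1#) → Monic 0 f
    horner : ∀ {n f g} c → (∀ x → f x ≡ c + x * g x) → Monic n g → Monic (suc n) f

  -- Synthetic division, with remainder `f r`; whether r is a root is left to the user of the
  -- quotient.
  divide : ∀ {n f} → Monic (suc n) f → ∀ r → ∃ λ g → Monic n g × (∀ x → f x ≡ f r + (x - r) * g x)
  divide {zero} {f} (horner {g = g} c fx (one g≡1)) r = (λ _ → 1#) , one (λ _ → refl) , λ x → begin
    f x                               ≡⟨ at x ⟩
    c + x * 1#                        ≡⟨ solve 3 (λ c x r → c :+ x :* :1 := (c :+ r :* :1) :+ (x :- r) :* :1) refl c x r ⟩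
    (c + r * 1#) + (x - r) * 1#       ≡⟨ cong (_+ (x - r) * 1#) (at r) ⟨
    f r + (x - r) * 1#                ∎
    where
    at : ∀ x → f x ≡ c + x * 1#
    at x = trans (fx x) (cong (λ y → c + x * y) (g≡1 x))
  divide {suc n} {f} (horner {g = g} c fx g-monic) r with divide g-monic r
  ... | k , k-monic , gx = (λ x → g r + x * k x) , horner (g r) (λ _ → refl) k-monic , λ x → begin
    f x                                        ≡⟨ fx x ⟩
    c + x * g x                                ≡⟨ cong (λ y → c + x * y) (gx x) ⟩
    c + x * (g r + (x - r) * k x)
      ≡⟨ solve 5 (λ c x r s t → c :+ x :* (s :+ (x :- r) :* t) := (c :+ r :* s) :+ (x :- r) :* (s :+ x :* t)) refl c x r (g r) (k x) ⟩
    (c + r * g r) + (x - r) * (g r + x * k x)  ≡⟨ cong (_+ (x - r) * (g r + x * k x)) (fx r) ⟨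
    f r + (x - r) * (g r + x * k x)            ∎

  root-bound : ∀ {n m f} → Monic n f → (r : Fin m → Carrier) → (∀ {i j} → r i ≡ r j → i ≡ j) →
               (∀ i → f (r i) ≡ 0#) → m ≤ n
  root-bound {m = zero} _ _ _ _ = z≤n
  root-bound {m = suc m} (one f≡1) r _ roots = ⊥-elim (1≢0 (trans (sym (f≡1 _)) (roots zero)))
  root-bound {m = suc m} {f} monic@(horner _ _ _) r r-inj roots with divide monic (r zero)
  ... | g , g-monic , fx = s≤s (root-bound g-monic (r ∘ suc) (Fin.suc-injective ∘ r-inj) g-roots)
    where
    g-roots : ∀ i → g (r (suc i)) ≡ 0#
    factored : ∀ i → (r (suc i) - r zero) * g (r (suc i)) ≡ 0#
    factored i = begin
      (r (suc i) - r zero) * g (r (suc i))              ≡⟨ +-identityˡ _ ⟨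
      0# + (r (suc i) - r zero) * g (r (suc i))         ≡⟨ cong (_+ _) (roots zero) ⟨
      f (r zero) + (r (suc i) - r zero) * g (r (suc i)) ≡⟨ fx (r (suc i)) ⟨
      f (r (suc i))                                     ≡⟨ roots (suc i) ⟩
      0#                                                ∎
    g-roots i = [ (λ eq → ⊥-elim (Fin.0≢1+n (sym (r-inj (x-y≡0⇒x≡y eq))))) , id ]′ (zero-product (factored i))

  ^-monic : ∀ n → Monic n (_^ n)
  ^-monic zero = one (λ _ → refl)
  ^-monic (suc n) = horner 0# (λ _ → sym (+-identityˡ _)) (^-monic n)

  -- Otherwise all n f nonzero elements would be roots of x^f - 1, which has degree f < n f. No
  -- primitive element of the field is needed.
  nonresidue : ∀ {n f} → 1 < n → 1 ≤ f → order ≡ suc (n ℕ.* f) → ∃ λ x → x ≢ 0# × x ^ f ≢ 1#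
  nonresidue {n} {suc f} 1<n _ eq
    with search (λ x → ¬? (x ≟ 0#) ×-dec ¬? (x ^ suc f ≟ 1#))
  ... | yes found = found
  ... | no none = ⊥-elim (ℕ.<⇒≱ n*f>f (root-bound monic nonzero nonzero-injective all-roots))
    where
    n*f>f : suc f < n ℕ.* suc f
    n*f>f = subst (_< n ℕ.* suc f) (ℕ.*-identityˡ (suc f)) (ℕ.*-monoˡ-< (suc f) 1<n)
    monic : Monic (suc f) (λ x → - 1# + x * x ^ f)
    monic = horner (- 1#) (λ _ → refl) (^-monic f)
    index : Carrier → Fin (suc (n ℕ.* suc f))
    index = Fin.cast eq ∘ Inverse.to enum
    at : Fin (suc (n ℕ.* suc f)) → Carrier
    at = Inverse.from enum ∘ Fin.cast (sym eq)
    index-at : ∀ i → index (at i) ≡ i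
    index-at i = trans (cong (Fin.cast eq) (Inverse.inverseˡ enum refl)) (Fin.cast-involutive eq (sym eq) i)
    at-injective : ∀ {i j} → at i ≡ at j → i ≡ j
    at-injective {i} {j} at≡ = trans (sym (index-at i)) (trans (cong index at≡) (index-at j))
    nonzero : Fin (n ℕ.* suc f) → Carrier
    nonzero i = at (Fin.punchIn (index 0#) i)
    nonzero-injective : ∀ {i j} → nonzero i ≡ nonzero j → i ≡ j
    nonzero-injective at≡ = Fin.punchIn-injective (index 0#) _ _ (at-injective at≡)
    nonzero≢0 : ∀ i → nonzero i ≢ 0#
    nonzero≢0 i eq′ = Fin.punchInᵢ≢i (index 0#) i (trans (sym (index-at _)) (cong index eq′))
    all-roots : ∀ i → - 1# + nonzero i * nonzero i ^ f ≡ 0#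
    all-roots i with nonzero i ^ suc f ≟ 1#
    ... | yes is1 = trans (cong (- 1# +_) is1) (-‿inverseˡ 1#)
    ... | no ≢1 = ⊥-elim (none (nonzero i , nonzero≢0 i , ≢1))

  IsOmega : Carrier → Set
  IsOmega ω = 1# + ω + ω * ω ≡ 0# × ω ≢ 1#

  omega : ∀ {f x} → order ≡ suc (3 ℕ.* f) → x ≢ 0# → x ^ f ≢ 1# → IsOmega (x ^ f)
  omega {f} {x} eq x≢0 ω≢1 = result (zero-product factored) , ω≢1
    where
    ω : Carrier
    ω = x ^ f
    ω³≡1 : ω ^ 3 ≡ 1#
    ω³≡1 = trans (^-assocʳ x f 3) (trans (cong (x ^_) (ℕ.*-comm f 3)) (fermat-pred eq x≢0))
    factored : (ω - 1#) * (1# + ω + ω * ω) ≡ 0#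
    factored = trans (solve 1 (λ ω → (ω :- :1) :* (:1 :+ ω :+ ω :* ω) := ω :* (ω :* (ω :* :1)) :- :1) refl ω)
      (trans (cong (_- 1#) ω³≡1) (-‿inverseʳ 1#))
    result : ω - 1# ≡ 0# ⊎ 1# + ω + ω * ω ≡ 0# → 1# + ω + ω * ω ≡ 0#
    result (inj₁ ω-1≡0) = ⊥-elim (ω≢1 (x-y≡0⇒x≡y ω-1≡0))
    result (inj₂ eq′) = eq′

-- The integers modulo n

module ModularRing (n : ℕ) where
  open import Data.Nat using (_+_; _*_)
  open ≡-Reasoning

  residue : ℕ → Fin (suc n)
  residue k = k mod suc n

  toℕ-residue : ∀ k → toℕ (residue k) ≡ k % suc n
  toℕ-residue k = Fin.toℕ-fromℕ< _

  residue-toℕ : ∀ a → residue (toℕ a) ≡ a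
  residue-toℕ a = Fin.toℕ-injective (trans (toℕ-residue (toℕ a)) (ℕ.m<n⇒m%n≡m (Fin.toℕ<n a)))

  residue-cong : ∀ k l → k % suc n ≡ l % suc n → residue k ≡ residue l
  residue-cong k l eq = Fin.toℕ-injective (trans (toℕ-residue k) (trans eq (sym (toℕ-residue l))))

  mulFin : Fin (suc n) → Fin (suc n) → Fin (suc n)
  mulFin a b = residue (toℕ a * toℕ b)

  negFin : Fin (suc n) → Fin (suc n)
  negFin a = residue (suc n ℕ.∸ toℕ a)

  residue-+ : ∀ k l → addFin (residue k) (residue l) ≡ residue (k + l)
  residue-+ k l = residue-cong (toℕ (residue k) + toℕ (residue l)) (k + l) (trans
    (cong₂ (λ x y → (x + y) % suc n) (toℕ-residue k) (toℕ-residue l))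
    (sym (ℕ.%-distribˡ-+ k l (suc n))))

  residue-* : ∀ k l → mulFin (residue k) (residue l) ≡ residue (k * l)
  residue-* k l = residue-cong (toℕ (residue k) * toℕ (residue l)) (k * l) (trans
    (cong₂ (λ x y → (x * y) % suc n) (toℕ-residue k) (toℕ-residue l))
    (sym (ℕ.%-distribˡ-* k l (suc n))))

  addFin-residueʳ : ∀ a l → addFin a (residue l) ≡ residue (toℕ a + l)
  addFin-residueʳ a l = trans (cong (λ x → addFin x (residue l)) (sym (residue-toℕ a))) (residue-+ (toℕ a) l)

  mulFin-residueʳ : ∀ a l → mulFin a (residue l) ≡ residue (toℕ a * l)
  mulFin-residueʳ a l = trans (cong (λ x → mulFin x (residue l)) (sym (residue-toℕ a))) (residue-* (toℕ a) l)

  addFin-comm : ∀ a b → addFin a b ≡ addFin b a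
  addFin-comm a b = cong residue (ℕ.+-comm (toℕ a) (toℕ b))

  mulFin-comm : ∀ a b → mulFin a b ≡ mulFin b a
  mulFin-comm a b = cong residue (ℕ.*-comm (toℕ a) (toℕ b))

  addFin-assoc : ∀ a b c → addFin (addFin a b) c ≡ addFin a (addFin b c)
  addFin-assoc a b c = begin
    addFin (addFin a b) c                 ≡⟨ addFin-comm (addFin a b) c ⟩
    addFin c (addFin a b)                 ≡⟨ addFin-residueʳ c (toℕ a + toℕ b) ⟩
    residue (toℕ c + (toℕ a + toℕ b)) ≡⟨ cong residue (trans (ℕ.+-comm (toℕ c) _) (ℕ.+-assoc (toℕ a) _ _)) ⟩
    residue (toℕ a + (toℕ b + toℕ c)) ≡⟨ addFin-residueʳ a (toℕ b + toℕ c) ⟨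
    addFin a (addFin b c)                 ∎

  mulFin-assoc : ∀ a b c → mulFin (mulFin a b) c ≡ mulFin a (mulFin b c)
  mulFin-assoc a b c = begin
    mulFin (mulFin a b) c                 ≡⟨ mulFin-comm (mulFin a b) c ⟩
    mulFin c (mulFin a b)                 ≡⟨ mulFin-residueʳ c (toℕ a * toℕ b) ⟩
    residue (toℕ c * (toℕ a * toℕ b)) ≡⟨ cong residue (trans (ℕ.*-comm (toℕ c) _) (ℕ.*-assoc (toℕ a) _ _)) ⟩
    residue (toℕ a * (toℕ b * toℕ c)) ≡⟨ mulFin-residueʳ a (toℕ b * toℕ c) ⟨
    mulFin a (mulFin b c)                 ∎

  mulFin-distribˡ : ∀ a b c → mulFin a (addFin b c) ≡ addFin (mulFin a b) (mulFin a c)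
  mulFin-distribˡ a b c = begin
    mulFin a (addFin b c)                           ≡⟨ mulFin-residueʳ a (toℕ b + toℕ c) ⟩
    residue (toℕ a * (toℕ b + toℕ c))           ≡⟨ cong residue (ℕ.*-distribˡ-+ (toℕ a) _ _) ⟩
    residue (toℕ a * toℕ b + toℕ a * toℕ c)   ≡⟨ residue-+ (toℕ a * toℕ b) (toℕ a * toℕ c) ⟨
    addFin (mulFin a b) (mulFin a c)                ∎

  addFin-identityˡ : ∀ a → addFin zero a ≡ a
  addFin-identityˡ = residue-toℕ

  mulFin-identityˡ : ∀ a → mulFin (residue 1) a ≡ a
  mulFin-identityˡ a = trans (mulFin-comm (residue 1) a)
    (trans (mulFin-residueʳ a 1) (trans (cong residue (ℕ.*-identityʳ (toℕ a))) (residue-toℕ a)))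

  negFin-inverseʳ : ∀ a → addFin a (negFin a) ≡ zero
  negFin-inverseʳ a = trans (addFin-residueʳ a (suc n ℕ.∸ toℕ a)) (residue-cong (toℕ a + (suc n ℕ.∸ toℕ a)) 0
    (trans (cong (_% suc n) (ℕ.m+[n∸m]≡n (ℕ.<⇒≤ (Fin.toℕ<n a)))) (ℕ.n%n≡0 (suc n))))

  addFin-isAbelianGroup : IsAbelianGroup _≡_ (addFin {suc n}) zero negFin
  addFin-isAbelianGroup = record
    { isGroup = record
      { isMonoid = record
        { isSemigroup = record
          { isMagma = record { isEquivalence = ≡.isEquivalence ; ∙-cong = cong₂ addFin }
          ; assoc = addFin-assoc }
        ; identity = addFin-identityˡ , λ a → trans (addFin-comm a zero) (addFin-identityˡ a) }
      ; inverse = (λ a → trans (addFin-comm (negFin a) a) (negFin-inverseʳ a)) , negFin-inverseʳ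
      ; ⁻¹-cong = cong negFin }
    ; comm = addFin-comm }

  isCommutativeRing : IsCommutativeRing _≡_ addFin mulFin negFin zero (residue 1)
  isCommutativeRing = record
    { isRing = record
      { +-isAbelianGroup = addFin-isAbelianGroup
      ; *-cong = cong₂ mulFin
      ; *-assoc = mulFin-assoc
      ; *-identity = mulFin-identityˡ , λ a → trans (mulFin-comm a (residue 1)) (mulFin-identityˡ a)
      ; distrib = mulFin-distribˡ , λ a b c → trans (mulFin-comm (addFin b c) a)
          (trans (mulFin-distribˡ a b c) (cong₂ addFin (mulFin-comm a b) (mulFin-comm a c))) }
    ; *-comm = mulFin-comm }

-- Cubic, quadratic and sextic classes

distinct? : ∀ {A : Set} {n} → ((x y : A) → Dec (x ≡ y)) → (xs : Vec A n) →
            Dec (∀ i j → Vec.lookup xs i ≡ Vec.lookup xs j → i ≡ j)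
distinct? _≟_ xs = Fin.all? λ i → Fin.all? λ j → (Vec.lookup xs i ≟ Vec.lookup xs j) →-dec (i Fin.≟ j)

-- The group of sextic classes, written as ℤ₃ × ℤ₂ instead of ℤ₆: cubic class and quadratic
-- character are treated separately throughout, and -1 changes the second component only.
Class : Set
Class = Fin 3 × Fin 2

infixl 6 _⊞_
_⊞_ : Class → Class → Class
(a , s) ⊞ (b , t) = addFin a b , addFin s t

_≟ᶜ_ : (c d : Class) → Dec (c ≡ d)
_≟ᶜ_ = ProductProperties.≡-dec Fin._≟_ Fin._≟_

addFin-cancelʳ : ∀ {n} (a b c : Fin (suc n)) → addFin a c ≡ addFin b c → a ≡ b
addFin-cancelʳ {n} a b c = Algebra.Properties.Group.∙-cancelʳ
  (record { isGroup = IsAbelianGroup.isGroup (ModularRing.addFin-isAbelianGroup n) }) c a b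

⊞-comm : ∀ c d → c ⊞ d ≡ d ⊞ c
⊞-comm (a , s) (b , t) = cong₂ _,_ (ModularRing.addFin-comm 2 a b) (ModularRing.addFin-comm 1 s t)

⊞-identityʳ : ∀ c → c ⊞ (0F , 0F) ≡ c
⊞-identityʳ c = trans (⊞-comm c _) (cong₂ _,_ (ModularRing.addFin-identityˡ 2 _) (ModularRing.addFin-identityˡ 1 _))

⊞-cancelʳ : ∀ {c d} e → c ⊞ e ≡ d ⊞ e → c ≡ d
⊞-cancelʳ e eq = cong₂ _,_ (addFin-cancelʳ _ _ (proj₁ e) (cong proj₁ eq)) (addFin-cancelʳ _ _ (proj₂ e) (cong proj₂ eq))

⊞-cancelˡ : ∀ {c d} e → e ⊞ c ≡ e ⊞ d → c ≡ d
⊞-cancelˡ e eq = ⊞-cancelʳ e (trans (⊞-comm _ e) (trans eq (⊞-comm e _)))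

-- Here f = (q - 1) / 3 and h = (q - 1) / 2. The divisibilities are the arithmetic content of q ≡ 19
-- modulo 36: f is even, so -1 is a cube; h is odd, so -1 is no square; 3 divides f and h, so `ω` is
-- a cube and a square.
module Exponents (order m : ℕ) (order≡ : order ≡ 19 ℕ.+ 36 ℕ.* m) where
  open import Data.Nat using (_+_; _*_)

  abstract
    f h : ℕ
    f = 6 + 12 * m
    h = 9 + 18 * m

    1≤f : 1 ≤ f
    1≤f = s≤s z≤n

    1≤h : 1 ≤ h
    1≤h = s≤s z≤n

    order≡1+3f : order ≡ suc (3 * f)
    order≡1+3f = trans order≡ (arith m)
      where
      arith : ∀ m → 19 + 36 * m ≡ suc (3 * (6 + 12 * m))
      arith = solve-∀

    order≡1+2h : order ≡ suc (2 * h)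
    order≡1+2h = trans order≡ (arith m)
      where
      arith : ∀ m → 19 + 36 * m ≡ suc (2 * (9 + 18 * m))
      arith = solve-∀

    2∣f : ∃ λ k → f ≡ 2 * k
    2∣f = 3 + 6 * m , arith m
      where
      arith : ∀ m → 6 + 12 * m ≡ 2 * (3 + 6 * m)
      arith = solve-∀

    3∣f : ∃ λ k → f ≡ 3 * k
    3∣f = 2 + 4 * m , arith m
      where
      arith : ∀ m → 6 + 12 * m ≡ 3 * (2 + 4 * m)
      arith = solve-∀

    3∣h : ∃ λ k → h ≡ 3 * k
    3∣h = 3 + 6 * m , arith m
      where
      arith : ∀ m → 9 + 18 * m ≡ 3 * (3 + 6 * m)
      arith = solve-∀

    h-odd : ∃ λ k → h ≡ suc (2 * k)
    h-odd = 4 + 9 * m , arith m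
      where
      arith : ∀ m → 9 + 18 * m ≡ suc (2 * (4 + 9 * m))
      arith = solve-∀

module SexticClasses (K : FiniteField) (m : ℕ) (order≡ : FiniteField.order K ≡ 19 ℕ.+ 36 ℕ.* m) where
  open ≡-Reasoning
  open FieldProperties K
  open PowerResidues K

  open Exponents order m order≡

  abstract
    cubic-nonresidue : ∃ λ x → x ≢ 0# × x ^ f ≢ 1#
    cubic-nonresidue = nonresidue {3} (s≤s (s≤s z≤n)) 1≤f order≡1+3f

  x₀ : Carrier
  x₀ = proj₁ cubic-nonresidue

  x₀≢0 : x₀ ≢ 0#
  x₀≢0 = proj₁ (proj₂ cubic-nonresidue)

  abstract
    ω : Carrier
    ω = x₀ ^ f

    x₀^f≡ω : x₀ ^ f ≡ ω
    x₀^f≡ω = refl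

    ω-relation : 1# + ω + ω * ω ≡ 0#
    ω-relation = proj₁ (omega {f} order≡1+3f x₀≢0 (proj₂ (proj₂ cubic-nonresidue)))

    1≢ω : 1# ≢ ω
    1≢ω eq = proj₂ (proj₂ cubic-nonresidue) (sym eq)

    ω≢0 : ω ≢ 0#
    ω≢0 = ^-nonzero f x₀≢0

  -- The ring solver treats `ω` as a variable. An identity that depends on 1 + ω + ω² = 0 is
  -- therefore proved with an explicit cofactor `k` of this relation.
  modulo-ω-relation : ∀ {a b} k → a ≡ b + k * (1# + ω + ω * ω) → a ≡ b
  modulo-ω-relation {a} {b} k eq = begin
    a                              ≡⟨ eq ⟩
    b + k * (1# + ω + ω * ω)       ≡⟨ cong (λ s → b + k * s) ω-relation ⟩
    b + k * 0#                     ≡⟨ cong (b +_) (zeroʳ k) ⟩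
    b + 0#                         ≡⟨ +-identityʳ b ⟩
    b                              ∎

  ω*ω*ω≡1 : ω * (ω * ω) ≡ 1#
  ω*ω*ω≡1 = modulo-ω-relation (ω - 1#)
    (solve 1 (λ ω → ω :* (ω :* ω) := :1 :+ (ω :- :1) :* (:1 :+ ω :+ ω :* ω)) refl ω)

  ω̂ : Fin 3 → Carrier
  ω̂ 0F = 1#
  ω̂ 1F = ω
  ω̂ 2F = ω * ω

  ω̂-nonzero : ∀ c → ω̂ c ≢ 0#
  ω̂-nonzero 0F = 1≢0
  ω̂-nonzero 1F = ω≢0
  ω̂-nonzero 2F = *-nonzero ω≢0 ω≢0

  private
    1≢ω² : 1# ≢ ω * ω
    1≢ω² eq = 1≢ω (sym (trans (sym (*-identityʳ ω)) (trans (cong (ω *_) eq) ω*ω*ω≡1)))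

    ω≢ω² : ω ≢ ω * ω
    ω≢ω² eq = 1≢ω (*-cancelˡ ω≢0 (trans (*-identityʳ ω) eq))

  ω̂-injective : ∀ {c d} → ω̂ c ≡ ω̂ d → c ≡ d
  ω̂-injective {0F} {0F} _ = refl
  ω̂-injective {0F} {1F} eq = ⊥-elim (1≢ω eq)
  ω̂-injective {0F} {2F} eq = ⊥-elim (1≢ω² eq)
  ω̂-injective {1F} {0F} eq = ⊥-elim (1≢ω (sym eq))
  ω̂-injective {1F} {1F} _ = refl
  ω̂-injective {1F} {2F} eq = ⊥-elim (ω≢ω² eq)
  ω̂-injective {2F} {0F} eq = ⊥-elim (1≢ω² (sym eq))
  ω̂-injective {2F} {1F} eq = ⊥-elim (ω≢ω² (sym eq))
  ω̂-injective {2F} {2F} _ = refl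

  ω̂-addFin : ∀ c d → ω̂ (addFin c d) ≡ ω̂ c * ω̂ d
  ω̂-addFin 0F 0F = sym (*-identityˡ _)
  ω̂-addFin 0F 1F = sym (*-identityˡ _)
  ω̂-addFin 0F 2F = sym (*-identityˡ _)
  ω̂-addFin 1F 0F = sym (*-identityʳ _)
  ω̂-addFin 1F 1F = refl
  ω̂-addFin 1F 2F = sym ω*ω*ω≡1
  ω̂-addFin 2F 0F = sym (*-identityʳ _)
  ω̂-addFin 2F 1F = sym (trans (*-assoc _ _ _) ω*ω*ω≡1)
  ω̂-addFin 2F 2F = sym (trans (*-assoc _ _ _) (trans (cong (ω *_) ω*ω*ω≡1) (*-identityʳ ω)))

  abstract
    quadratic-nonresidue : ∃ λ x → x ≢ 0# × x ^ h ≢ 1#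
    quadratic-nonresidue = nonresidue {2} (s≤s (s≤s z≤n)) 1≤h order≡1+2h

  square-roots-of-1 : ∀ {y} → y ^ 2 ≡ 1# → y ≡ 1# ⊎ y ≡ - 1#
  square-roots-of-1 {y} eq = Sum.map x-y≡0⇒x≡y x-y≡0⇒x≡y (zero-product (begin
    (y - 1#) * (y - - 1#) ≡⟨ solve 1 (λ y → (y :- :1) :* (y :- (:- :1)) := y :* (y :* :1) :- :1) refl y ⟩
    y ^ 2 - 1#            ≡⟨ cong (_- 1#) eq ⟩
    1# - 1#               ≡⟨ -‿inverseʳ 1# ⟩
    0#                    ∎))

  ^h-square : ∀ {x} → x ≢ 0# → (x ^ h) ^ 2 ≡ 1#
  ^h-square {x} x≢0 = trans (^-assocʳ x h 2) (trans (cong (x ^_) (ℕ.*-comm h 2)) (fermat-pred order≡1+2h x≢0))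

  1≢-1 : 1# ≢ - 1#
  1≢-1 eq = case quadratic-nonresidue of λ { (y , y≢0 , y^h≢1) →
    y^h≢1 ([ id , (λ e → trans e (sym eq)) ]′ (square-roots-of-1 (^h-square y≢0))) }

  ±1 : Fin 2 → Carrier
  ±1 0F = 1#
  ±1 1F = - 1#

  ±1-injective : ∀ {s t} → ±1 s ≡ ±1 t → s ≡ t
  ±1-injective {0F} {0F} _ = refl
  ±1-injective {0F} {1F} eq = ⊥-elim (1≢-1 eq)
  ±1-injective {1F} {0F} eq = ⊥-elim (1≢-1 (sym eq))
  ±1-injective {1F} {1F} _ = refl

  -1*-1≡1 : - 1# * - 1# ≡ 1#
  -1*-1≡1 = solve 0 ((:- :1) :* (:- :1) := :1) refl

  ±1-addFin : ∀ s t → ±1 (addFin s t) ≡ ±1 s * ±1 t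
  ±1-addFin 0F 0F = sym (*-identityˡ _)
  ±1-addFin 0F 1F = sym (*-identityˡ _)
  ±1-addFin 1F 0F = sym (*-identityʳ _)
  ±1-addFin 1F 1F = sym -1*-1≡1

  cube-roots-of-1 : ∀ {y} → y ^ 3 ≡ 1# → ∃ λ c → y ≡ ω̂ c
  cube-roots-of-1 {y} eq =
    [ (λ e → [ (λ e′ → 0F , x-y≡0⇒x≡y e′) , (λ e′ → 1F , x-y≡0⇒x≡y e′) ]′ (zero-product e))
    , (λ e → 2F , x-y≡0⇒x≡y e) ]′ (zero-product factored)
    where
    k : Carrier
    k = - (y * y - ω * y + (ω - 1#))
    factored : (y - 1#) * (y - ω) * (y - ω * ω) ≡ 0#
    factored = modulo-ω-relation k (trans
      (solve 2 (λ y ω → (y :- :1) :* (y :- ω) :* (y :- ω :* ω)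
        := y :* (y :* (y :* :1)) :- :1 :+ (:- (y :* y :- ω :* y :+ (ω :- :1))) :* (:1 :+ ω :+ ω :* ω)) refl y ω)
      (cong (_+ k * (1# + ω + ω * ω)) (trans (cong (_- 1#) eq) (-‿inverseʳ 1#))))

  abstract
    -- The cubic residue character in additive form, as the exponent of `ω` in `x ^ f`; `sign` is
    -- its quadratic counterpart. The values at `0#` are dummies.
    cubic : Carrier → Fin 3
    cubic x with x ≟ 0#
    ... | yes _ = 0F
    ... | no x≢0 = proj₁ (cube-roots-of-1 (trans (^-assocʳ x f 3) (trans (cong (x ^_) (ℕ.*-comm f 3)) (fermat-pred order≡1+3f x≢0))))

    cubic-spec : ∀ {x} → x ≢ 0# → x ^ f ≡ ω̂ (cubic x)
    cubic-spec {x} x≢0 with x ≟ 0#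
    ... | yes x≡0 = ⊥-elim (x≢0 x≡0)
    ... | no x≢0′ = proj₂ (cube-roots-of-1 (trans (^-assocʳ x f 3) (trans (cong (x ^_) (ℕ.*-comm f 3)) (fermat-pred order≡1+3f x≢0′))))

    sign : Carrier → Fin 2
    sign x with x ^ h ≟ 1#
    ... | yes _ = 0F
    ... | no _ = 1F

    sign-spec : ∀ {x} → x ≢ 0# → x ^ h ≡ ±1 (sign x)
    sign-spec {x} x≢0 with x ^ h ≟ 1#
    ... | yes e = e
    ... | no ≢1 = [ (λ e → ⊥-elim (≢1 e)) , id ]′ (square-roots-of-1 (^h-square x≢0))

  cubic-unique : ∀ {x c} → x ≢ 0# → x ^ f ≡ ω̂ c → cubic x ≡ c
  cubic-unique x≢0 eq = ω̂-injective (trans (sym (cubic-spec x≢0)) eq)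

  sign-unique : ∀ {x s} → x ≢ 0# → x ^ h ≡ ±1 s → sign x ≡ s
  sign-unique x≢0 eq = ±1-injective (trans (sym (sign-spec x≢0)) eq)

  class : Carrier → Class
  class x = cubic x , sign x

  class-* : ∀ {x y} → x ≢ 0# → y ≢ 0# → class (x * y) ≡ class x ⊞ class y
  class-* {x} {y} x≢0 y≢0 = cong₂ _,_
    (cubic-unique (*-nonzero x≢0 y≢0)
      (trans (^-distrib-* x y f) (trans (cong₂ _*_ (cubic-spec x≢0) (cubic-spec y≢0)) (sym (ω̂-addFin (cubic x) (cubic y))))))
    (sign-unique (*-nonzero x≢0 y≢0)
      (trans (^-distrib-* x y h) (trans (cong₂ _*_ (sign-spec x≢0) (sign-spec y≢0)) (sym (±1-addFin (sign x) (sign y))))))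

  private
    ^-multiple : ∀ {x k} a → x ^ a ≡ 1# → (∃ λ b → k ≡ a ℕ.* b) → x ^ k ≡ 1#
    ^-multiple {x} a eq (b , refl) = trans (sym (^-assocʳ x a b)) (trans (cong (_^ b) eq) (1^ b))

    ω̂³≡1 : ∀ c → ω̂ c ^ 3 ≡ 1#
    ω̂³≡1 c = trans (solve 1 (λ y → y :* (y :* (y :* :1)) := y :* (y :* y)) refl (ω̂ c)) (trans (cong (ω̂ c *_) (sym (ω̂-addFin c c))) (trans (sym (ω̂-addFin c _)) (cong ω̂ (tripled c))))
      where
      tripled : ∀ c → addFin c (addFin c c) ≡ 0F
      tripled 0F = refl
      tripled 1F = refl
      tripled 2F = refl

    -1² : (- 1#) ^ 2 ≡ 1#
    -1² = trans (cong (- 1# *_) (*-identityʳ _)) -1*-1≡1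

  -- A cube root of unity vanishes in the characters because 3 divides both exponents f and h.
  class-ω̂ : ∀ c → class (ω̂ c) ≡ (0F , 0F)
  class-ω̂ c = cong₂ _,_
    (cubic-unique (ω̂-nonzero c) (^-multiple 3 (ω̂³≡1 c) 3∣f))
    (sign-unique (ω̂-nonzero c) (^-multiple 3 (ω̂³≡1 c) 3∣h))

  class-1 : class 1# ≡ (0F , 0F)
  class-1 = class-ω̂ 0F

  class-−1 : class (- 1#) ≡ (0F , 1F)
  class-−1 = cong₂ _,_
    (cubic-unique (neg-nonzero 1≢0) (^-multiple 2 -1² 2∣f))
    (sign-unique (neg-nonzero 1≢0) (odd-power h-odd))
    where
    odd-power : (∃ λ k → h ≡ suc (2 ℕ.* k)) → (- 1#) ^ h ≡ - 1#
    odd-power (k , eq) = trans (cong ((- 1#) ^_) eq)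
      (trans (cong (- 1# *_) (^-multiple 2 -1² (k , refl))) (*-identityʳ _))

  class-neg : ∀ {x} → x ≢ 0# → class (- x) ≡ class x ⊞ (0F , 1F)
  class-neg {x} x≢0 = begin
    class (- x)              ≡⟨ cong class (solve 1 (λ x → :- x := x :* (:- :1)) refl x) ⟩
    class (x * - 1#)         ≡⟨ class-* x≢0 (neg-nonzero 1≢0) ⟩
    class x ⊞ class (- 1#)   ≡⟨ cong (class x ⊞_) class-−1 ⟩
    class x ⊞ (0F , 1F)      ∎

  class-*ω̂ : ∀ {x} c → x ≢ 0# → class (x * ω̂ c) ≡ class x
  class-*ω̂ {x} c x≢0 = trans (class-* x≢0 (ω̂-nonzero c)) (trans (cong (class x ⊞_) (class-ω̂ c)) (⊞-identityʳ _))

  cubic-x₀ : cubic x₀ ≡ 1F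
  cubic-x₀ = cubic-unique x₀≢0 x₀^f≡ω

  -- The powers of `x₀` reach every cubic class, and negation corrects the sign without leaving the
  -- cubic class.
  class-surjective : ∀ c → ∃ λ x → x ≢ 0# × class x ≡ c
  class-surjective (a , s) = with-sign (with-cubic a) s
    where
    with-cubic : ∀ a → ∃ λ x → x ≢ 0# × cubic x ≡ a
    with-cubic 0F = 1# , 1≢0 , cong proj₁ class-1
    with-cubic 1F = x₀ , x₀≢0 , cubic-x₀
    with-cubic 2F = x₀ * x₀ , *-nonzero x₀≢0 x₀≢0 ,
      trans (cong proj₁ (class-* x₀≢0 x₀≢0)) (cong (λ c → addFin c c) cubic-x₀)
    with-sign : (∃ λ x → x ≢ 0# × cubic x ≡ a) → ∀ s → ∃ λ x → x ≢ 0# × class x ≡ (a , s)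
    with-sign (x , x≢0 , cx) s with sign x Fin.≟ s
    ... | yes sx = x , x≢0 , cong₂ _,_ cx sx
    ... | no sx≢s = - x , neg-nonzero x≢0 , trans (class-neg x≢0)
      (cong₂ _,_ (trans (cong (λ c → addFin c 0F) cx) (cong proj₁ (⊞-identityʳ (a , 0F)))) (flipped (sign x) s sx≢s))
      where
      flipped : ∀ s t → s ≢ t → addFin s 1F ≡ t
      flipped 0F 0F ne = ⊥-elim (ne refl)
      flipped 0F 1F _ = refl
      flipped 1F 0F _ = refl
      flipped 1F 1F ne = ⊥-elim (ne refl)

-- Cyclotomic numbers of order 3

indicator : ∀ {P : Set} → Dec P → ℕ
indicator (yes _) = 1
indicator (no _) = 0

indicator-yes : ∀ {P : Set} (d : Dec P) → P → indicator d ≡ 1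
indicator-yes (yes _) _ = refl
indicator-yes (no ¬p) p = ⊥-elim (¬p p)

indicator-no : ∀ {P : Set} (d : Dec P) → ¬ P → indicator d ≡ 0
indicator-no (yes p) ¬p = ⊥-elim (¬p p)
indicator-no (no _) _ = refl

indicator-cong : ∀ {P Q : Set} (d : Dec P) (e : Dec Q) → (P → Q) → (Q → P) → indicator d ≡ indicator e
indicator-cong (yes p) e to _ = sym (indicator-yes e (to p))
indicator-cong (no ¬p) e _ from = sym (indicator-no e (¬p ∘ from))

module Convolution (K : FiniteField) where
  open FieldProperties K
  open FieldSums K ℕ.+-0-commutativeMonoid public
  import Algebra.Properties.Semiring.Sum ℕ.+-*-semiring as S

  *-distribˡ-total : ∀ c h → c ℕ.* total h ≡ total (λ x → c ℕ.* h x)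
  *-distribˡ-total c h = S.*-distribˡ-sum c (h ∘ Inverse.from enum)

  *-distribʳ-total : ∀ c h → total h ℕ.* c ≡ total (λ x → h x ℕ.* c)
  *-distribʳ-total c h = S.*-distribʳ-sum c (h ∘ Inverse.from enum)

  total-mono : ∀ {h h′} → (∀ x → h x ≤ h′ x) → total h ≤ total h′
  total-mono {h} {h′} h≤h′ = go order (h ∘ Inverse.from enum) (h′ ∘ Inverse.from enum) (h≤h′ ∘ Inverse.from enum)
    where
    go : ∀ n (s t : Fin n → ℕ) → (∀ i → s i ≤ t i) → S.sum s ≤ S.sum t
    go zero _ _ _ = z≤n
    go (suc n) s t s≤t = ℕ.+-mono-≤ (s≤t zero) (go n (s ∘ suc) (t ∘ suc) (s≤t ∘ suc))

  total-translate : ∀ h c → total h ≡ total (λ x → h (x + c))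
  total-translate h c = total-permute h (_+ c) (_- c)
    (λ x → solve 2 (λ x c → (x :- c) :+ c := x) refl x c)
    (λ x → solve 2 (λ x c → (x :+ c) :- c := x) refl x c)

  total-negate : ∀ h → total h ≡ total (λ x → h (- x))
  total-negate h = total-permute h -_ -_ -‿involutive -‿involutive

  total-reflect : ∀ h c → total h ≡ total (λ x → h (c - x))
  total-reflect h c = total-permute h (λ x → c - x) (λ x → c - x) involutive involutive
    where
    involutive : ∀ x → c - (c - x) ≡ x
    involutive x = solve 2 (λ x c → c :- (c :- x) := x) refl x c

  total-scale : ∀ h {c} → c ≢ 0# → total h ≡ total (λ x → h (x * c))
  total-scale h {c} c≢0 = total-permute h (_* c) (_* inv c)
    (λ x → trans (*-assoc _ _ _) (trans (cong (x *_) (*-inverseˡ c≢0)) (*-identityʳ x)))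
    (λ x → trans (*-assoc _ _ _) (trans (cong (x *_) (*-inverseʳ c≢0)) (*-identityʳ x)))

  total-invert : ∀ h → total h ≡ total (λ x → h (inv x))
  total-invert h = total-permute h inv inv inv-involutive inv-involutive

  total-point : ∀ c → total (λ x → indicator (x ≟ c)) ≡ 1
  total-point c = total-single c 1 _ (indicator-yes (c ≟ c) refl) (λ y y≢c → indicator-no (y ≟ c) y≢c)

  conv : (Carrier → ℕ) → (Carrier → ℕ) → Carrier → ℕ
  conv u v z = total (λ x → u x ℕ.* v (z - x))

  Even : (Carrier → ℕ) → Set
  Even u = ∀ x → u (- x) ≡ u x

  -- Both sides count x + y ≡ x′ + y′, alias x − x′ ≡ y′ − y.
  conv-second-moment : ∀ u v → Even u → Even v →
    total (λ z → conv u v z ℕ.* conv u v z) ≡ total (λ z → conv u u z ℕ.* conv v v z)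
  conv-second-moment u v u-even v-even = begin
    total (λ z → conv u v z ℕ.* conv u v z)
      ≡⟨ total-cong (λ z → trans (*-distribʳ-total (conv u v z) (λ x → u x ℕ.* v (z - x))) (total-cong (λ x →
           trans (*-distribˡ-total (u x ℕ.* v (z - x)) (λ y → u y ℕ.* v (z - y)))
             (total-cong (λ y → interchange (u x) (v (z - x)) (u y) (v (z - y))))))) ⟩
    total (λ z → total (λ x → total (λ y → (u x ℕ.* u y) ℕ.* (v (z - x) ℕ.* v (z - y)))))
      ≡⟨ total-swap (λ z x → total (λ y → (u x ℕ.* u y) ℕ.* (v (z - x) ℕ.* v (z - y)))) ⟩
    total (λ x → total (λ z → total (λ y → (u x ℕ.* u y) ℕ.* (v (z - x) ℕ.* v (z - y)))))
      ≡⟨ total-cong (λ x → total-swap (λ z y → (u x ℕ.* u y) ℕ.* (v (z - x) ℕ.* v (z - y)))) ⟩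
    total (λ x → total (λ y → total (λ z → (u x ℕ.* u y) ℕ.* (v (z - x) ℕ.* v (z - y)))))
      ≡⟨ total-cong (λ x → total-cong (λ y → trans
           (sym (*-distribˡ-total (u x ℕ.* u y) (λ z → v (z - x) ℕ.* v (z - y))))
           (cong (u x ℕ.* u y ℕ.*_) (correlation x y)))) ⟩
    total (λ x → total (λ y → (u x ℕ.* u y) ℕ.* conv v v (y - x)))
      ≡⟨ total-cong (λ x → trans (total-translate (λ y → (u x ℕ.* u y) ℕ.* conv v v (y - x)) x)
           (total-cong (λ w → cong (λ s → (u x ℕ.* u (w + x)) ℕ.* conv v v s)
             (solve 2 (λ w x → (w :+ x) :- x := w) refl w x)))) ⟩
    total (λ x → total (λ w → (u x ℕ.* u (w + x)) ℕ.* conv v v w))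
      ≡⟨ total-swap (λ x w → (u x ℕ.* u (w + x)) ℕ.* conv v v w) ⟩
    total (λ w → total (λ x → (u x ℕ.* u (w + x)) ℕ.* conv v v w))
      ≡⟨ total-cong (λ w → sym (*-distribʳ-total (conv v v w) (λ x → u x ℕ.* u (w + x)))) ⟩
    total (λ w → total (λ x → u x ℕ.* u (w + x)) ℕ.* conv v v w)
      ≡⟨ total-cong (λ w → cong (ℕ._* conv v v w) (trans (total-negate (λ x → u x ℕ.* u (w + x)))
           (total-cong (λ x → cong (ℕ._* u (w - x)) (u-even x))))) ⟩
    total (λ w → conv u u w ℕ.* conv v v w) ∎
    where
    open ≡-Reasoning
    interchange : ∀ a b c d → (a ℕ.* b) ℕ.* (c ℕ.* d) ≡ (a ℕ.* c) ℕ.* (b ℕ.* d)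
    interchange = solve-∀
    correlation : ∀ x y → total (λ z → v (z - x) ℕ.* v (z - y)) ≡ conv v v (y - x)
    correlation x y = trans (total-translate (λ z → v (z - x) ℕ.* v (z - y)) x) (total-cong (λ z →
      cong₂ ℕ._*_ (cong v (solve 2 (λ z x → (z :+ x) :- x := z) refl z x))
        (trans (cong v (solve 3 (λ x y z → (z :+ x) :- y := :- ((y :- x) :- z)) refl x y z)) (v-even ((y - x) - z)))))

module CyclotomicNumbers where
  open import Data.Nat using (_+_; _*_)

  -- The rows give d = a + 1 and n = s + d with s = b + c, and then the second moment becomes (s -
  -- 2d)² + 3 (b - c)² = 4d. With q = 3n + 1 this is the representation 4q = L² + 27M² for L = 3 (s
  -- - 2d) + 2 and M = b - c. The bound 4d + 6 ≤ n would force s - 2d ≥ d + 6, whose square exceeds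
  -- 4d.
  cyclotomic-contradiction : ∀ {n a b c d} → a + b + c + 1 ≡ n → b + c + d ≡ n →
    n * (d * d + b * b + c * c) ≡ n * n + n * (c * b + a * c + b * a) →
    4 * d + 6 ≤ n → ⊥
  cyclotomic-contradiction {n} {a} {b} {c} {d} row₀ row₁ moment d≤n = ℕ.<⇒≱ 4d<t² t²≤4d
    where
    s = b + c
    n≡s+d : n ≡ s + d
    n≡s+d = sym row₁
    d≡1+a : d ≡ suc a
    d≡1+a = ℕ.+-cancelˡ-≡ s d (suc a) (trans row₁ (trans (sym row₀) (arith a b c)))
      where
      arith : ∀ a b c → a + b + c + 1 ≡ (b + c) + suc a
      arith = solve-∀
    1≤n : 1 ≤ n
    1≤n = subst (1 ≤_) row₀ (ℕ.m≤n+m 1 (a + b + c))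
    moment′ : d * d + b * b + c * c ≡ n + (c * b + a * c + b * a)
    moment′ = ℕ.*-cancelˡ-≡ _ _ n ⦃ ℕ.>-nonZero 1≤n ⦄ (trans moment (sym (ℕ.*-distribˡ-+ n n _)))
    2bc≤ordered : ∀ b e → 2 * (b * (b + e)) ≤ b * b + (b + e) * (b + e)
    2bc≤ordered b e = subst (2 * (b * (b + e)) ≤_) (arith b e) (ℕ.m≤m+n _ (e * e))
      where
      arith : ∀ b e → 2 * (b * (b + e)) + e * e ≡ b * b + (b + e) * (b + e)
      arith = solve-∀
    2bc≤ : ∀ b c → 2 * (b * c) ≤ b * b + c * c
    2bc≤ b c with ℕ.≤-total b c
    ... | inj₁ b≤c = subst (λ x → 2 * (b * x) ≤ b * b + x * x) (ℕ.m+[n∸m]≡n b≤c) (2bc≤ordered b (c ℕ.∸ b))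
    ... | inj₂ c≤b = subst (λ x → 2 * (x * c) ≤ x * x + c * c) (ℕ.m+[n∸m]≡n c≤b)
        (subst₂ _≤_ (cong (2 ℕ.*_) (ℕ.*-comm c (c + (b ℕ.∸ c)))) (ℕ.+-comm (c * c) _) (2bc≤ordered c (b ℕ.∸ c)))
    -- By `d≤n` the truncated subtraction is exact, and t is s - 2d.
    k t : ℕ
    k = n ℕ.∸ (4 * d + 6)
    t = d + 6 + k
    s≡2d+t : s ≡ 2 * d + t
    s≡2d+t = ℕ.+-cancelʳ-≡ d s (2 * d + t) (trans row₁ (trans (sym (ℕ.m+[n∸m]≡n d≤n)) (arith d k)))
      where
      arith : ∀ d k → 4 * d + 6 + k ≡ 2 * d + (d + 6 + k) + d
      arith = solve-∀
    4d<t² : 4 * d < t * t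
    4d<t² = subst (4 * d <_) (arith d k) (ℕ.m<m+n (4 * d) (s≤s z≤n))
      where
      arith : ∀ d k → 4 * d + suc (35 + d * d + 8 * d + 2 * (d + 6) * k + k * k)
                ≡ (d + 6 + k) * (d + 6 + k)
      arith = solve-∀
    -- The two sides differ by the dropped term 3 (b - c)².
    bound : s * s + 4 * (d * d) + 4 * (b * c) ≤ 4 * (n + (c * b + a * c + b * a))
    bound = begin
      s * s + 4 * (d * d) + 4 * (b * c)
        ≡⟨ arith₁ b c (d * d) ⟩
      b * b + c * c + 4 * (d * d) + 3 * (2 * (b * c))
        ≤⟨ ℕ.+-monoʳ-≤ (b * b + c * c + 4 * (d * d)) (ℕ.*-monoʳ-≤ 3 (2bc≤ b c)) ⟩
      b * b + c * c + 4 * (d * d) + 3 * (b * b + c * c)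
        ≡⟨ arith₂ (b * b) (c * c) (d * d) ⟩
      4 * (d * d + b * b + c * c)
        ≡⟨ cong (4 ℕ.*_) moment′ ⟩
      4 * (n + (c * b + a * c + b * a)) ∎
      where
      open ℕ.≤-Reasoning
      arith₁ : ∀ b c dd → (b + c) * (b + c) + 4 * dd + 4 * (b * c)
                          ≡ b * b + c * c + 4 * dd + 3 * (2 * (b * c))
      arith₁ = solve-∀
      arith₂ : ∀ bb cc dd → bb + cc + 4 * dd + 3 * (bb + cc) ≡ 4 * (dd + bb + cc)
      arith₂ = solve-∀
    t²≤4d : t * t ≤ 4 * d
    t²≤4d = ℕ.+-cancelʳ-≤ (8 * (d * d) + 4 * (d * t) + 4 * (b * c)) (t * t) (4 * d) (begin
      t * t + (8 * (d * d) + 4 * (d * t) + 4 * (b * c))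
        ≡⟨ arith₁ t d (b * c) ⟩
      (2 * d + t) * (2 * d + t) + 4 * (d * d) + 4 * (b * c)
        ≡⟨ cong (λ s → s * s + 4 * (d * d) + 4 * (b * c)) s≡2d+t ⟨
      s * s + 4 * (d * d) + 4 * (b * c)
        ≤⟨ bound ⟩
      4 * (n + (c * b + a * c + b * a))
        ≡⟨ cong (λ n → 4 * (n + (c * b + a * c + b * a))) (trans n≡s+d (cong (s ℕ.+_) d≡1+a)) ⟩
      4 * (s + suc a + (c * b + a * c + b * a))
        ≡⟨ arith₂ a b c ⟩
      4 * (suc a * s) + 4 * suc a + 4 * (b * c)
        ≡⟨ cong (λ d → 4 * (d * s) + 4 * d + 4 * (b * c)) d≡1+a ⟨
      4 * (d * s) + 4 * d + 4 * (b * c)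
        ≡⟨ cong (λ s → 4 * (d * s) + 4 * d + 4 * (b * c)) s≡2d+t ⟩
      4 * (d * (2 * d + t)) + 4 * d + 4 * (b * c)
        ≡⟨ arith₃ t d (b * c) ⟩
      4 * d + (8 * (d * d) + 4 * (d * t) + 4 * (b * c)) ∎)
      where
      open ℕ.≤-Reasoning
      arith₁ : ∀ t d bc → t * t + (8 * (d * d) + 4 * (d * t) + 4 * bc)
                 ≡ (2 * d + t) * (2 * d + t) + 4 * (d * d) + 4 * bc
      arith₁ = solve-∀
      arith₂ : ∀ a b c → 4 * ((b + c) + suc a + (c * b + a * c + b * a))
                 ≡ 4 * (suc a * (b + c)) + 4 * suc a + 4 * (b * c)
      arith₂ = solve-∀
      arith₃ : ∀ t d bc → 4 * (d * (2 * d + t)) + 4 * d + 4 * bc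
                 ≡ 4 * d + (8 * (d * d) + 4 * (d * t) + 4 * bc)
      arith₃ = solve-∀

module CyclotomicCounting (K : FiniteField) (m : ℕ) (order≡ : FiniteField.order K ≡ 19 ℕ.+ 36 ℕ.* m) where
  open ≡-Reasoning
  open FieldProperties K
  open SexticClasses K m order≡
  open Convolution K

  cubic-neg : ∀ {x} → x ≢ 0# → cubic (- x) ≡ cubic x
  cubic-neg {x} x≢0 = cong proj₁ (trans (class-neg x≢0) (cong (_, addFin (sign x) 1F) (cong proj₁ (⊞-identityʳ (class x)))))

  cubic-* : ∀ {x y} → x ≢ 0# → y ≢ 0# → cubic (x * y) ≡ addFin (cubic x) (cubic y)
  cubic-* x≢0 y≢0 = cong proj₁ (class-* x≢0 y≢0)

  Member : Fin 3 → Carrier → Set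
  Member i x = x ≢ 0# × cubic x ≡ i

  member? : ∀ i x → Dec (Member i x)
  member? i x = ¬? (x ≟ 0#) ×-dec (cubic x Fin.≟ i)

  ⟦_⟧ : Fin 3 → Carrier → ℕ
  ⟦ i ⟧ x = indicator (member? i x)

  ⟦⟧-even : ∀ i → Even ⟦ i ⟧
  ⟦⟧-even i x = indicator-cong (member? i (- x)) (member? i x)
    (λ { (-x≢0 , c) → subst (Member i) (-‿involutive x) (neg-nonzero -x≢0 , trans (cubic-neg -x≢0) c) })
    (λ { (x≢0 , c) → neg-nonzero x≢0 , trans (cubic-neg x≢0) c })

  ⟦⟧-scale : ∀ i {l c} x → c ≢ 0# → cubic c ≡ l → ⟦ addFin i l ⟧ (x * c) ≡ ⟦ i ⟧ x
  ⟦⟧-scale i {l} {c} x c≢0 refl = indicator-cong (member? _ (x * c)) (member? i x)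
    (λ { (xc≢0 , e) → nonzeroˡ xc≢0 , addFin-cancelʳ _ i l (trans (sym (cubic-* (nonzeroˡ xc≢0) c≢0)) e) })
    (λ { (x≢0 , e) → *-nonzero x≢0 c≢0 , trans (cubic-* x≢0 c≢0) (cong (λ k → addFin k l) e) })

  ⟦⟧-0 : ∀ i → ⟦ i ⟧ 0# ≡ 0
  ⟦⟧-0 i = indicator-no (member? i 0#) (λ { (0≢0 , _) → 0≢0 refl })

  ⟦⟧-partition : ∀ x → ⟦ 0F ⟧ x ℕ.+ ⟦ 1F ⟧ x ℕ.+ ⟦ 2F ⟧ x ℕ.+ indicator (x ≟ 0#) ≡ 1
  ⟦⟧-partition x with x ≟ 0# | cubic x
  ... | yes refl | _ = refl
  ... | no _ | 0F = refl
  ... | no _ | 1F = refl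
  ... | no _ | 2F = refl

  ⟦⟧-idem : ∀ i x → ⟦ i ⟧ x ℕ.* ⟦ i ⟧ x ≡ ⟦ i ⟧ x
  ⟦⟧-idem i x with member? i x
  ... | yes _ = refl
  ... | no _ = refl

  R : Fin 3 → Fin 3 → Carrier → ℕ
  R i j = conv ⟦ i ⟧ ⟦ j ⟧

  -- The cyclotomic number (i, j) of order 3. Counting x + y = 1 instead of y = x + 1 makes no
  -- difference because -1 is a cube, and it makes the symmetry in i and j evident.
  N : Fin 3 → Fin 3 → ℕ
  N i j = R i j 1#

  -- Dividing x + y = z by z lowers both cubic classes by that of z.
  R-scale : ∀ i j l {z} → z ≢ 0# → cubic z ≡ l → R (addFin i l) (addFin j l) z ≡ N i j
  R-scale i j l {z} z≢0 cz = trans (total-scale (λ x → ⟦ addFin i l ⟧ x ℕ.* ⟦ addFin j l ⟧ (z - x)) z≢0)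
    (total-cong (λ x → cong₂ ℕ._*_ (⟦⟧-scale i x z≢0 cz)
      (trans (cong ⟦ addFin j l ⟧ (solve 2 (λ x z → z :- x :* z := (:1 :- x) :* z) refl x z)) (⟦⟧-scale j (1# - x) z≢0 cz))))

  N-sym : ∀ i j → N i j ≡ N j i
  N-sym i j = trans (total-reflect (λ x → ⟦ i ⟧ x ℕ.* ⟦ j ⟧ (1# - x)) 1#)
    (total-cong (λ x → trans (cong (λ y → ⟦ i ⟧ (1# - x) ℕ.* ⟦ j ⟧ y) (solve 1 (λ x → :1 :- (:1 :- x) := x) refl x))
      (ℕ.*-comm (⟦ i ⟧ (1# - x)) (⟦ j ⟧ x))))

  -- The substitution x ↦ 1 / x.
  N-invert : ∀ i j l → addFin i l ≡ 0F → N i (addFin j i) ≡ N l j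
  N-invert i j l i+l≡0 = trans (total-invert (λ x → ⟦ i ⟧ x ℕ.* ⟦ addFin j i ⟧ (1# - x))) (total-cong pointwise)
    where
    pointwise : ∀ x → ⟦ i ⟧ (inv x) ℕ.* ⟦ addFin j i ⟧ (1# - inv x) ≡ ⟦ l ⟧ x ℕ.* ⟦ j ⟧ (1# - x)
    pointwise x = case x ≟ 0# of λ { (yes x≡0) → at-zero x≡0 ; (no x≢0) → away x≢0 }
      where
      at-zero : x ≡ 0# → ⟦ i ⟧ (inv x) ℕ.* ⟦ addFin j i ⟧ (1# - inv x) ≡ ⟦ l ⟧ x ℕ.* ⟦ j ⟧ (1# - x)
      at-zero refl = trans
        (cong (ℕ._* ⟦ addFin j i ⟧ (1# - inv 0#)) (trans (cong ⟦ i ⟧ inv-0) (⟦⟧-0 i)))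
        (sym (cong (ℕ._* ⟦ j ⟧ (1# - 0#)) (⟦⟧-0 l)))
      away : x ≢ 0# → ⟦ i ⟧ (inv x) ℕ.* ⟦ addFin j i ⟧ (1# - inv x) ≡ ⟦ l ⟧ x ℕ.* ⟦ j ⟧ (1# - x)
      away x≢0 = go (member? l x)
        where
        x⁻¹≢0 : inv x ≢ 0#
        x⁻¹≢0 = inv-nonzero x≢0
        sum≡0 : addFin (cubic (inv x)) (cubic x) ≡ 0F
        sum≡0 = trans (sym (cubic-* x⁻¹≢0 x≢0)) (trans (cong cubic (*-inverseˡ x≢0)) (cong proj₁ class-1))
        to : cubic x ≡ l → cubic (inv x) ≡ i
        to refl = addFin-cancelʳ _ _ l (trans sum≡0 (sym i+l≡0))
        from : cubic (inv x) ≡ i → cubic x ≡ l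
        from refl = addFin-cancelʳ _ _ i (trans (ModularRing.addFin-comm 2 (cubic x) i)
          (trans sum≡0 (trans (sym i+l≡0) (ModularRing.addFin-comm 2 i l))))
        go : Dec (Member l x) → ⟦ i ⟧ (inv x) ℕ.* ⟦ addFin j i ⟧ (1# - inv x) ≡ ⟦ l ⟧ x ℕ.* ⟦ j ⟧ (1# - x)
        go (no ¬l) = trans
          (cong (ℕ._* ⟦ addFin j i ⟧ (1# - inv x)) (indicator-no (member? i (inv x)) (λ { (_ , e) → ¬l (x≢0 , from e) })))
          (sym (cong (ℕ._* ⟦ j ⟧ (1# - x)) (indicator-no (member? l x) ¬l)))
        go (yes (_ , cx)) = cong₂ ℕ._*_
          (trans (indicator-yes (member? i (inv x)) (x⁻¹≢0 , to cx)) (sym (indicator-yes (member? l x) (x≢0 , cx))))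
          (trans (cong ⟦ addFin j i ⟧ flip-sides) (trans (⟦⟧-scale j (- (1# - x)) x⁻¹≢0 (to cx)) (⟦⟧-even j (1# - x))))
          where
          flip-sides : 1# - inv x ≡ - (1# - x) * inv x
          flip-sides = begin
            1# - inv x             ≡⟨ cong (_- inv x) (*-inverseʳ x≢0) ⟨
            x * inv x - inv x      ≡⟨ solve 2 (λ x y → x :* y :- y := :- (:1 :- x) :* y) refl x (inv x) ⟩
            - (1# - x) * inv x     ∎

  n : ℕ
  n = total ⟦ 0F ⟧

  -- Multiplication by `x₀`, whose cubic class is 1F, carries each class onto the next.
  size : ∀ i → total ⟦ i ⟧ ≡ n
  size i = subst (λ i → total ⟦ i ⟧ ≡ n) (cyclic i) (rotated (toℕ i))
    where
    shift : Fin 3 → Fin 3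
    shift i = addFin i 1F
    step : ∀ i → total ⟦ shift i ⟧ ≡ total ⟦ i ⟧
    step i = trans (total-scale ⟦ shift i ⟧ x₀≢0) (total-cong (λ x → ⟦⟧-scale i x x₀≢0 cubic-x₀))
    rotation : ℕ → Fin 3
    rotation zero = 0F
    rotation (suc k) = shift (rotation k)
    rotated : ∀ k → total ⟦ rotation k ⟧ ≡ n
    rotated zero = refl
    rotated (suc k) = trans (step (rotation k)) (rotated k)
    cyclic : ∀ i → rotation (toℕ i) ≡ i
    cyclic 0F = refl
    cyclic 1F = refl
    cyclic 2F = refl

  -- By N-sym and N-invert, the other cyclotomic numbers of order 3 equal one of these.
  a b c d : ℕ
  a = N 0F 0F
  b = N 0F 1F
  c = N 0F 2F
  d = N 1F 2F

  -- The element 1 - x lies in exactly one cubic class unless x = 1, and this exception is the last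
  -- summand.
  N-row : ∀ i → N i 0F ℕ.+ N i 1F ℕ.+ N i 2F ℕ.+ ⟦ i ⟧ 1# ≡ n
  N-row i = begin
    N i 0F ℕ.+ N i 1F ℕ.+ N i 2F ℕ.+ ⟦ i ⟧ 1#
      ≡⟨ cong (λ s → N i 0F ℕ.+ N i 1F ℕ.+ N i 2F ℕ.+ s) point ⟩
    N i 0F ℕ.+ N i 1F ℕ.+ N i 2F ℕ.+ total q
      ≡⟨ cong (λ s → s ℕ.+ N i 2F ℕ.+ total q) (total-distrib (p 0F) (p 1F)) ⟨
    total (λ x → p 0F x ℕ.+ p 1F x) ℕ.+ N i 2F ℕ.+ total q
      ≡⟨ cong (ℕ._+ total q) (total-distrib (λ x → p 0F x ℕ.+ p 1F x) (p 2F)) ⟨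
    total (λ x → p 0F x ℕ.+ p 1F x ℕ.+ p 2F x) ℕ.+ total q
      ≡⟨ total-distrib (λ x → p 0F x ℕ.+ p 1F x ℕ.+ p 2F x) q ⟨
    total (λ x → p 0F x ℕ.+ p 1F x ℕ.+ p 2F x ℕ.+ q x)
      ≡⟨ total-cong (λ x → trans (factor (⟦ i ⟧ x) (⟦ 0F ⟧ (1# - x)) (⟦ 1F ⟧ (1# - x)) (⟦ 2F ⟧ (1# - x)) (indicator (1# - x ≟ 0#)))
           (trans (cong (⟦ i ⟧ x ℕ.*_) (⟦⟧-partition (1# - x))) (ℕ.*-identityʳ (⟦ i ⟧ x)))) ⟩
    total ⟦ i ⟧
      ≡⟨ size i ⟩
    n ∎
    where
    p : Fin 3 → Carrier → ℕ
    p j x = ⟦ i ⟧ x ℕ.* ⟦ j ⟧ (1# - x)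
    q : Carrier → ℕ
    q x = ⟦ i ⟧ x ℕ.* indicator (1# - x ≟ 0#)
    factor : ∀ u x y z w → u ℕ.* x ℕ.+ u ℕ.* y ℕ.+ u ℕ.* z ℕ.+ u ℕ.* w ≡ u ℕ.* (x ℕ.+ y ℕ.+ z ℕ.+ w)
    factor = solve-∀
    point : ⟦ i ⟧ 1# ≡ total q
    point = sym (total-single 1# (⟦ i ⟧ 1#) q
      (trans (cong (⟦ i ⟧ 1# ℕ.*_) (indicator-yes (1# - 1# ≟ 0#) (-‿inverseʳ 1#))) (ℕ.*-identityʳ (⟦ i ⟧ 1#)))
      (λ y y≢1 → trans (cong (⟦ i ⟧ y ℕ.*_) (indicator-no (1# - y ≟ 0#) (λ e → y≢1 (sym (x-y≡0⇒x≡y e))))) (ℕ.*-zeroʳ (⟦ i ⟧ y))))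

  row₀ : a ℕ.+ b ℕ.+ c ℕ.+ 1 ≡ n
  row₀ = trans (cong (a ℕ.+ b ℕ.+ c ℕ.+_) (sym (indicator-yes (member? 0F 1#) (1≢0 , cong proj₁ class-1)))) (N-row 0F)

  N₂₂≡b : N 2F 2F ≡ b
  N₂₂≡b = trans (N-invert 2F 0F 1F refl) (N-sym 1F 0F)

  N₁₁≡c : N 1F 1F ≡ c
  N₁₁≡c = trans (N-invert 1F 0F 2F refl) (N-sym 2F 0F)

  row₁ : b ℕ.+ c ℕ.+ d ≡ n
  row₁ = begin
    b ℕ.+ c ℕ.+ d                             ≡⟨ cong₂ (λ x y → x ℕ.+ y ℕ.+ d) (N-sym 0F 1F) (sym N₁₁≡c) ⟩
    N 1F 0F ℕ.+ N 1F 1F ℕ.+ N 1F 2F           ≡⟨ ℕ.+-identityʳ _ ⟨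
    N 1F 0F ℕ.+ N 1F 1F ℕ.+ N 1F 2F ℕ.+ 0
      ≡⟨ cong (N 1F 0F ℕ.+ N 1F 1F ℕ.+ N 1F 2F ℕ.+_) (indicator-no (member? 1F 1#) (λ { (_ , e) → Fin.0≢1+n (trans (sym (cong proj₁ class-1)) e) })) ⟨
    N 1F 0F ℕ.+ N 1F 1F ℕ.+ N 1F 2F ℕ.+ ⟦ 1F ⟧ 1#
      ≡⟨ N-row 1F ⟩
    n ∎

  total-by-class : ∀ {h : Carrier → ℕ} (H : Fin 3 → ℕ) → (∀ {z} l → z ≢ 0# → cubic z ≡ l → h z ≡ H l) →
                   total h ≡ h 0# ℕ.+ n ℕ.* (H 0F ℕ.+ H 1F ℕ.+ H 2F)
  total-by-class {h} H eq = begin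
    total h
      ≡⟨ total-cong pointwise ⟩
    total (λ z → δ z ℕ.+ (p 0F z ℕ.+ p 1F z ℕ.+ p 2F z))
      ≡⟨ total-distrib δ (λ z → p 0F z ℕ.+ p 1F z ℕ.+ p 2F z) ⟩
    total δ ℕ.+ total (λ z → p 0F z ℕ.+ p 1F z ℕ.+ p 2F z)
      ≡⟨ cong₂ ℕ._+_ total-δ (trans (total-distrib (λ z → p 0F z ℕ.+ p 1F z) (p 2F)) (cong (ℕ._+ total (p 2F)) (total-distrib (p 0F) (p 1F)))) ⟩
    h 0# ℕ.+ (total (p 0F) ℕ.+ total (p 1F) ℕ.+ total (p 2F))
      ≡⟨ cong (h 0# ℕ.+_) (cong₂ ℕ._+_ (cong₂ ℕ._+_ (part 0F) (part 1F)) (part 2F)) ⟩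
    h 0# ℕ.+ (n ℕ.* H 0F ℕ.+ n ℕ.* H 1F ℕ.+ n ℕ.* H 2F)
      ≡⟨ cong (h 0# ℕ.+_) (factor n (H 0F) (H 1F) (H 2F)) ⟩
    h 0# ℕ.+ n ℕ.* (H 0F ℕ.+ H 1F ℕ.+ H 2F) ∎
    where
    factor : ∀ n x y z → n ℕ.* x ℕ.+ n ℕ.* y ℕ.+ n ℕ.* z ≡ n ℕ.* (x ℕ.+ y ℕ.+ z)
    factor = solve-∀
    p : Fin 3 → Carrier → ℕ
    p i z = ⟦ i ⟧ z ℕ.* H i
    δ : Carrier → ℕ
    δ z = indicator (z ≟ 0#) ℕ.* h 0#
    part : ∀ i → total (p i) ≡ n ℕ.* H i
    part i = trans (sym (*-distribʳ-total (H i) ⟦ i ⟧)) (cong (ℕ._* H i) (size i))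
    total-δ : total δ ≡ h 0#
    total-δ = trans (sym (*-distribʳ-total (h 0#) (λ z → indicator (z ≟ 0#)))) (trans (cong (ℕ._* h 0#) (total-point 0#)) (ℕ.+-identityʳ _))
    pointwise : ∀ z → h z ≡ δ z ℕ.+ (p 0F z ℕ.+ p 1F z ℕ.+ p 2F z)
    pointwise z with z ≟ 0# | cubic z in cz
    ... | yes refl | _ = sym (trans (ℕ.+-identityʳ _) (ℕ.+-identityʳ _))
    ... | no z≢0 | 0F = trans (eq 0F z≢0 cz) (sym (trans (ℕ.+-identityʳ _) (trans (ℕ.+-identityʳ _) (ℕ.+-identityʳ _))))
    ... | no z≢0 | 1F = trans (eq 1F z≢0 cz) (sym (trans (ℕ.+-identityʳ _) (ℕ.+-identityʳ _)))
    ... | no z≢0 | 2F = trans (eq 2F z≢0 cz) (sym (ℕ.+-identityʳ _))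

  R-0-disjoint : ∀ i j → i ≢ j → R i j 0# ≡ 0
  R-0-disjoint i j i≢j = trans (total-cong (λ x → trans (cong (⟦ i ⟧ x ℕ.*_)
      (trans (cong ⟦ j ⟧ (+-identityˡ (- x))) (⟦⟧-even j x))) (disjoint x))) total-ε
    where
    disjoint : ∀ x → ⟦ i ⟧ x ℕ.* ⟦ j ⟧ x ≡ 0
    disjoint x with member? i x
    ... | no _ = refl
    ... | yes (_ , e) = trans (ℕ.+-identityʳ _) (indicator-no (member? j x) (λ { (_ , e′) → i≢j (trans (sym e) e′) }))

  R-0-same : ∀ i → R i i 0# ≡ n
  R-0-same i = trans (total-cong (λ x → trans (cong (⟦ i ⟧ x ℕ.*_)
      (trans (cong ⟦ i ⟧ (+-identityˡ (- x))) (⟦⟧-even i x))) (⟦⟧-idem i x))) (size i)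

  -- The second moment identity for the cubic classes 1 and 2, evaluated class by class. The term n
  -- * n is the contribution of z = 0: x and -x share their class, so 0 is a sum of two elements of
  -- one class in n ways and never a sum of elements of different classes.
  moment : n ℕ.* (d ℕ.* d ℕ.+ b ℕ.* b ℕ.+ c ℕ.* c) ≡ n ℕ.* n ℕ.+ n ℕ.* (c ℕ.* b ℕ.+ a ℕ.* c ℕ.+ b ℕ.* a)
  moment = begin
    n ℕ.* (d ℕ.* d ℕ.+ b ℕ.* b ℕ.+ c ℕ.* c)
      ≡⟨ cong (λ r → r ℕ.* r ℕ.+ n ℕ.* (d ℕ.* d ℕ.+ b ℕ.* b ℕ.+ c ℕ.* c)) (R-0-disjoint 1F 2F λ ()) ⟨
    R 1F 2F 0# ℕ.* R 1F 2F 0# ℕ.+ n ℕ.* (d ℕ.* d ℕ.+ b ℕ.* b ℕ.+ c ℕ.* c)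
      ≡⟨ total-by-class H (λ l z≢0 cz → cong₂ ℕ._*_ (R₁₂ l z≢0 cz) (R₁₂ l z≢0 cz)) ⟨
    total (λ z → R 1F 2F z ℕ.* R 1F 2F z)
      ≡⟨ conv-second-moment ⟦ 1F ⟧ ⟦ 2F ⟧ (⟦⟧-even 1F) (⟦⟧-even 2F) ⟩
    total (λ z → R 1F 1F z ℕ.* R 2F 2F z)
      ≡⟨ total-by-class H′ (λ l z≢0 cz → cong₂ ℕ._*_ (R₁₁ l z≢0 cz) (R₂₂ l z≢0 cz)) ⟩
    R 1F 1F 0# ℕ.* R 2F 2F 0# ℕ.+ n ℕ.* (c ℕ.* b ℕ.+ a ℕ.* c ℕ.+ b ℕ.* a)
      ≡⟨ cong₂ (λ r s → r ℕ.* s ℕ.+ n ℕ.* (c ℕ.* b ℕ.+ a ℕ.* c ℕ.+ b ℕ.* a)) (R-0-same 1F) (R-0-same 2F) ⟩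
    n ℕ.* n ℕ.+ n ℕ.* (c ℕ.* b ℕ.+ a ℕ.* c ℕ.+ b ℕ.* a) ∎
    where
    h₁₂ h₁₁ h₂₂ H H′ : Fin 3 → ℕ
    h₁₂ 0F = d
    h₁₂ 1F = b
    h₁₂ 2F = c
    h₁₁ 0F = c
    h₁₁ 1F = a
    h₁₁ 2F = b
    h₂₂ 0F = b
    h₂₂ 1F = c
    h₂₂ 2F = a
    H l = h₁₂ l ℕ.* h₁₂ l
    H′ l = h₁₁ l ℕ.* h₂₂ l
    R₁₂ : ∀ {z} l → z ≢ 0# → cubic z ≡ l → R 1F 2F z ≡ h₁₂ l
    R₁₂ 0F z≢0 cz = R-scale 1F 2F 0F z≢0 cz
    R₁₂ 1F z≢0 cz = R-scale 0F 1F 1F z≢0 cz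
    R₁₂ 2F z≢0 cz = trans (R-scale 2F 0F 2F z≢0 cz) (N-sym 2F 0F)
    R₁₁ : ∀ {z} l → z ≢ 0# → cubic z ≡ l → R 1F 1F z ≡ h₁₁ l
    R₁₁ 0F z≢0 cz = trans (R-scale 1F 1F 0F z≢0 cz) N₁₁≡c
    R₁₁ 1F z≢0 cz = R-scale 0F 0F 1F z≢0 cz
    R₁₁ 2F z≢0 cz = trans (R-scale 2F 2F 2F z≢0 cz) N₂₂≡b
    R₂₂ : ∀ {z} l → z ≢ 0# → cubic z ≡ l → R 2F 2F z ≡ h₂₂ l
    R₂₂ 0F z≢0 cz = trans (R-scale 2F 2F 0F z≢0 cz) N₂₂≡b
    R₂₂ 1F z≢0 cz = trans (R-scale 1F 1F 1F z≢0 cz) N₁₁≡c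
    R₂₂ 2F z≢0 cz = R-scale 0F 0F 2F z≢0 cz

-- Admissible parameters that are no sixth powers

module GoodParameters (K : FiniteField) (m : ℕ) (order≡ : FiniteField.order K ≡ 19 ℕ.+ 36 ℕ.* m) where
  open FieldProperties K
  open PowerResidues K using (search)
  open SexticClasses K m order≡
  open Convolution K
  open CyclotomicCounting K m order≡ renaming (⟦_⟧ to 𝟙[_])

  θ : Carrier
  θ = ω - 1#

  θ≢0 : θ ≢ 0#
  θ≢0 eq = 1≢ω (sym (x-y≡0⇒x≡y eq))

  record Admissible (t : Carrier) : Set where
    field
      t≢0 : t ≢ 0#
      t-ω̂≢0 : ∀ i → t - ω̂ i ≢ 0#
      cubic-distinct : ∀ {i j} → cubic (t - ω̂ i) ≡ cubic (t - ω̂ j) → i ≡ j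

  Split : Fin 3 → Fin 3 → Carrier → Set
  Split i j x = Member i x × Member j (1# - x)

  split? : ∀ i j x → Dec (Split i j x)
  split? i j x = member? i x ×-dec member? j (1# - x)

  -- The Möbius transformation with 1 ↦ 1, ∞ ↦ ω and 0 ↦ ω². It translates the condition that t - 1,
  -- t - ω, t - ω² have distinct cubic classes into one on x and 1 - x. Since `inv 0#` is `0#`, the
  -- pole -ω is sent to ω, the value missed otherwise, and `τ` permutes the carrier.
  τ : Carrier → Carrier
  τ x = ω + (1# - ω * ω) * inv (x + ω)

  -- Up to sign and a common factor, the numbers τ x − ω̂ k are 1 − x, ω² and ω x.
  module Candidate {x i j} (x∈ : Split i j x) (i≢0 : i ≢ 0F)
                   (distinct : ∀ {k l} → Vec.lookup (j ∷ 0F ∷ i ∷ []) k ≡ Vec.lookup (j ∷ 0F ∷ i ∷ []) l → k ≡ l) where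
    x≢0 : x ≢ 0#
    x≢0 = proj₁ (proj₁ x∈)

    1-x≢0 : 1# - x ≢ 0#
    1-x≢0 = proj₁ (proj₂ x∈)

    -- This keeps x away from the pole -ω of `τ` and from its zero -ω², as -1 and `ω` are cubes.
    cubic≢0⇒x≢−ω̂ : ∀ k → x ≢ - ω̂ k
    cubic≢0⇒x≢−ω̂ k refl = i≢0 (trans (sym (proj₂ (proj₁ x∈))) (trans (cubic-neg (ω̂-nonzero k)) (cong proj₁ (class-ω̂ k))))

    u : Carrier
    u = x + ω

    u≢0 : u ≢ 0#
    u≢0 eq = cubic≢0⇒x≢−ω̂ 1F (begin
      x             ≡⟨ solve 2 (λ x w → x := (x :+ w) :+ (:- w)) refl x ω ⟩
      u + - ω       ≡⟨ cong (_+ - ω) eq ⟩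
      0# + - ω      ≡⟨ +-identityˡ _ ⟩
      - ω           ∎)
      where open ≡-Reasoning

    y : Fin 3 → Carrier
    y 0F = - (1# - x)
    y 1F = ω * ω
    y 2F = - (ω * x)

    y≢0 : ∀ k → y k ≢ 0#
    y≢0 0F = neg-nonzero 1-x≢0
    y≢0 1F = ω̂-nonzero 2F
    y≢0 2F = neg-nonzero (*-nonzero ω≢0 x≢0)

    cubic-y : ∀ k → cubic (y k) ≡ Vec.lookup (j ∷ 0F ∷ i ∷ []) k
    cubic-y 0F = trans (cubic-neg 1-x≢0) (proj₂ (proj₂ x∈))
    cubic-y 1F = cong proj₁ (class-ω̂ 2F)
    cubic-y 2F = trans (cubic-neg (*-nonzero ω≢0 x≢0)) (trans (cubic-* ω≢0 x≢0)
      (trans (cong₂ addFin (cong proj₁ (class-ω̂ 1F)) (proj₂ (proj₁ x∈))) (ModularRing.addFin-identityˡ 2 i)))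

    v : Carrier
    v = inv u

    factor : ∀ k → τ x - ω̂ k ≡ (θ * v) * y k
    factor 0F = begin
      ω + (1# - ω * ω) * v - 1#
        ≡⟨ solve 2 (λ w v → w :+ (:1 :- w :* w) :* v :- :1 := (w :- :1) :* :1 :+ (:1 :- w :* w) :* v) refl ω v ⟩
      θ * 1# + (1# - ω * ω) * v
        ≡⟨ cong (λ s → θ * s + (1# - ω * ω) * v) (*-inverseʳ u≢0) ⟨
      θ * (u * v) + (1# - ω * ω) * v
        ≡⟨ solve 3 (λ x w v → (w :- :1) :* ((x :+ w) :* v) :+ (:1 :- w :* w) :* v := ((w :- :1) :* v) :* (:- (:1 :- x))) refl x ω v ⟩
      (θ * v) * - (1# - x) ∎
      where open ≡-Reasoning
    factor 1F = modulo-ω-relation (v - ω * v)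
      (solve 2 (λ w v → w :+ (:1 :- w :* w) :* v :- w
         := ((w :- :1) :* v) :* (w :* w) :+ (v :- w :* v) :* (:1 :+ w :+ w :* w)) refl ω v)
    factor 2F = begin
      ω + (1# - ω * ω) * v - ω * ω
        ≡⟨ solve 2 (λ w v → w :+ (:1 :- w :* w) :* v :- w :* w := (w :- w :* w) :* :1 :+ (:1 :- w :* w) :* v) refl ω v ⟩
      (ω - ω * ω) * 1# + (1# - ω * ω) * v
        ≡⟨ cong (λ s → (ω - ω * ω) * s + (1# - ω * ω) * v) (*-inverseʳ u≢0) ⟨
      (ω - ω * ω) * (u * v) + (1# - ω * ω) * v
        ≡⟨ modulo-ω-relation (v - ω * v)
             (solve 3 (λ x w v → (w :- w :* w) :* ((x :+ w) :* v) :+ (:1 :- w :* w) :* v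
                := ((w :- :1) :* v) :* (:- (w :* x)) :+ (v :- w :* v) :* (:1 :+ w :+ w :* w)) refl x ω v) ⟩
      (θ * v) * - (ω * x) ∎
      where open ≡-Reasoning

    θv≢0 : θ * v ≢ 0#
    θv≢0 = *-nonzero θ≢0 (inv-nonzero u≢0)

    τ-ω̂≢0 : ∀ k → τ x - ω̂ k ≢ 0#
    τ-ω̂≢0 k eq = *-nonzero θv≢0 (y≢0 k) (trans (sym (factor k)) eq)

    τ-cubic-distinct : ∀ {k l} → cubic (τ x - ω̂ k) ≡ cubic (τ x - ω̂ l) → k ≡ l
    τ-cubic-distinct {k} {l} eq = distinct (trans (sym (cubic-y k)) (trans
      (addFin-cancelʳ (cubic (y k)) (cubic (y l)) (cubic (θ * v))
        (trans (sym (expand k)) (trans eq (expand l))))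
      (cubic-y l)))
      where
      expand : ∀ k → cubic (τ x - ω̂ k) ≡ addFin (cubic (y k)) (cubic (θ * v))
      expand k = trans (cong cubic (factor k)) (trans (cubic-* θv≢0 (y≢0 k)) (ModularRing.addFin-comm 2 (cubic (θ * v)) (cubic (y k))))

    τ≢0 : τ x ≢ 0#
    τ≢0 eq = cubic≢0⇒x≢−ω̂ 2F (modulo-ω-relation ((1# - ω) * x) (begin
      x
        ≡⟨ solve 2 (λ x w → x := (w :* w) :* (w :* (x :+ w) :+ (:1 :- w :* w)) :+
              (:- (w :* w) :+ ((:1 :- w) :* x) :* (:1 :+ w :+ w :* w))) refl x ω ⟩
      (ω * ω) * (ω * u + (1# - ω * ω)) + (- (ω * ω) + ((1# - ω) * x) * (1# + ω + ω * ω))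
        ≡⟨ cong (λ s → (ω * ω) * s + (- (ω * ω) + ((1# - ω) * x) * (1# + ω + ω * ω))) clear ⟩
      (ω * ω) * 0# + (- (ω * ω) + ((1# - ω) * x) * (1# + ω + ω * ω))
        ≡⟨ trans (cong (_+ (- (ω * ω) + ((1# - ω) * x) * (1# + ω + ω * ω))) (zeroʳ (ω * ω))) (+-identityˡ _) ⟩
      - (ω * ω) + ((1# - ω) * x) * (1# + ω + ω * ω) ∎))
      where
      open ≡-Reasoning
      clear : ω * u + (1# - ω * ω) ≡ 0#
      clear = begin
        ω * u + (1# - ω * ω)                  ≡⟨ cong (ω * u +_) (*-identityʳ _) ⟨
        ω * u + (1# - ω * ω) * 1#             ≡⟨ cong (λ s → ω * u + (1# - ω * ω) * s) (*-inverseˡ u≢0) ⟨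
        ω * u + (1# - ω * ω) * (v * u)        ≡⟨ solve 3 (λ w u v → w :* u :+ (:1 :- w :* w) :* (v :* u) := (w :+ (:1 :- w :* w) :* v) :* u) refl ω u v ⟩
        τ x * u                               ≡⟨ cong (_* u) eq ⟩
        0# * u                                ≡⟨ zeroˡ u ⟩
        0#                                    ∎

    admissible : Admissible (τ x)
    admissible = record { t≢0 = τ≢0 ; t-ω̂≢0 = τ-ω̂≢0 ; cubic-distinct = τ-cubic-distinct }

  τ-admissible : ∀ {x} → Split 1F 2F x ⊎ Split 2F 1F x → Admissible (τ x)
  τ-admissible (inj₁ s) = Candidate.admissible s (λ ()) (λ {k} {l} → toWitness {a? = distinct? Fin._≟_ (2F ∷ 0F ∷ 1F ∷ [])} tt k l)
  τ-admissible (inj₂ s) = Candidate.admissible s (λ ()) (λ {k} {l} → toWitness {a? = distinct? Fin._≟_ (1F ∷ 0F ∷ 2F ∷ [])} tt k l)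

  sextic? : ∀ s t → Dec (t ≢ 0# × class t ≡ (0F , s))
  sextic? s t = ¬? (t ≟ 0#) ×-dec (class t ≟ᶜ (0F , s))

  q : Fin 2 → Carrier → ℕ
  q s t = indicator (sextic? s t)

  -- Negation preserves the cubes and exchanges the squares and non-squares among them.
  total-sextic : n ≡ total (q 0F) ℕ.+ total (q 0F)
  total-sextic = begin
    n                                      ≡⟨ total-cong split ⟩
    total (λ x → q 0F x ℕ.+ q 1F x)        ≡⟨ total-distrib (q 0F) (q 1F) ⟩
    total (q 0F) ℕ.+ total (q 1F)          ≡⟨ cong (total (q 0F) ℕ.+_) (trans (total-negate (q 1F)) (total-cong negate)) ⟩
    total (q 0F) ℕ.+ total (q 0F)          ∎
    where
    open ≡-Reasoning
    split : ∀ x → 𝟙[ 0F ] x ≡ q 0F x ℕ.+ q 1F x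
    split x with x ≟ 0# | cubic x | sign x
    ... | yes _ | _ | _ = refl
    ... | no _ | 0F | 0F = refl
    ... | no _ | 0F | 1F = refl
    ... | no _ | 1F | 0F = refl
    ... | no _ | 1F | 1F = refl
    ... | no _ | 2F | 0F = refl
    ... | no _ | 2F | 1F = refl
    negate : ∀ x → q 1F (- x) ≡ q 0F x
    negate x = indicator-cong (sextic? 1F (- x)) (sextic? 0F x)
      (λ { (-x≢0 , e) → let x≢0 = subst (_≢ 0#) (-‿involutive x) (neg-nonzero -x≢0) in
           x≢0 , ⊞-cancelʳ (0F , 1F) (trans (sym (class-neg x≢0)) e) })
      (λ { (x≢0 , e) → neg-nonzero x≢0 , trans (class-neg x≢0) (cong (_⊞ (0F , 1F)) e) })

  -- The cube roots of unity are sixth powers that cannot be admissible. Leaving them out produces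
  -- the summand 6 of the final inequality, which settles the case of small d.
  Proper : Carrier → Set
  Proper t = (t ≢ 0# × class t ≡ (0F , 0F)) × t ≢ ω̂ 0F × t ≢ ω̂ 1F × t ≢ ω̂ 2F

  proper? : ∀ t → Dec (Proper t)
  proper? t = sextic? 0F t ×-dec (¬? (t ≟ ω̂ 0F) ×-dec (¬? (t ≟ ω̂ 1F) ×-dec ¬? (t ≟ ω̂ 2F)))

  σ : Carrier → ℕ
  σ t = indicator (proper? t)

  total-proper : total σ ℕ.+ 3 ≡ total (q 0F)
  total-proper = begin
    total σ ℕ.+ 3
      ≡⟨ arith (total σ) ⟩
    total σ ℕ.+ 1 ℕ.+ 1 ℕ.+ 1
      ≡⟨ cong₂ ℕ._+_ (cong₂ ℕ._+_ (cong (total σ ℕ.+_) (sym (total-point (ω̂ 0F)))) (sym (total-point (ω̂ 1F)))) (sym (total-point (ω̂ 2F))) ⟩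
    total σ ℕ.+ total (δ 0F) ℕ.+ total (δ 1F) ℕ.+ total (δ 2F)
      ≡⟨ cong (λ s → s ℕ.+ total (δ 1F) ℕ.+ total (δ 2F)) (total-distrib σ (δ 0F)) ⟨
    total (λ t → σ t ℕ.+ δ 0F t) ℕ.+ total (δ 1F) ℕ.+ total (δ 2F)
      ≡⟨ cong (λ s → s ℕ.+ total (δ 2F)) (total-distrib (λ t → σ t ℕ.+ δ 0F t) (δ 1F)) ⟨
    total (λ t → σ t ℕ.+ δ 0F t ℕ.+ δ 1F t) ℕ.+ total (δ 2F)
      ≡⟨ total-distrib (λ t → σ t ℕ.+ δ 0F t ℕ.+ δ 1F t) (δ 2F) ⟨
    total (λ t → σ t ℕ.+ δ 0F t ℕ.+ δ 1F t ℕ.+ δ 2F t)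
      ≡⟨ total-cong pointwise ⟩
    total (q 0F) ∎
    where
    open ≡-Reasoning
    arith : ∀ s → s ℕ.+ 3 ≡ s ℕ.+ 1 ℕ.+ 1 ℕ.+ 1
    arith = solve-∀
    δ : Fin 3 → Carrier → ℕ
    δ i t = indicator (t ≟ ω̂ i)
    pointwise : ∀ t → σ t ℕ.+ δ 0F t ℕ.+ δ 1F t ℕ.+ δ 2F t ≡ q 0F t
    pointwise t = go (t ≟ ω̂ 0F) (t ≟ ω̂ 1F) (t ≟ ω̂ 2F)
      where
      at-root : ∀ i → t ≡ ω̂ i → t ≢ 0# × class t ≡ (0F , 0F)
      at-root i refl = ω̂-nonzero i , class-ω̂ i
      δ-other : ∀ i j → t ≡ ω̂ i → i ≢ j → δ j t ≡ 0
      δ-other i j refl i≢j = indicator-no (ω̂ i ≟ ω̂ j) (λ e → i≢j (ω̂-injective {i} {j} e))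
      combine : ∀ {s w x y z} → s ≡ w → δ 0F t ≡ x → δ 1F t ≡ y → δ 2F t ≡ z →
                s ℕ.+ δ 0F t ℕ.+ δ 1F t ℕ.+ δ 2F t ≡ w ℕ.+ x ℕ.+ y ℕ.+ z
      combine refl refl refl refl = refl
      root-value : ∀ i → t ≡ ω̂ i → 1 ≡ q 0F t
      root-value i e = sym (indicator-yes (sextic? 0F t) (at-root i e))
      go : Dec (t ≡ ω̂ 0F) → Dec (t ≡ ω̂ 1F) → Dec (t ≡ ω̂ 2F) → σ t ℕ.+ δ 0F t ℕ.+ δ 1F t ℕ.+ δ 2F t ≡ q 0F t
      go (yes e) _ _ = trans (combine (indicator-no (proper? t) (λ { (_ , ne , _) → ne e }))
        (indicator-yes (t ≟ ω̂ 0F) e) (δ-other 0F 1F e λ ()) (δ-other 0F 2F e λ ())) (root-value 0F e)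
      go (no _) (yes e) _ = trans (combine (indicator-no (proper? t) (λ { (_ , _ , ne , _) → ne e }))
        (δ-other 1F 0F e λ ()) (indicator-yes (t ≟ ω̂ 1F) e) (δ-other 1F 2F e λ ())) (root-value 1F e)
      go (no _) (no _) (yes e) = trans (combine (indicator-no (proper? t) (λ { (_ , _ , _ , ne) → ne e }))
        (δ-other 2F 0F e λ ()) (δ-other 2F 1F e λ ()) (indicator-yes (t ≟ ω̂ 2F) e)) (root-value 2F e)
      go (no n₀) (no n₁) (no n₂) = trans (combine
        (indicator-cong (proper? t) (sextic? 0F t) proj₁ (λ s → s , n₀ , n₁ , n₂))
        (indicator-no (t ≟ ω̂ 0F) n₀) (indicator-no (t ≟ ω̂ 1F) n₁) (indicator-no (t ≟ ω̂ 2F) n₂))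
        (trans (ℕ.+-identityʳ _) (trans (ℕ.+-identityʳ _) (ℕ.+-identityʳ _)))

  -- `τ` is a composition of translations, a scaling and `inv`, each a permutation of the carrier.
  total-τ : ∀ h → total h ≡ total (h ∘ τ)
  total-τ h = begin
    total h                                           ≡⟨ total-permute h (λ x → ω + x) (λ x → - ω + x)
        (λ x → solve 2 (λ w x → w :+ (:- w :+ x) := x) refl ω x) (λ x → solve 2 (λ w x → :- w :+ (w :+ x) := x) refl ω x) ⟩
    total (λ x → h (ω + x))                           ≡⟨ total-scale (λ x → h (ω + x)) 1-ω²≢0 ⟩
    total (λ x → h (ω + x * (1# - ω * ω)))            ≡⟨ total-invert (λ x → h (ω + x * (1# - ω * ω))) ⟩
    total (λ x → h (ω + inv x * (1# - ω * ω)))        ≡⟨ total-translate (λ x → h (ω + inv x * (1# - ω * ω))) ω ⟩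
    total (λ x → h (ω + inv (x + ω) * (1# - ω * ω)))  ≡⟨ total-cong (λ x → cong (λ s → h (ω + s)) (*-comm (inv (x + ω)) (1# - ω * ω))) ⟩
    total (h ∘ τ)                                     ∎
    where
    open ≡-Reasoning
    1-ω²≢0 : 1# - ω * ω ≢ 0#
    1-ω²≢0 e = case ω̂-injective {0F} {2F} (x-y≡0⇒x≡y e) of λ ()

  good-parameter : ∃ λ t → Admissible t × class t ≢ (0F , 0F)
  good-parameter = case search (λ x → (split? 1F 2F x ⊎-dec split? 2F 1F x) ×-dec ¬? (class (τ x) ≟ᶜ (0F , 0F))) of λ
    { (yes (x , s , non-sextic)) → τ x , τ-admissible s , non-sextic
    ; (no none) → ⊥-elim (CyclotomicNumbers.cyclotomic-contradiction {n} {a} {b} {c} {d} row₀ row₁ moment (too-many none)) }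
    where
    open ℕ.≤-Reasoning
    -- If all the values of `τ` at the d + d split elements were sixth powers, then, 1, ω and ω² not
    -- being among them, d + d + 3 ≤ n / 2 would follow.
    too-many : ¬ (∃ λ x → (Split 1F 2F x ⊎ Split 2F 1F x) × class (τ x) ≢ (0F , 0F)) → 4 ℕ.* d ℕ.+ 6 ≤ n
    too-many none = begin
      4 ℕ.* d ℕ.+ 6
        ≡⟨ arith d ⟩
      (d ℕ.+ d ℕ.+ 3) ℕ.+ (d ℕ.+ d ℕ.+ 3)
        ≤⟨ ℕ.+-mono-≤ half half ⟩
      total (q 0F) ℕ.+ total (q 0F)
        ≡⟨ total-sextic ⟨
      n ∎
      where
      arith : ∀ d → 4 ℕ.* d ℕ.+ 6 ≡ (d ℕ.+ d ℕ.+ 3) ℕ.+ (d ℕ.+ d ℕ.+ 3)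
      arith = solve-∀
      p : Fin 3 → Fin 3 → Carrier → ℕ
      p i j x = 𝟙[ i ] x ℕ.* 𝟙[ j ] (1# - x)
      all-proper : ∀ {x} → Split 1F 2F x ⊎ Split 2F 1F x → Proper (τ x)
      all-proper {x} s = (t≢0 , sextic) , ≢ω̂ 0F , ≢ω̂ 1F , ≢ω̂ 2F
        where
        open Admissible (τ-admissible s)
        sextic : class (τ x) ≡ (0F , 0F)
        sextic = case class (τ x) ≟ᶜ (0F , 0F) of λ { (no ne) → ⊥-elim (none (x , s , ne)) ; (yes e) → e }
        ≢ω̂ : ∀ i → τ x ≢ ω̂ i
        ≢ω̂ i e = t-ω̂≢0 i (trans (cong (_- ω̂ i) e) (-‿inverseʳ (ω̂ i)))
      p-indicator : ∀ i j x → p i j x ≡ indicator (split? i j x)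
      p-indicator i j x with member? i x | member? j (1# - x)
      ... | yes _ | yes _ = refl
      ... | yes _ | no _ = refl
      ... | no _ | _ = refl
      pointwise : ∀ x → p 1F 2F x ℕ.+ p 2F 1F x ≤ σ (τ x)
      pointwise x = subst₂ (λ k l → k ℕ.+ l ≤ σ (τ x)) (sym (p-indicator 1F 2F x)) (sym (p-indicator 2F 1F x))
        (go (split? 1F 2F x) (split? 2F 1F x))
        where
        one≤ : Split 1F 2F x ⊎ Split 2F 1F x → 1 ≤ σ (τ x)
        one≤ s = ℕ.≤-reflexive (sym (indicator-yes (proper? (τ x)) (all-proper s)))
        go : (s : Dec (Split 1F 2F x)) (s′ : Dec (Split 2F 1F x)) → indicator s ℕ.+ indicator s′ ≤ σ (τ x)
        go (yes ((_ , e) , _)) (yes ((_ , e′) , _)) = case trans (sym e) e′ of λ ()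
        go (yes s) (no _) = one≤ (inj₁ s)
        go (no _) (yes s) = one≤ (inj₂ s)
        go (no _) (no _) = z≤n
      half : d ℕ.+ d ℕ.+ 3 ≤ total (q 0F)
      half = begin
        d ℕ.+ d ℕ.+ 3                                   ≡⟨ cong (λ e → d ℕ.+ e ℕ.+ 3) (N-sym 1F 2F) ⟩
        N 1F 2F ℕ.+ N 2F 1F ℕ.+ 3                       ≡⟨ cong (ℕ._+ 3) (total-distrib (p 1F 2F) (p 2F 1F)) ⟨
        total (λ x → p 1F 2F x ℕ.+ p 2F 1F x) ℕ.+ 3     ≤⟨ ℕ.+-monoˡ-≤ 3 (total-mono pointwise) ⟩
        total (σ ∘ τ) ℕ.+ 3                             ≡⟨ cong (ℕ._+ 3) (total-τ σ) ⟨
        total σ ℕ.+ 3                                   ≡⟨ total-proper ⟩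
        total (q 0F)                                    ∎

-- Base blocks

injective⇒surjective : ∀ {n} (f : Fin n → Fin n) → (∀ {i j} → f i ≡ f j → i ≡ j) → ∀ y → ∃ λ x → f x ≡ y
injective⇒surjective {suc n} f f-inj y = case Fin.any? (λ x → f x Fin.≟ y) of λ
  { (yes found) → found
  ; (no missed) → ⊥-elim (ℕ.1+n≰n (Fin.injective⇒≤ {f = λ x → Fin.punchOut {i = y} {f x} (λ e → missed (x , sym e))}
      (λ {i} {j} e → f-inj (Fin.punchOut-injective (λ e → missed (i , sym e)) (λ e → missed (j , sym e)) e)))) }

fresh : ∀ {m n} → m < n → (f : Fin m → Fin n) → ∃ λ y → ∀ x → f x ≢ y
fresh m<n f = case Fin.any? (λ y → Fin.all? (λ x → ¬? (f x Fin.≟ y))) of λ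
  { (yes found) → found
  ; (no none) → ⊥-elim (ℕ.<⇒≱ m<n (Fin.injective⇒≤ {f = λ y → proj₁ (hit none y)}
      (λ {y} {z} e → trans (sym (proj₂ (hit none y))) (trans (cong f e) (proj₂ (hit none z)))))) }
  where
  hit : ¬ (∃ λ y → ∀ x → f x ≢ y) → ∀ y → ∃ λ x → f x ≡ y
  hit none y = case Fin.any? (λ x → f x Fin.≟ y) of λ
    { (yes found) → found
    ; (no missed) → ⊥-elim (none (y , λ x e → missed (x , e))) }

record Enumeration {A : Set} (P : A → Set) : Set where
  field
    size : ℕ
    elem : Fin size → A
    sound : ∀ i → P (elem i)
    injective : ∀ {i j} → elem i ≡ elem j → i ≡ j
    complete : ∀ {x} → P x → ∃ λ i → elem i ≡ x

enumerate : ∀ n {P : Fin n → Set} → (∀ i → Dec (P i)) → Enumeration P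
enumerate zero P? = record { size = 0 ; elem = λ () ; sound = λ () ; injective = λ { {()} } ; complete = λ { {()} } }
enumerate (suc n) {P} P? = case P? zero of λ { (yes p) → extend p ; (no ¬p) → skip ¬p }
  where
  open Enumeration (enumerate n (P? ∘ suc))
  extend : P zero → Enumeration P
  extend p = record
    { size = suc size
    ; elem = λ { zero → zero ; (suc i) → suc (elem i) }
    ; sound = λ { zero → p ; (suc i) → sound i }
    ; injective = λ { {zero} {zero} _ → refl ; {suc i} {suc j} e → cong suc (injective (Fin.suc-injective e)) }
    ; complete = λ { {zero} _ → zero , refl ; {suc x} q → let i , e = complete q in suc i , cong suc e } }
  skip : ¬ P zero → Enumeration P
  skip ¬p = record
    { size = size
    ; elem = suc ∘ elem
    ; sound = sound
    ; injective = injective ∘ Fin.suc-injective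
    ; complete = λ { {zero} q → ⊥-elim (¬p q) ; {suc x} q → let i , e = complete q in i , cong suc e } }

enumerate-via : ∀ {A : Set} {n} {P : A → Set} → A ↔ Fin n → (∀ x → Dec (P x)) → Enumeration P
enumerate-via {A} {n} {P} A↔Fin P? = record
  { size = size
  ; elem = from ∘ elem
  ; sound = sound
  ; injective = λ {i} {j} e → injective (trans (sym (inverseˡ refl)) (trans (cong to e) (inverseˡ refl)))
  ; complete = λ {x} p → let i , e = complete (subst P (sym (inverseʳ refl)) p) in
      i , trans (cong from e) (inverseʳ refl) }
  where
  open Inverse A↔Fin
  open Enumeration (enumerate n (P? ∘ from))

argmin₃ : (f : Fin 3 → ℕ) → ∃ λ i → ∀ j → f i ≤ f j
argmin₃ f with ℕ.≤-total (f 0F) (f 1F) | ℕ.≤-total (f 0F) (f 2F) | ℕ.≤-total (f 1F) (f 2F)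
... | inj₁ a≤b | inj₁ a≤c | _ = 0F , λ { 0F → ℕ.≤-refl ; 1F → a≤b ; 2F → a≤c }
... | inj₁ a≤b | inj₂ c≤a | _ = 2F , λ { 0F → c≤a ; 1F → ℕ.≤-trans c≤a a≤b ; 2F → ℕ.≤-refl }
... | inj₂ b≤a | _ | inj₁ b≤c = 1F , λ { 0F → b≤a ; 1F → ℕ.≤-refl ; 2F → b≤c }
... | inj₂ b≤a | _ | inj₂ c≤b = 2F , λ { 0F → ℕ.≤-trans c≤b b≤a ; 1F → c≤b ; 2F → ℕ.≤-refl }

-- The blocks (over Fin 3 × G) of one parallel class other than the block Fin 3 × {ε}, up to
-- translation by Fin 3: their second coordinates partition the nonidentity elements of G, and
-- every (d , x) with x ≢ ε is a difference exactly once.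
record Family (G : Set) (_∙_ : G → G → G) (ε : G) : Set₁ where
  field
    Index : Set
    count : ℕ
    index : Index ↔ Fin count
    size : Index → ℕ
    size-3-6 : ∀ k → size k ≡ 3 ⊎ size k ≡ 6
    sizes-occur : ∀ {x} → x ≢ ε → (∃ λ k → size k ≡ 3) × (∃ λ k → size k ≡ 6)
    Point : Index → Set
    point : ∀ k → Point k ↔ Fin (size k)
    label : ∀ {k} → Point k → Fin 3
    pos : ∀ {k} → Point k → G
    pos≢ε : ∀ {k} (p : Point k) → pos p ≢ ε
    pos-surjective : ∀ {x} → x ≢ ε → ∃ λ k → ∃ λ (p : Point k) → pos p ≡ x
    pos-injective : ∀ {k l} (p : Point k) (q : Point l) → pos p ≡ pos q → _≡_ {A = Σ Index Point} (k , p) (l , q)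

  Difference : Fin 3 → G → ∀ {k} → Point k → Point k → Set
  Difference d x p q = label p ≡ addFin d (label q) × pos p ≡ x ∙ pos q

  field
    difference-surjective : ∀ d {x} → x ≢ ε → ∃ λ k → ∃₂ λ (p q : Point k) → Difference d x p q
    difference-injective : ∀ d {x} → x ≢ ε → ∀ {k l} (p q : Point k) (p′ q′ : Point l) →
      Difference d x p q → Difference d x p′ q′ →
      _≡_ {A = Σ Index λ k → Point k × Point k} (k , p , q) (l , p′ , q′)

class-index : Class → Fin 6
class-index (a , s) = Fin.combine a s

class-index-injective : ∀ {c d} → class-index c ≡ class-index d → c ≡ d
class-index-injective {a , s} {b , t} e = cong₂ _,_ (proj₁ (Fin.combine-injective a s b t e)) (proj₂ (Fin.combine-injective a s b t e))

-- Which of the t − ω̂ i the three numerators bω − 1, 1 − bω² and b − 1 are, for b = t ω̂ k.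
eᵢ fᵢ gᵢ : Fin 3 → Fin 3
eᵢ = Vec.lookup (2F ∷ 1F ∷ 0F ∷ [])
fᵢ = Vec.lookup (1F ∷ 0F ∷ 2F ∷ [])
gᵢ = Vec.lookup (0F ∷ 2F ∷ 1F ∷ [])

-- The classes of 1, b, e, f, given β for b and ε for the (t - ω̂ i) / θ. The shift by (0F , 1F) is
-- the sign in 1 - bω² = - (t - ω̂ i) ω̂ j.
quadruple : Class → Vec Class 3 → Fin 3 → Vec Class 4
quadruple β ε k = (0F , 0F) ∷ β ∷ Vec.lookup ε (eᵢ k) ∷ Vec.lookup ε (fᵢ k) ⊞ (0F , 1F) ∷ []

-- Each of the classes (0F , 0F) and β spoils exactly one of the three choices of k.
choose-rotation : ∀ β a b c → β ≢ (0F , 0F) →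
  (∀ i j → Vec.lookup (proj₁ a ∷ proj₁ b ∷ proj₁ c ∷ []) i ≡ Vec.lookup (proj₁ a ∷ proj₁ b ∷ proj₁ c ∷ []) j → i ≡ j) →
  ∃ λ k → ∀ i j → Vec.lookup (quadruple β (a ∷ b ∷ c ∷ []) k) i ≡ Vec.lookup (quadruple β (a ∷ b ∷ c ∷ []) k) j → i ≡ j
choose-rotation (β , β′) (a , a′) (b , b′) (c , c′) = toWitness
  {a? = Fin.all? λ β → Fin.all? λ β′ → Fin.all? λ a → Fin.all? λ a′ → Fin.all? λ b → Fin.all? λ b′ → Fin.all? λ c → Fin.all? λ c′ →
    ¬? ((β , β′) ≟ᶜ (0F , 0F)) →-dec (distinct? Fin._≟_ (a ∷ b ∷ c ∷ []) →-dec
    Fin.any? λ k → distinct? _≟ᶜ_ (quadruple (β , β′) ((a , a′) ∷ (b , b′) ∷ (c , c′) ∷ []) k))}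
  tt β β′ a a′ b b′ c c′

module BaseFamily (K : FiniteField) (m : ℕ) (order≡ : FiniteField.order K ≡ 19 ℕ.+ 36 ℕ.* m) where
  open ≡-Reasoning
  open FieldProperties K
  open SexticClasses K m order≡
  open CyclotomicCounting K m order≡ using (cubic-*; cubic-neg)
  open GoodParameters K m order≡ using (θ; θ≢0; module Admissible; good-parameter)

  abstract
    rank : Carrier → ℕ
    rank x = toℕ (Inverse.to enum x)

    rank-injective : ∀ {x y} → rank x ≡ rank y → x ≡ y
    rank-injective {x} {y} e = trans (sym (Inverse.inverseʳ enum refl))
      (trans (cong (Inverse.from enum) (Fin.toℕ-injective e)) (Inverse.inverseʳ enum refl))

  -- Chooses one element in each orbit of the cube roots of unity on the sixth powers.
  Transversal : Carrier → Set
  Transversal x = x ≢ 0# × class x ≡ (0F , 0F) × (∀ j → rank x ≤ rank (x * ω̂ j))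

  abstract
    transversal : Enumeration Transversal
    transversal = enumerate-via enum (λ x → ¬? (x ≟ 0#) ×-dec ((class x ≟ᶜ (0F , 0F)) ×-dec Fin.all? (λ j → rank x ℕ.≤? rank (x * ω̂ j))))

  module E = Enumeration transversal

  T : Fin E.size → Carrier
  T = E.elem

  T≢0 : ∀ i → T i ≢ 0#
  T≢0 i = proj₁ (E.sound i)

  neg₃ : Fin 3 → Fin 3
  neg₃ = ModularRing.negFin 2

  ω̂-*-* : ∀ x i j → x * ω̂ i * ω̂ j ≡ x * ω̂ (addFin i j)
  ω̂-*-* x i j = trans (*-assoc x (ω̂ i) (ω̂ j)) (cong (x *_) (sym (ω̂-addFin i j)))

  ω̂-cancel : ∀ x i → x * ω̂ i * ω̂ (neg₃ i) ≡ x
  ω̂-cancel x i = trans (ω̂-*-* x i (neg₃ i)) (trans (cong (λ k → x * ω̂ k) (ModularRing.negFin-inverseʳ 2 i)) (*-identityʳ x))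

  sextic-decompose : ∀ {x} → x ≢ 0# → class x ≡ (0F , 0F) → ∃₂ λ i j → T i * ω̂ j ≡ x
  sextic-decompose {x} x≢0 cx = from-minimal (argmin₃ (λ j → rank (x * ω̂ j)))
    where
    from-minimal : (∃ λ j → ∀ k → rank (x * ω̂ j) ≤ rank (x * ω̂ k)) → ∃₂ λ i j → T i * ω̂ j ≡ x
    from-minimal (j , minimal) = case E.complete representative of λ
      { (i , e) → i , neg₃ j , trans (cong (_* ω̂ (neg₃ j)) e) (ω̂-cancel x j) }
      where
      representative : Transversal (x * ω̂ j)
      representative = *-nonzero x≢0 (ω̂-nonzero j) , trans (class-*ω̂ j x≢0) cx ,
        λ k → subst (λ y → rank (x * ω̂ j) ≤ rank y) (sym (ω̂-*-* x j k)) (minimal (addFin j k))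

  -- Both representatives have minimal rank in their common orbit, hence the same rank.
  sextic-unique : ∀ {i j k l} → T i * ω̂ j ≡ T k * ω̂ l → i ≡ k × j ≡ l
  sextic-unique {i} {j} {k} {l} e = i≡k , j≡l i≡k
    where
    rank≤ : ∀ {i j k l} → T i * ω̂ j ≡ T k * ω̂ l → rank (T k) ≤ rank (T i)
    rank≤ {i} {j} {k} {l} e = subst (λ x → rank (T k) ≤ rank x)
      (trans (sym (ω̂-*-* (T k) l (neg₃ j))) (trans (cong (_* ω̂ (neg₃ j)) (sym e)) (ω̂-cancel (T i) j)))
      (proj₂ (proj₂ (E.sound k)) (addFin l (neg₃ j)))
    i≡k : i ≡ k
    i≡k = E.injective (rank-injective (ℕ.≤-antisym (rank≤ {k} {l} {i} {j} (sym e)) (rank≤ {i} {j} {k} {l} e)))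
    j≡l : i ≡ k → j ≡ l
    j≡l refl = ω̂-injective (*-cancelˡ (T≢0 i) e)

  -- Injectivity on classes is enough, as six elements in distinct classes meet all six. The sixth
  -- powers being T ⟨ω⟩ without repetition, every nonzero element is then uniquely
  -- `T i * (D c * ω̂ j)`. The positions and the differences of each label are all counted in this
  -- way.
  record ClassSystem (D : Fin 6 → Carrier) : Set where
    field
      nonzero : ∀ c → D c ≢ 0#
      class-injective : ∀ {c c′} → class (D c) ≡ class (D c′) → c ≡ c′

    decompose : ∀ {x} → x ≢ 0# → ∃ λ i → ∃₂ λ c j → T i * (D c * ω̂ j) ≡ x
    decompose {x} x≢0 = from-class
      (injective⇒surjective (class-index ∘ class ∘ D) (class-injective ∘ class-index-injective) (class-index (class x)))
      where
      from-class : (∃ λ c → class-index (class (D c)) ≡ class-index (class x)) → ∃ λ i → ∃₂ λ c j → T i * (D c * ω̂ j) ≡ x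
      from-class (c , e) = from-sextic (sextic-decompose y≢0 class-y)
        where
        y : Carrier
        y = x * inv (D c)
        y≢0 : y ≢ 0#
        y≢0 = *-nonzero x≢0 (inv-nonzero (nonzero c))
        y*D≡x : y * D c ≡ x
        y*D≡x = trans (*-assoc _ _ _) (trans (cong (x *_) (*-inverseˡ (nonzero c))) (*-identityʳ x))
        class-y : class y ≡ (0F , 0F)
        class-y = ⊞-cancelʳ (class (D c)) (begin
          class y ⊞ class (D c)      ≡⟨ class-* y≢0 (nonzero c) ⟨
          class (y * D c)            ≡⟨ cong class y*D≡x ⟩
          class x                    ≡⟨ class-index-injective e ⟨
          class (D c)                ≡⟨ ⊞-identityʳ _ ⟨
          class (D c) ⊞ (0F , 0F)    ≡⟨ ⊞-comm (class (D c)) (0F , 0F) ⟩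
          (0F , 0F) ⊞ class (D c)    ∎)
        from-sextic : (∃₂ λ i j → T i * ω̂ j ≡ y) → ∃ λ i → ∃₂ λ c j → T i * (D c * ω̂ j) ≡ x
        from-sextic (i , j , e′) = i , c , j , (begin
          T i * (D c * ω̂ j)    ≡⟨ solve 3 (λ t d w → t :* (d :* w) := t :* w :* d) refl (T i) (D c) (ω̂ j) ⟩
          T i * ω̂ j * D c      ≡⟨ cong (_* D c) e′ ⟩
          y * D c              ≡⟨ y*D≡x ⟩
          x                    ∎)

    unique : ∀ {i c j i′ c′ j′} → T i * (D c * ω̂ j) ≡ T i′ * (D c′ * ω̂ j′) → i ≡ i′ × c ≡ c′ × j ≡ j′
    unique {i} {c} {j} {i′} {c′} {j′} e = finish (class-injective (trans (sym (class-of i c j)) (trans (cong class e) (class-of i′ c′ j′))))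
      where
      class-of : ∀ i c j → class (T i * (D c * ω̂ j)) ≡ class (D c)
      class-of i c j = begin
        class (T i * (D c * ω̂ j))           ≡⟨ class-* (T≢0 i) (*-nonzero (nonzero c) (ω̂-nonzero j)) ⟩
        class (T i) ⊞ class (D c * ω̂ j)     ≡⟨ cong₂ _⊞_ (proj₁ (proj₂ (E.sound i))) (class-*ω̂ j (nonzero c)) ⟩
        (0F , 0F) ⊞ class (D c)             ≡⟨ trans (⊞-comm (0F , 0F) (class (D c))) (⊞-identityʳ (class (D c))) ⟩
        class (D c)                         ∎
      finish : c ≡ c′ → i ≡ i′ × c ≡ c′ × j ≡ j′
      finish refl = combine (sextic-unique {i} {j} {i′} {j′} (*-cancelˡ (nonzero c) (trans (rearrange i j) (trans e (sym (rearrange i′ j′))))))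
        where
        combine : i ≡ i′ × j ≡ j′ → i ≡ i′ × c ≡ c × j ≡ j′
        combine (i≡ , j≡) = i≡ , refl , j≡
        rearrange : ∀ i j → D c * (T i * ω̂ j) ≡ T i * (D c * ω̂ j)
        rearrange i j = solve 3 (λ t d w → d :* (t :* w) := t :* (d :* w)) refl (T i) (D c) (ω̂ j)

  t : Carrier
  t = proj₁ good-parameter

  open Admissible (proj₁ (proj₂ good-parameter))

  -- Up to sign and a cube root of unity, the elements e, f, g are these ratios in an order that
  -- depends on the rotation `k₀`.
  ratio : Fin 3 → Carrier
  ratio i = (t - ω̂ i) * inv θ

  ratio≢0 : ∀ i → ratio i ≢ 0#
  ratio≢0 i = *-nonzero (t-ω̂≢0 i) (inv-nonzero θ≢0)

  ratio-cubic-injective : ∀ i j → cubic (ratio i) ≡ cubic (ratio j) → i ≡ j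
  ratio-cubic-injective i j e = cubic-distinct (addFin-cancelʳ _ _ (cubic (inv θ))
    (trans (sym (cubic-* (t-ω̂≢0 i) (inv-nonzero θ≢0))) (trans e (cubic-* (t-ω̂≢0 j) (inv-nonzero θ≢0)))))

  ε : Vec Class 3
  ε = class (ratio 0F) ∷ class (ratio 1F) ∷ class (ratio 2F) ∷ []

  lookup-ε : ∀ i → Vec.lookup ε i ≡ class (ratio i)
  lookup-ε 0F = refl
  lookup-ε 1F = refl
  lookup-ε 2F = refl

  abstract
    rotation : ∃ λ k → ∀ i j → Vec.lookup (quadruple (class t) ε k) i ≡ Vec.lookup (quadruple (class t) ε k) j → i ≡ j
    rotation = choose-rotation (class t) (class (ratio 0F)) (class (ratio 1F)) (class (ratio 2F)) (proj₂ (proj₂ good-parameter))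
      (λ i j e → ratio-cubic-injective i j (trans (sym (lookup-cubic i)) (trans e (lookup-cubic j))))
      where
      lookup-cubic : ∀ i → Vec.lookup (cubic (ratio 0F) ∷ cubic (ratio 1F) ∷ cubic (ratio 2F) ∷ []) i ≡ cubic (ratio i)
      lookup-cubic 0F = refl
      lookup-cubic 1F = refl
      lookup-cubic 2F = refl

  k₀ : Fin 3
  k₀ = proj₁ rotation

  b e f g : Carrier
  b = t * ω̂ k₀
  e = (b * ω - 1#) * inv θ
  f = (1# - b * (ω * ω)) * inv θ
  g = (b - 1#) * inv θ

  private
    -- Each numerator is a root of unity times a difference t - ω̂ i. As cube roots of unity are
    -- sixth powers, only the index i and the sign matter for its class; the explicit cofactors
    -- reduce modulo 1 + ω + ω².
    efg-ratio : ∀ k → (∃ λ j → (t * ω̂ k * ω - 1#) ≡ (t - ω̂ (eᵢ k)) * ω̂ j)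
                     × (∃ λ j → (1# - t * ω̂ k * (ω * ω)) ≡ - (t - ω̂ (fᵢ k)) * ω̂ j)
                     × (∃ λ j → (t * ω̂ k - 1#) ≡ (t - ω̂ (gᵢ k)) * ω̂ j)
    efg-ratio 0F =
      (1F , modulo-ω-relation (ω - 1#) (solve 2 (λ t w → t :* :1 :* w :- :1 := (t :- w :* w) :* w :+ (w :- :1) :* (:1 :+ w :+ w :* w)) refl t ω)) ,
      (2F , modulo-ω-relation (- (ω - 1#)) (solve 2 (λ t w → :1 :- t :* :1 :* (w :* w) := (:- (t :- w)) :* (w :* w) :+ (:- (w :- :1)) :* (:1 :+ w :+ w :* w)) refl t ω)) ,
      (0F , solve 1 (λ t → t :* :1 :- :1 := (t :- :1) :* :1) refl t)
    efg-ratio 1F =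
      (2F , modulo-ω-relation (ω - 1#) (solve 2 (λ t w → t :* w :* w :- :1 := (t :- w) :* (w :* w) :+ (w :- :1) :* (:1 :+ w :+ w :* w)) refl t ω)) ,
      (0F , modulo-ω-relation (- (t * (ω - 1#))) (solve 2 (λ t w → :1 :- t :* w :* (w :* w) := (:- (t :- :1)) :* :1 :+ (:- (t :* (w :- :1))) :* (:1 :+ w :+ w :* w)) refl t ω)) ,
      (1F , modulo-ω-relation (ω - 1#) (solve 2 (λ t w → t :* w :- :1 := (t :- w :* w) :* w :+ (w :- :1) :* (:1 :+ w :+ w :* w)) refl t ω))
    efg-ratio 2F =
      (0F , modulo-ω-relation (t * (ω - 1#)) (solve 2 (λ t w → t :* (w :* w) :* w :- :1 := (t :- :1) :* :1 :+ (t :* (w :- :1)) :* (:1 :+ w :+ w :* w)) refl t ω)) ,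
      (1F , modulo-ω-relation (- ((ω - 1#) * (t * ω + 1#))) (solve 2 (λ t w → :1 :- t :* (w :* w) :* (w :* w) := (:- (t :- w :* w)) :* w :+ (:- ((w :- :1) :* (t :* w :+ :1))) :* (:1 :+ w :+ w :* w)) refl t ω)) ,
      (2F , modulo-ω-relation (ω - 1#) (solve 2 (λ t w → t :* (w :* w) :- :1 := (t :- w) :* (w :* w) :+ (w :- :1) :* (:1 :+ w :+ w :* w)) refl t ω))

    proportional : ∀ {x y} j → x ≡ y * ω̂ j → x * inv θ ≡ (y * inv θ) * ω̂ j
    proportional {x} {y} j e = trans (cong (_* inv θ) e) (solve 3 (λ y w v → y :* w :* v := y :* v :* w) refl y (ω̂ j) (inv θ))

  e-ratio : ∃ λ j → e ≡ ratio (eᵢ k₀) * ω̂ j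
  e-ratio = let j , eq = proj₁ (efg-ratio k₀) in j , proportional j eq

  f-ratio : ∃ λ j → f ≡ - ratio (fᵢ k₀) * ω̂ j
  f-ratio = let j , eq = proj₁ (proj₂ (efg-ratio k₀)) in
    j , trans (proportional j eq) (cong (_* ω̂ j) (sym (-‿distribˡ-* _ _)))

  g-ratio : ∃ λ j → g ≡ ratio (gᵢ k₀) * ω̂ j
  g-ratio = let j , eq = proj₂ (proj₂ (efg-ratio k₀)) in j , proportional j eq

  b≢0 : b ≢ 0#
  b≢0 = *-nonzero t≢0 (ω̂-nonzero k₀)

  private
    via : ∀ {x y} → y ≢ 0# → (∃ λ j → x ≡ y * ω̂ j) → x ≢ 0# × class x ≡ class y
    via y≢0 (j , refl) = *-nonzero y≢0 (ω̂-nonzero j) , class-*ω̂ j y≢0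

    e-facts : e ≢ 0# × class e ≡ class (ratio (eᵢ k₀))
    e-facts = via (ratio≢0 (eᵢ k₀)) e-ratio

    f-facts : f ≢ 0# × class f ≡ class (- ratio (fᵢ k₀))
    f-facts = via (neg-nonzero (ratio≢0 (fᵢ k₀))) f-ratio

    g-facts : g ≢ 0# × class g ≡ class (ratio (gᵢ k₀))
    g-facts = via (ratio≢0 (gᵢ k₀)) g-ratio

  four : Fin 4 → Carrier
  four 0F = 1#
  four 1F = b
  four 2F = e
  four 3F = f

  four≢0 : ∀ i → four i ≢ 0#
  four≢0 0F = 1≢0
  four≢0 1F = b≢0
  four≢0 2F = proj₁ e-facts
  four≢0 3F = proj₁ f-facts

  class-four : ∀ i → class (four i) ≡ Vec.lookup (quadruple (class t) ε k₀) i
  class-four 0F = class-1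
  class-four 1F = class-*ω̂ k₀ t≢0
  class-four 2F = trans (proj₂ e-facts) (sym (lookup-ε (eᵢ k₀)))
  class-four 3F = trans (proj₂ f-facts) (trans (class-neg (ratio≢0 (fᵢ k₀))) (cong (_⊞ (0F , 1F)) (sym (lookup-ε (fᵢ k₀)))))

  Distinct : ∀ {n} → (Fin n → Carrier) → Set
  Distinct {n} r = (∀ i → r i ≢ 0#) × (∀ {i j} → class (r i) ≡ class (r j) → i ≡ j)

  four-distinct : Distinct four
  four-distinct = four≢0 , λ {i} {j} eq → proj₂ rotation i j (trans (sym (class-four i)) (trans eq (class-four j)))

  cons : ∀ {n} → Carrier → (Fin n → Carrier) → Fin (suc n) → Carrier
  cons x r zero = x
  cons x r (suc i) = r i

  extend : ∀ {n} (r : Fin n → Carrier) → Distinct r → n < 6 → ∃ λ x → Distinct (cons x r)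
  extend r (r≢0 , r-inj) n<6 = x , nonzero , injective
    where
    missed : ∃ λ y → ∀ i → class-index (class (r i)) ≢ y
    missed = fresh n<6 (class-index ∘ class ∘ r)
    y : Class
    y = Fin.remQuot {3} 2 (proj₁ missed)
    x : Carrier
    x = proj₁ (class-surjective y)
    x-class : class-index (class x) ≡ proj₁ missed
    x-class = trans (cong class-index (proj₂ (proj₂ (class-surjective y)))) (Fin.combine-remQuot {3} 2 (proj₁ missed))
    nonzero : ∀ i → cons x r i ≢ 0#
    nonzero zero = proj₁ (proj₂ (class-surjective y))
    nonzero (suc i) = r≢0 i
    injective : ∀ {i j} → class (cons x r i) ≡ class (cons x r j) → i ≡ j
    injective {zero} {zero} _ = refl
    injective {zero} {suc j} e = ⊥-elim (proj₂ missed j (trans (cong class-index (sym e)) x-class))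
    injective {suc i} {zero} e = ⊥-elim (proj₂ missed i (trans (cong class-index e) x-class))
    injective {suc i} {suc j} e = cong suc (r-inj e)

  abstract
    fifth : ∃ λ x → Distinct (cons x four)
    fifth = extend four four-distinct (s≤s (s≤s (s≤s (s≤s (s≤s z≤n)))))

    sixth : ∃ λ x → Distinct (cons x (cons (proj₁ fifth) four))
    sixth = extend (cons (proj₁ fifth) four) (proj₂ fifth) (s≤s (s≤s (s≤s (s≤s (s≤s (s≤s z≤n))))))

  -- The orbit representatives d₁, d₂, 1, b, e, f.
  rep : Fin 6 → Carrier
  rep = cons (proj₁ sixth) (cons (proj₁ fifth) four)

  rep-system : ClassSystem rep
  rep-system = record { nonzero = proj₁ (proj₂ sixth) ; class-injective = proj₂ (proj₂ sixth) }

  efg : Fin 3 → Carrier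
  efg 0F = e
  efg 1F = f
  efg 2F = g

  efg≢0 : ∀ i → efg i ≢ 0#
  efg≢0 0F = proj₁ e-facts
  efg≢0 1F = proj₁ f-facts
  efg≢0 2F = proj₁ g-facts

  efgᵢ : Fin 3 → Fin 3 → Fin 3
  efgᵢ k i = Vec.lookup (eᵢ k ∷ fᵢ k ∷ gᵢ k ∷ []) i

  efgᵢ-injective : ∀ k i j → efgᵢ k i ≡ efgᵢ k j → i ≡ j
  efgᵢ-injective = toWitness {a? = Fin.all? λ k → distinct? Fin._≟_ (eᵢ k ∷ fᵢ k ∷ gᵢ k ∷ [])} tt

  cubic-efg : ∀ i → cubic (efg i) ≡ cubic (ratio (efgᵢ k₀ i))
  cubic-efg 0F = cong proj₁ (proj₂ e-facts)
  cubic-efg 1F = trans (cong proj₁ (proj₂ f-facts)) (cubic-neg (ratio≢0 (fᵢ k₀)))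
  cubic-efg 2F = cong proj₁ (proj₂ g-facts)

  class-± : ∀ s {x} → x ≢ 0# → ±1 s * x ≢ 0# × class (±1 s * x) ≡ class x ⊞ (0F , s)
  class-± 0F {x} x≢0 = subst (_≢ 0#) (sym (*-identityˡ x)) x≢0 , trans (cong class (*-identityˡ x)) (sym (⊞-identityʳ (class x)))
  class-± 1F {x} x≢0 = *-nonzero (neg-nonzero 1≢0) x≢0 ,
    trans (cong class (solve 1 (λ x → (:- :1) :* x := :- x) refl x)) (class-neg x≢0)

  halve : Fin 6 → Fin 3 × Fin 2
  halve = Fin.remQuot {3} 2

  halve-injective : ∀ c c′ → proj₁ (halve c) ≡ proj₁ (halve c′) → proj₂ (halve c) ≡ proj₂ (halve c′) → c ≡ c′
  halve-injective = toWitness {a? = Fin.all? λ c → Fin.all? λ c′ → (proj₁ (halve c) Fin.≟ proj₁ (halve c′)) →-dec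
    ((proj₂ (halve c) Fin.≟ proj₂ (halve c′)) →-dec (c Fin.≟ c′))} tt

  diff : Fin 3 → Fin 6 → Carrier
  diff 0F c = ±1 (proj₂ (halve c)) * (θ * efg (proj₁ (halve c)))
  diff 1F c = ±1 0F * (θ * rep c)
  diff 2F c = ±1 1F * (θ * rep c)

  private
    module Rep = ClassSystem rep-system

    θrep-system : ∀ s → ClassSystem (λ c → ±1 s * (θ * rep c))
    θrep-system s = record
      { nonzero = λ c → proj₁ (class-± s (θrep≢0 c))
      ; class-injective = λ {c} {c′} eq → Rep.class-injective (⊞-cancelˡ (class θ) (trans (sym (class-* θ≢0 (Rep.nonzero c)))
          (trans (⊞-cancelʳ (0F , s) (trans (sym (proj₂ (class-± s (θrep≢0 c)))) (trans eq (proj₂ (class-± s (θrep≢0 c′))))))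
            (class-* θ≢0 (Rep.nonzero c′))))) }
      where
      θrep≢0 : ∀ c → θ * rep c ≢ 0#
      θrep≢0 c = *-nonzero θ≢0 (Rep.nonzero c)

    -- Distinct cubic classes of e, f, g suffice here: -1 exchanges the two sextic classes inside
    -- each cubic class, so ± e, ± f, ± g meet all six.
    efg-system : ClassSystem (diff 0F)
    efg-system = record
      { nonzero = λ c → proj₁ (class-± (proj₂ (halve c)) (θefg≢0 (proj₁ (halve c))))
      ; class-injective = λ {c} {c′} eq → finish c c′ (trans (sym (class-diff c)) (trans eq (class-diff c′))) }
      where
      θefg≢0 : ∀ i → θ * efg i ≢ 0#
      θefg≢0 i = *-nonzero θ≢0 (efg≢0 i)
      class-diff : ∀ c → class (diff 0F c) ≡ class (θ * efg (proj₁ (halve c))) ⊞ (0F , proj₂ (halve c))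
      class-diff c = proj₂ (class-± (proj₂ (halve c)) (θefg≢0 (proj₁ (halve c))))
      cubic-injective : ∀ i j → cubic (θ * efg i) ≡ cubic (θ * efg j) → i ≡ j
      cubic-injective i j eq = efgᵢ-injective k₀ i j (ratio-cubic-injective _ _ (trans (sym (cubic-efg i)) (trans
        (addFin-cancelʳ _ _ (cubic θ) (trans (expand i) (trans eq (sym (expand j))))) (cubic-efg j))))
        where
        expand : ∀ i → addFin (cubic (efg i)) (cubic θ) ≡ cubic (θ * efg i)
        expand i = trans (ModularRing.addFin-comm 2 (cubic (efg i)) (cubic θ)) (sym (cubic-* θ≢0 (efg≢0 i)))
      finish : ∀ c c′ → class (θ * efg (proj₁ (halve c))) ⊞ (0F , proj₂ (halve c)) ≡
                        class (θ * efg (proj₁ (halve c′))) ⊞ (0F , proj₂ (halve c′)) → c ≡ c′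
      finish c c′ eq = halve-injective c c′ same same-sign
        where
        same : proj₁ (halve c) ≡ proj₁ (halve c′)
        same = cubic-injective _ _ (addFin-cancelʳ _ _ 0F (cong proj₁ eq))
        same-sign : proj₂ (halve c) ≡ proj₂ (halve c′)
        same-sign = cong proj₂ (⊞-cancelˡ {0F , proj₂ (halve c)} {0F , proj₂ (halve c′)} (class (θ * efg (proj₁ (halve c))))
          (trans eq (cong (λ i → class (θ * efg i) ⊞ (0F , proj₂ (halve c′))) (sym same))))

  diff-system : ∀ d → ClassSystem (diff d)
  diff-system 0F = efg-system
  diff-system 1F = θrep-system 0F
  diff-system 2F = θrep-system 1F

  -- For each element of the transversal: the block of size 6, the two triples with constant
  -- label and the two triples with all three labels.
  data Block : Set where
    six : Block
    flat twisted : Fin 2 → Block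

  block : Block ↔ Fin 5
  block = mk↔ₛ′
    (λ { six → 0F ; (flat 0F) → 1F ; (flat 1F) → 2F ; (twisted 0F) → 3F ; (twisted 1F) → 4F })
    (λ { 0F → six ; 1F → flat 0F ; 2F → flat 1F ; 3F → twisted 0F ; 4F → twisted 1F })
    (λ { 0F → refl ; 1F → refl ; 2F → refl ; 3F → refl ; 4F → refl })
    (λ { six → refl ; (flat 0F) → refl ; (flat 1F) → refl ; (twisted 0F) → refl ; (twisted 1F) → refl })

  BlockPoint : Block → Set
  BlockPoint six = Fin 2 × Fin 3
  BlockPoint (flat _) = Fin 3
  BlockPoint (twisted _) = Fin 3

  block-size : Block → ℕ
  block-size six = 6
  block-size (flat _) = 3
  block-size (twisted _) = 3

  blockPoint : ∀ w → BlockPoint w ↔ Fin (block-size w)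
  blockPoint six = ↔-sym (Fin.*↔× {2} {3})
  blockPoint (flat _) = mk↔ₛ′ id id (λ _ → refl) (λ _ → refl)
  blockPoint (twisted _) = mk↔ₛ′ id id (λ _ → refl) (λ _ → refl)

  blockLabel : ∀ w → BlockPoint w → Fin 3
  blockLabel six (_ , j) = j
  blockLabel (flat _) _ = 0F
  blockLabel (twisted _) j = j

  orbit : Σ Block BlockPoint → Fin 6 × Fin 3
  orbit (six , 0F , j) = 2F , j
  orbit (six , 1F , j) = 3F , j
  orbit (flat 0F , j) = 4F , j
  orbit (flat 1F , j) = 5F , j
  orbit (twisted 0F , j) = 0F , j
  orbit (twisted 1F , j) = 1F , j

  orbit⁻¹ : Fin 6 × Fin 3 → Σ Block BlockPoint
  orbit⁻¹ (0F , j) = twisted 0F , j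
  orbit⁻¹ (1F , j) = twisted 1F , j
  orbit⁻¹ (2F , j) = six , 0F , j
  orbit⁻¹ (3F , j) = six , 1F , j
  orbit⁻¹ (4F , j) = flat 0F , j
  orbit⁻¹ (5F , j) = flat 1F , j

  orbit-orbit⁻¹ : ∀ o → orbit (orbit⁻¹ o) ≡ o
  orbit-orbit⁻¹ (0F , _) = refl
  orbit-orbit⁻¹ (1F , _) = refl
  orbit-orbit⁻¹ (2F , _) = refl
  orbit-orbit⁻¹ (3F , _) = refl
  orbit-orbit⁻¹ (4F , _) = refl
  orbit-orbit⁻¹ (5F , _) = refl

  orbit⁻¹-orbit : ∀ p → orbit⁻¹ (orbit p) ≡ p
  orbit⁻¹-orbit (six , 0F , _) = refl
  orbit⁻¹-orbit (six , 1F , _) = refl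
  orbit⁻¹-orbit (flat 0F , _) = refl
  orbit⁻¹-orbit (flat 1F , _) = refl
  orbit⁻¹-orbit (twisted 0F , _) = refl
  orbit⁻¹-orbit (twisted 1F , _) = refl

  value : ∀ w → BlockPoint w → Carrier
  value w p = rep (proj₁ (orbit (w , p))) * ω̂ (proj₂ (orbit (w , p)))

  Pair : Set
  Pair = Σ Block λ w → BlockPoint w × BlockPoint w

  swap : Pair → Pair
  swap (w , p , q) = w , q , p

  next : Fin 3 → Fin 3
  next = addFin 1F

  step : Fin 6 → Fin 3 → Pair
  step 0F k = twisted 0F , next k , k
  step 1F k = twisted 1F , next k , k
  step 2F k = six , (0F , next k) , (0F , k)
  step 3F k = six , (1F , next k) , (1F , k)
  step 4F k = six , (1F , next k) , (0F , k)
  -- The label difference must be 1, so the second point has label k - 1, that is `addFin 2F k`.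
  -- This is the origin of the factor ω² in 1 - bω².
  step 5F k = six , (0F , k) , (1F , addFin 2F k)

  pair : Fin 3 → Fin 6 → Fin 3 → Pair
  pair 0F 0F k = flat 0F , next k , k
  pair 0F 1F k = flat 0F , k , next k
  pair 0F 2F k = flat 1F , next k , k
  pair 0F 3F k = flat 1F , k , next k
  pair 0F 4F k = six , (1F , k) , (0F , k)
  pair 0F 5F k = six , (0F , k) , (1F , k)
  pair 1F c k = step c k
  pair 2F c k = swap (step c k)

  Realizes : Fin 3 → Carrier → Pair → Set
  Realizes d x (w , p , q) = blockLabel w p ≡ addFin d (blockLabel w q) × value w p ≡ x + value w q

  private
    forward : ∀ {x y Δ W} → x ≡ Δ * W + y → x ≡ ±1 0F * Δ * W + y
    forward {y = y} {Δ} {W} eq = trans eq (solve 3 (λ y Δ W → Δ :* W :+ y := :1 :* Δ :* W :+ y) refl y Δ W)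

    backward : ∀ {x y Δ W} → x ≡ Δ * W + y → y ≡ ±1 1F * Δ * W + x
    backward {x} {y} {Δ} {W} eq = trans (solve 3 (λ y Δ W → y := (:- :1) :* Δ :* W :+ (Δ :* W :+ y)) refl y Δ W)
      (cong (±1 1F * Δ * W +_) (sym eq))

    same-orbit : ∀ r k → r * ω̂ (next k) ≡ (θ * r) * ω̂ k + r * ω̂ k
    same-orbit r k = trans (cong (r *_) (ω̂-addFin 1F k))
      (solve 3 (λ r w W → r :* (w :* W) := ((w :- :1) :* r) :* W :+ r :* W) refl r ω (ω̂ k))

    θ-cancel : ∀ x → x ≡ θ * (x * inv θ)
    θ-cancel x = sym (trans (cong (θ *_) (*-comm x (inv θ))) (x*[x⁻¹*y] θ≢0 x))

    e-step : ∀ k → b * ω̂ (next k) ≡ (θ * e) * ω̂ k + 1# * ω̂ k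
    e-step k = trans (cong (b *_) (ω̂-addFin 1F k))
      (trans (solve 3 (λ b w W → b :* (w :* W) := (b :* w :- :1) :* W :+ :1 :* W) refl b ω (ω̂ k))
        (cong (λ x → x * ω̂ k + 1# * ω̂ k) (θ-cancel (b * ω - 1#))))

    f-step : ∀ k → 1# * ω̂ k ≡ (θ * f) * ω̂ k + b * ω̂ (addFin 2F k)
    f-step k = trans (solve 3 (λ b w W → :1 :* W := (:1 :- b :* (w :* w)) :* W :+ b :* (w :* w :* W)) refl b ω (ω̂ k))
      (cong₂ (λ x y → x * ω̂ k + b * y) (θ-cancel (1# - b * (ω * ω))) (sym (ω̂-addFin 2F k)))

    g-step : ∀ k → b * ω̂ k ≡ (θ * g) * ω̂ k + 1# * ω̂ k
    g-step k = trans (solve 2 (λ b W → b :* W := (b :- :1) :* W :+ :1 :* W) refl b (ω̂ k))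
      (cong (λ x → x * ω̂ k + 1# * ω̂ k) (θ-cancel (b - 1#)))

    step-label : ∀ c k → let w , p , q = step c k in blockLabel w p ≡ addFin 1F (blockLabel w q)
    step-label 0F k = refl
    step-label 1F k = refl
    step-label 2F k = refl
    step-label 3F k = refl
    step-label 4F k = refl
    step-label 5F 0F = refl
    step-label 5F 1F = refl
    step-label 5F 2F = refl

    step-value : ∀ c k → let w , p , q = step c k in value w p ≡ (θ * rep c) * ω̂ k + value w q
    step-value 0F k = same-orbit (rep 0F) k
    step-value 1F k = same-orbit (rep 1F) k
    step-value 2F k = same-orbit (rep 2F) k
    step-value 3F k = same-orbit (rep 3F) k
    step-value 4F k = e-step k
    step-value 5F k = f-step k

    reverse-label : ∀ {i j : Fin 3} → i ≡ addFin 1F j → j ≡ addFin 2F i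
    reverse-label {j = 0F} refl = refl
    reverse-label {j = 1F} refl = refl
    reverse-label {j = 2F} refl = refl

  pair-realizes : ∀ d c k → Realizes d (diff d c * ω̂ k) (pair d c k)
  pair-realizes 0F 0F k = refl , forward (same-orbit e k)
  pair-realizes 0F 1F k = refl , backward (same-orbit e k)
  pair-realizes 0F 2F k = refl , forward (same-orbit f k)
  pair-realizes 0F 3F k = refl , backward (same-orbit f k)
  pair-realizes 0F 4F k = sym (ModularRing.addFin-identityˡ 2 k) , forward (g-step k)
  pair-realizes 0F 5F k = sym (ModularRing.addFin-identityˡ 2 k) , backward (g-step k)
  pair-realizes 1F c k = step-label c k , forward (step-value c k)
  pair-realizes 2F c k = reverse-label (step-label c k) , backward (step-value c k)

  private
    successor : (i j : Fin 3) → i ≡ j ⊎ i ≡ next j ⊎ j ≡ next i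
    successor 0F 0F = inj₁ refl
    successor 0F 1F = inj₂ (inj₂ refl)
    successor 0F 2F = inj₂ (inj₁ refl)
    successor 1F 0F = inj₂ (inj₁ refl)
    successor 1F 1F = inj₁ refl
    successor 1F 2F = inj₂ (inj₂ refl)
    successor 2F 0F = inj₂ (inj₂ refl)
    successor 2F 1F = inj₂ (inj₁ refl)
    successor 2F 2F = inj₁ refl

    predecessor : ∀ j → addFin 2F (next j) ≡ j
    predecessor 0F = refl
    predecessor 1F = refl
    predecessor 2F = refl

    Covered : Pair → Set
    Covered π = ∃ λ d → ∃₂ λ c k → pair d c k ≡ π

    -- Two distinct elements of ℤ₃ are consecutive in one of the two orders.
    cover-triple : ∀ {w} d₁ c₁ d₂ c₂ (at : Fin 3 → BlockPoint w) →
      (∀ k → pair d₁ c₁ k ≡ (w , at (next k) , at k)) → (∀ k → pair d₂ c₂ k ≡ (w , at k , at (next k))) →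
      ∀ i j → i ≢ j → Covered (w , at i , at j)
    cover-triple d₁ c₁ d₂ c₂ at up down i j i≢j = case successor i j of λ
      { (inj₁ refl) → ⊥-elim (i≢j refl)
      ; (inj₂ (inj₁ refl)) → d₁ , c₁ , j , up j
      ; (inj₂ (inj₂ refl)) → d₂ , c₂ , i , down i }

  -- Uniqueness of differences rests on this. Every ordered pair of distinct points is some
  -- `pair d c k`, its labels determine d, and its difference `T i * (diff d c * ω̂ k)` then
  -- determines i, c and k.
  pair-covers : ∀ w p q → p ≢ q → Covered (w , p , q)
  pair-covers (twisted 0F) i j = cover-triple 1F 0F 2F 0F id (λ _ → refl) (λ _ → refl) i j
  pair-covers (twisted 1F) i j = cover-triple 1F 1F 2F 1F id (λ _ → refl) (λ _ → refl) i j
  pair-covers (flat 0F) i j = cover-triple 0F 0F 0F 1F id (λ _ → refl) (λ _ → refl) i j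
  pair-covers (flat 1F) i j = cover-triple 0F 2F 0F 3F id (λ _ → refl) (λ _ → refl) i j
  pair-covers six (0F , i) (0F , j) p≢q = cover-triple 1F 2F 2F 2F (0F ,_) (λ _ → refl) (λ _ → refl) i j (λ { refl → p≢q refl })
  pair-covers six (1F , i) (1F , j) p≢q = cover-triple 1F 3F 2F 3F (1F ,_) (λ _ → refl) (λ _ → refl) i j (λ { refl → p≢q refl })
  pair-covers six (1F , i) (0F , j) _ = case successor i j of λ
    { (inj₁ refl) → 0F , 4F , i , refl
    ; (inj₂ (inj₁ refl)) → 1F , 4F , j , refl
    ; (inj₂ (inj₂ refl)) → 2F , 5F , j , cong (λ l → six , (1F , l) , (0F , j)) (predecessor i) }
  pair-covers six (0F , i) (1F , j) _ = case successor i j of λ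
    { (inj₁ refl) → 0F , 5F , i , refl
    ; (inj₂ (inj₁ refl)) → 1F , 5F , i , cong (λ l → six , (0F , i) , (1F , l)) (predecessor j)
    ; (inj₂ (inj₂ refl)) → 2F , 4F , i , refl }

  Index : Set
  Index = Fin E.size × Block

  base-pos : ∀ {k : Index} → BlockPoint (proj₂ k) → Carrier
  base-pos {i , w} p = T i * value w p

  private
    translate : ∀ i {x y z} → x ≡ y + z → T i * x ≡ T i * y + T i * z
    translate i {x} {y} {z} eq = trans (cong (T i *_) eq) (solve 3 (λ t y z → t :* (y :+ z) := t :* y :+ t :* z) refl (T i) y z)

    nonempty : Fin E.size
    nonempty = proj₁ (sextic-decompose 1≢0 class-1)

    nonzero-point : ∀ i w p → T i * value w p ≢ 0#
    nonzero-point i w p = *-nonzero (T≢0 i) (*-nonzero (Rep.nonzero (proj₁ (orbit (w , p)))) (ω̂-nonzero (proj₂ (orbit (w , p)))))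

    IndexedPoint : Set
    IndexedPoint = Σ Index λ k → BlockPoint (proj₂ k)

    place : Fin E.size → Σ Block BlockPoint → IndexedPoint
    place i (w , p) = (i , w) , p

    point-injective : ∀ i w p i′ w′ p′ → T i * value w p ≡ T i′ * value w′ p′ → place i (w , p) ≡ place i′ (w′ , p′)
    point-injective i w p i′ w′ p′ eq = finish (Rep.unique eq)
      where
      finish : i ≡ i′ × proj₁ (orbit (w , p)) ≡ proj₁ (orbit (w′ , p′)) × proj₂ (orbit (w , p)) ≡ proj₂ (orbit (w′ , p′)) →
        place i (w , p) ≡ place i′ (w′ , p′)
      finish (i≡ , o≡ , j≡) = subst₂ (λ π π′ → place i π ≡ place i′ π′) (orbit⁻¹-orbit (w , p)) (orbit⁻¹-orbit (w′ , p′))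
        (cong₂ place i≡ (cong orbit⁻¹ (cong₂ _,_ o≡ j≡)))

    point-surjective : ∀ {x} → x ≢ 0# → ∃ λ (k : Index) → ∃ λ p → base-pos {k} p ≡ x
    point-surjective {x} x≢0 = located (Rep.decompose x≢0)
      where
      located : (∃ λ i → ∃₂ λ c j → T i * (rep c * ω̂ j) ≡ x) → ∃ λ (k : Index) → ∃ λ p → base-pos {k} p ≡ x
      located (i , c , j , eq) = (i , proj₁ (orbit⁻¹ (c , j))) , proj₂ (orbit⁻¹ (c , j)) ,
        trans (cong (λ o → T i * (rep (proj₁ o) * ω̂ (proj₂ o))) (orbit-orbit⁻¹ (c , j))) eq

    Realized : Fin 3 → Carrier → Set
    Realized d x = ∃ λ (k : Index) → ∃₂ λ p q →
      blockLabel (proj₂ k) p ≡ addFin d (blockLabel (proj₂ k) q) × base-pos {k} p ≡ x + base-pos {k} q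

    difference-exists : ∀ d {x} → x ≢ 0# → Realized d x
    difference-exists d {x} x≢0 = located (ClassSystem.decompose (diff-system d) x≢0)
      where
      located : (∃ λ i → ∃₂ λ c k → T i * (diff d c * ω̂ k) ≡ x) → Realized d x
      located (i , c , k , eq) = found (pair d c k) (pair-realizes d c k)
        where
        found : ∀ π → Realizes d (diff d c * ω̂ k) π → Realized d x
        found (w , p , q) (label-eq , pos-eq) = (i , w) , p , q , label-eq ,
          trans (translate i pos-eq) (cong (_+ T i * value w q) eq)

    Triple : Set
    Triple = Σ Index λ k → BlockPoint (proj₂ k) × BlockPoint (proj₂ k)

    triple : Fin E.size → Pair → Triple
    triple i (w , p , q) = (i , w) , p , q

    Decoded : Fin 3 → Carrier → Fin E.size → Triple → Set
    Decoded d x i π = ∃₂ λ c k → triple i (pair d c k) ≡ π × x ≡ T i * (diff d c * ω̂ k)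

    decode : ∀ d {x} → x ≢ 0# → ∀ i w p q → blockLabel w p ≡ addFin d (blockLabel w q) →
             T i * value w p ≡ x + T i * value w q → Decoded d x i (triple i (w , p , q))
    decode d {x} x≢0 i w p q label-eq pos-eq = result (pair-covers w p q p≢q)
      where
      p≢q : p ≢ q
      p≢q refl = x≢0 (+-cancelʳ (T i * value w p) x 0# (trans (sym pos-eq) (sym (+-identityˡ _))))
      result : Covered (w , p , q) → Decoded d x i (triple i (w , p , q))
      result (d′ , c , k , eq) = matched (addFin-cancelʳ d′ d (blockLabel w q) (trans (sym (proj₁ realized)) label-eq))
        where
        realized : Realizes d′ (diff d′ c * ω̂ k) (w , p , q)
        realized = subst (Realizes d′ (diff d′ c * ω̂ k)) eq (pair-realizes d′ c k)
        matched : d′ ≡ d → Decoded d x i (triple i (w , p , q))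
        matched refl = c , k , cong (triple i) eq ,
          +-cancelʳ (T i * value w q) _ _ (trans (sym pos-eq) (translate i (proj₂ realized)))

    difference-unique : ∀ d {x i i′ π π′} → Decoded d x i π → Decoded d x i′ π′ → π ≡ π′
    difference-unique d {x} {i} {i′} {π} {π′} (c , k , eq , x-eq) (c′ , k′ , eq′ , x-eq′) =
      finish (ClassSystem.unique (diff-system d) (trans (sym x-eq) x-eq′))
      where
      finish : i ≡ i′ × c ≡ c′ × k ≡ k′ → π ≡ π′
      finish (refl , refl , refl) = trans (sym eq) eq′

  family : Family Carrier _+_ 0#
  family = record
    { Index = Index
    ; count = E.size ℕ.* 5
    ; index = ↔-trans (mk↔ₛ′ (λ (i , w) → i , Inverse.to block w) (λ (i , w) → i , Inverse.from block w)
        (λ (i , w) → cong (i ,_) (Inverse.inverseˡ block refl)) (λ (i , w) → cong (i ,_) (Inverse.inverseʳ block refl)))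
        (↔-sym (Fin.*↔× {E.size} {5}))
    ; size = block-size ∘ proj₂
    ; size-3-6 = λ { (_ , six) → inj₂ refl ; (_ , flat _) → inj₁ refl ; (_ , twisted _) → inj₁ refl }
    ; sizes-occur = λ _ → ((nonempty , flat 0F) , refl) , ((nonempty , six) , refl)
    ; Point = BlockPoint ∘ proj₂
    ; point = blockPoint ∘ proj₂
    ; label = λ {k} → blockLabel (proj₂ k)
    ; pos = λ {k} → base-pos {k}
    ; pos≢ε = λ {k} p → nonzero-point (proj₁ k) (proj₂ k) p
    ; pos-surjective = point-surjective
    ; pos-injective = λ {k} {l} p q eq → point-injective (proj₁ k) (proj₂ k) p (proj₁ l) (proj₂ l) q eq
    ; difference-surjective = difference-exists
    ; difference-injective = λ d x≢0 {k} {l} p q p′ q′ (label-eq , pos-eq) (label-eq′ , pos-eq′) →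
        difference-unique d (decode d x≢0 (proj₁ k) (proj₂ k) p q label-eq pos-eq)
          (decode d x≢0 (proj₁ l) (proj₂ l) p′ q′ label-eq′ pos-eq′)
    }

-- Products of families

record FiniteAbelianGroup (G : Set) (_∙_ : G → G → G) : Set where
  field
    ε : G
    _⁻¹ : G → G
    isAbelianGroup : IsAbelianGroup _≡_ _∙_ ε _⁻¹
    order : ℕ
    enum : G ↔ Fin order

  open IsAbelianGroup isAbelianGroup public using (assoc; comm; identityˡ; identityʳ; inverseˡ; inverseʳ; isGroup)

  group : Group 0ℓ 0ℓ
  group = record { isGroup = isGroup }

  open Algebra.Properties.Group group public using (∙-cancelʳ; ∙-cancelˡ; //-rightDividesˡ; \\-leftDividesˡ)

  infix 4 _≟_
  _≟_ : (x y : G) → Dec (x ≡ y)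
  x ≟ y = Dec.via-injection (↔⇒↣ enum) Fin._≟_ x y

  x∙y≡y⇒x≡ε : ∀ {x y} → x ∙ y ≡ y → x ≡ ε
  x∙y≡y⇒x≡ε {x} {y} e = ∙-cancelʳ y x ε (trans e (sym (identityˡ y)))

  x∙y⁻¹≡ε⇒x≡y : ∀ {x y} → x ∙ (y ⁻¹) ≡ ε → x ≡ y
  x∙y⁻¹≡ε⇒x≡y {x} {y} e = trans (sym (//-rightDividesˡ y x)) (trans (cong (_∙ y) e) (identityˡ y))

cyclic : ∀ n → FiniteAbelianGroup (Fin (suc n)) addFin
cyclic n = record
  { isAbelianGroup = ModularRing.addFin-isAbelianGroup n ; order = suc n ; enum = mk↔ₛ′ id id (λ _ → refl) (λ _ → refl) }

_⊗_ : ∀ {G H : Set} → (G → G → G) → (H → H → H) → G × H → G × H → G × H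
(_∙_ ⊗ _∘′_) x y = proj₁ x ∙ proj₁ y , proj₂ x ∘′ proj₂ y

_⊗-group_ : ∀ {G H _∙_ _∘′_} → FiniteAbelianGroup G _∙_ → FiniteAbelianGroup H _∘′_ → FiniteAbelianGroup (G × H) (_∙_ ⊗ _∘′_)
A ⊗-group B = record
  { ε = A.ε , B.ε
  ; _⁻¹ = λ x → proj₁ x A.⁻¹ , proj₂ x B.⁻¹
  ; isAbelianGroup = record
    { isGroup = record
      { isMonoid = record
        { isSemigroup = record
          { isMagma = record { isEquivalence = ≡.isEquivalence ; ∙-cong = cong₂ _ }
          ; assoc = λ x y z → cong₂ _,_ (A.assoc _ _ _) (B.assoc _ _ _) }
        ; identity = (λ x → cong₂ _,_ (A.identityˡ _) (B.identityˡ _)) , (λ x → cong₂ _,_ (A.identityʳ _) (B.identityʳ _)) }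
      ; inverse = (λ x → cong₂ _,_ (A.inverseˡ _) (B.inverseˡ _)) , (λ x → cong₂ _,_ (A.inverseʳ _) (B.inverseʳ _))
      ; ⁻¹-cong = λ { refl → refl } }
    ; comm = λ x y → cong₂ _,_ (A.comm _ _) (B.comm _ _) }
  ; order = A.order ℕ.* B.order
  ; enum = ↔-trans (A.enum ×-↔ B.enum) (↔-sym (Fin.*↔× {A.order} {B.order}))
  }
  where
  module A = FiniteAbelianGroup A
  module B = FiniteAbelianGroup B

-- A difference matrix with six rows, one for each point of a largest block, and one column for each
-- group element; `mult i h` is the entry. Quotients of two rows run through the group once, which
-- handles differences. Each row itself does so too, which handles the partition into positions.
record DifferenceMatrix (G : Set) (_∙_ : G → G → G) : Set where
  field
    mult : Fin 6 → G → G
    mult-surjective : ∀ i y → ∃ λ h → mult i h ≡ y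
    mult-injective : ∀ i {h h′} → mult i h ≡ mult i h′ → h ≡ h′
    quotient-surjective : ∀ {i j} → i ≢ j → ∀ y → ∃ λ h → mult i h ≡ y ∙ mult j h
    quotient-injective : ∀ {i j} → i ≢ j → ∀ {y h h′} → mult i h ≡ y ∙ mult j h → mult i h′ ≡ y ∙ mult j h′ → h ≡ h′

_⊗-matrix_ : ∀ {G H _∙_ _∘′_} → DifferenceMatrix G _∙_ → DifferenceMatrix H _∘′_ → DifferenceMatrix (G × H) (_∙_ ⊗ _∘′_)
A ⊗-matrix B = record
  { mult = λ i x → A.mult i (proj₁ x) , B.mult i (proj₂ x)
  ; mult-surjective = λ i y → Product.zip _,_ (cong₂ _,_) (A.mult-surjective i (proj₁ y)) (B.mult-surjective i (proj₂ y))
  ; mult-injective = λ i e → cong₂ _,_ (A.mult-injective i (cong proj₁ e)) (B.mult-injective i (cong proj₂ e))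
  ; quotient-surjective = λ i≢j y → Product.zip _,_ (cong₂ _,_) (A.quotient-surjective i≢j (proj₁ y)) (B.quotient-surjective i≢j (proj₂ y))
  ; quotient-injective = λ i≢j e e′ → cong₂ _,_ (A.quotient-injective i≢j (cong proj₁ e) (cong proj₁ e′)) (B.quotient-injective i≢j (cong proj₂ e) (cong proj₂ e′))
  }
  where
  module A = DifferenceMatrix A
  module B = DifferenceMatrix B

module FamilyProperties {G : Set} {_∙_ : G → G → G} (A : FiniteAbelianGroup G _∙_)
                        (F : Family G _∙_ (FiniteAbelianGroup.ε A)) where
  open FiniteAbelianGroup A
  open Family F

  point-equal : ∀ {k} {p q : Point k} → pos p ≡ pos q → p ≡ q
  point-equal {k} {p} {q} e = unpair (pos-injective p q e)
    where
    unpair : _≡_ {A = Σ Index Point} (k , p) (k , q) → p ≡ q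
    unpair refl = refl

  difference-≢ε : ∀ {k x} {p q : Point k} → p ≢ q → pos p ≡ x ∙ pos q → x ≢ ε
  difference-≢ε p≢q e refl = p≢q (point-equal (trans e (identityˡ _)))

  difference-≢ : ∀ {k x} {p q : Point k} → x ≢ ε → pos p ≡ x ∙ pos q → p ≢ q
  difference-≢ x≢ε e refl = x≢ε (x∙y≡y⇒x≡ε (sym e))

  -- Distinct points of a block are assigned distinct rows of the difference matrix.
  slot : ∀ {k} → Point k → Fin 6
  slot {k} p = Fin.inject≤ (Inverse.to (point k) p) (size≤6 (size-3-6 k))
    where
    size≤6 : ∀ {n} → n ≡ 3 ⊎ n ≡ 6 → n ≤ 6
    size≤6 (inj₁ refl) = s≤s (s≤s (s≤s z≤n))
    size≤6 (inj₂ refl) = ℕ.≤-refl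

  slot-injective : ∀ {k} {p q : Point k} → slot p ≡ slot q → p ≡ q
  slot-injective {k} {p} {q} e = trans (sym (Inverse.inverseʳ (point k) refl))
    (trans (cong (Inverse.from (point k)) (Fin.inject≤-injective _ _ _ _ e)) (Inverse.inverseʳ (point k) refl))

module ProductFamily {G H : Set} {_∙_ : G → G → G} {_∘′_ : H → H → H}
                     (A : FiniteAbelianGroup G _∙_) (B : FiniteAbelianGroup H _∘′_) (M : DifferenceMatrix H _∘′_)
                     (F : Family G _∙_ (FiniteAbelianGroup.ε A)) (F′ : Family H _∘′_ (FiniteAbelianGroup.ε B)) where
  private
    module A = FiniteAbelianGroup A
    module B = FiniteAbelianGroup B
    module F = Family F
    module F′ = Family F′
  open DifferenceMatrix M
  open FamilyProperties A F

  ε : G × H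
  ε = A.ε , B.ε

  -- Each block over G is spread over H once for every column h of the matrix, the labels being
  -- kept. This accounts for all positions and differences with nontrivial first coordinate; those
  -- with trivial first coordinate are left to the second family.
  Index : Set
  Index = F.Index × H ⊎ F′.Index

  size : Index → ℕ
  size (inj₁ (k , _)) = F.size k
  size (inj₂ k) = F′.size k

  Point : Index → Set
  Point (inj₁ (k , _)) = F.Point k
  Point (inj₂ k) = F′.Point k

  label : ∀ k → Point k → Fin 3
  label (inj₁ _) p = F.label p
  label (inj₂ _) p = F′.label p

  pos : ∀ k → Point k → G × H
  pos (inj₁ (k , h)) p = F.pos p , mult (slot p) h
  pos (inj₂ k) p = A.ε , F′.pos p

  index : Index ↔ Fin (F.count ℕ.* B.order ℕ.+ F′.count)
  index = ↔-trans ((↔-trans (F.index ×-↔ B.enum) (↔-sym (Fin.*↔× {F.count} {B.order}))) ⊎-↔ F′.index)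
    (↔-sym (Fin.+↔⊎ {F.count ℕ.* B.order} {F′.count}))

  split-≢ε : ∀ {x} → x ≢ ε → proj₁ x ≢ A.ε ⊎ (proj₁ x ≡ A.ε × proj₂ x ≢ B.ε)
  split-≢ε {x} x≢ε = case proj₁ x A.≟ A.ε of λ
    { (no ne) → inj₁ ne
    ; (yes e) → inj₂ (e , λ e′ → x≢ε (cong₂ _,_ e e′)) }

  size-3-6 : ∀ k → size k ≡ 3 ⊎ size k ≡ 6
  size-3-6 (inj₁ (k , _)) = F.size-3-6 k
  size-3-6 (inj₂ k) = F′.size-3-6 k

  point : ∀ k → Point k ↔ Fin (size k)
  point (inj₁ (k , _)) = F.point k
  point (inj₂ k) = F′.point k

  sizes-occur : ∀ {x} → x ≢ ε → (∃ λ k → size k ≡ 3) × (∃ λ k → size k ≡ 6)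
  sizes-occur {x} x≢ε = [ (λ ne → Product.map lift₁ lift₁ (F.sizes-occur ne))
                        , (λ (_ , ne) → Product.map lift₂ lift₂ (F′.sizes-occur ne)) ]′ (split-≢ε x≢ε)
    where
    lift₁ : ∀ {n} → (∃ λ k → F.size k ≡ n) → ∃ λ k → size k ≡ n
    lift₁ (k , e) = inj₁ (k , B.ε) , e
    lift₂ : ∀ {n} → (∃ λ k → F′.size k ≡ n) → ∃ λ k → size k ≡ n
    lift₂ (k , e) = inj₂ k , e

  pos≢ε : ∀ k p → pos k p ≢ ε
  pos≢ε (inj₁ _) p e = F.pos≢ε p (cong proj₁ e)
  pos≢ε (inj₂ _) p e = F′.pos≢ε p (cong proj₂ e)

  pos-surjective : ∀ {x} → x ≢ ε → ∃ λ k → ∃ λ p → pos k p ≡ x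
  pos-surjective {x , y} x≢ε = [ (λ ne → outer (F.pos-surjective ne)) , (λ (e , ne) → inner e (F′.pos-surjective ne)) ]′ (split-≢ε x≢ε)
    where
    outer : (∃ λ k → ∃ λ (p : F.Point k) → F.pos p ≡ x) → ∃ λ k → ∃ λ p → pos k p ≡ (x , y)
    outer (k , p , e) with mult-surjective (slot p) y
    ... | h , e′ = inj₁ (k , h) , p , cong₂ _,_ e e′
    inner : x ≡ A.ε → (∃ λ k → ∃ λ (p : F′.Point k) → F′.pos p ≡ y) → ∃ λ k → ∃ λ p → pos k p ≡ (x , y)
    inner e (k , p , e′) = inj₂ k , p , cong₂ _,_ (sym e) e′

  pos-injective : ∀ k l p q → pos k p ≡ pos l q → _≡_ {A = Σ Index Point} (k , p) (l , q)
  pos-injective (inj₁ (k , h)) (inj₁ (l , h′)) p q e = finish (F.pos-injective p q (cong proj₁ e)) (cong proj₂ e)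
    where
    finish : _≡_ {A = Σ F.Index F.Point} (k , p) (l , q) → mult (slot p) h ≡ mult (slot q) h′ →
             _≡_ {A = Σ Index Point} (inj₁ (k , h) , p) (inj₁ (l , h′) , q)
    finish refl e = cong (λ h → inj₁ (k , h) , p) (mult-injective (slot p) e)
  pos-injective (inj₁ _) (inj₂ _) p q e = ⊥-elim (F.pos≢ε p (cong proj₁ e))
  pos-injective (inj₂ _) (inj₁ _) p q e = ⊥-elim (F.pos≢ε q (sym (cong proj₁ e)))
  pos-injective (inj₂ k) (inj₂ l) p q e = cong (λ (k , p) → inj₂ k , p) (F′.pos-injective p q (cong proj₂ e))

  _◆_ : G × H → G × H → G × H
  _◆_ = _∙_ ⊗ _∘′_

  difference-surjective : ∀ d {x} → x ≢ ε → ∃ λ k → ∃₂ λ p q → label k p ≡ addFin d (label k q) × pos k p ≡ x ◆ pos k q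
  difference-surjective d {x , y} x≢ε =
    [ (λ ne → outer ne (F.difference-surjective d ne)) , (λ (e , ne) → inner e (F′.difference-surjective d ne)) ]′ (split-≢ε x≢ε)
    where
    Found : Set
    Found = ∃ λ k → ∃₂ λ p q → label k p ≡ addFin d (label k q) × pos k p ≡ (x , y) ◆ pos k q
    outer : x ≢ A.ε → (∃ λ k → ∃₂ λ (p q : F.Point k) → F.Difference d x p q) → Found
    outer ne (k , p , q , l , e) with quotient-surjective (λ s → difference-≢ ne e (slot-injective s)) y
    ... | h , e′ = inj₁ (k , h) , p , q , l , cong₂ _,_ e e′
    inner : x ≡ A.ε → (∃ λ k → ∃₂ λ (p q : F′.Point k) → F′.Difference d y p q) → Found
    inner refl (k , p , q , l , e) = inj₂ k , p , q , l , cong₂ _,_ (sym (A.identityˡ _)) e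

  difference-injective : ∀ d {x} → x ≢ ε → ∀ k l p q p′ q′ →
    label k p ≡ addFin d (label k q) × pos k p ≡ x ◆ pos k q →
    label l p′ ≡ addFin d (label l q′) × pos l p′ ≡ x ◆ pos l q′ →
    _≡_ {A = Σ Index λ k → Point k × Point k} (k , p , q) (l , p′ , q′)
  difference-injective d {x , y} x≢ε = go
    where
    -- If x were the identity, the two points would coincide and y would be the identity as well.
    outer-≢ε : ∀ {k h} {p q : F.Point k} → F.pos p ≡ x ∙ F.pos q → mult (slot p) h ≡ y ∘′ mult (slot q) h → x ≢ A.ε
    outer-≢ε e e′ refl with point-equal (trans e (A.identityˡ _))
    ... | refl = x≢ε (cong (A.ε ,_) (B.x∙y≡y⇒x≡ε (sym e′)))
    inner-≡ε : A.ε ≡ x ∙ A.ε → x ≡ A.ε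
    inner-≡ε e = A.x∙y≡y⇒x≡ε (sym e)
    go : ∀ k l p q p′ q′ → label k p ≡ addFin d (label k q) × pos k p ≡ (x , y) ◆ pos k q →
      label l p′ ≡ addFin d (label l q′) × pos l p′ ≡ (x , y) ◆ pos l q′ →
      _≡_ {A = Σ Index λ k → Point k × Point k} (k , p , q) (l , p′ , q′)
    go (inj₁ (k , h)) (inj₁ (l , h′)) p q p′ q′ (lab , e) (lab′ , e′) =
      finish (F.difference-injective d ne p q p′ q′ (lab , cong proj₁ e) (lab′ , cong proj₁ e′)) (cong proj₂ e′)
      where
      ne : x ≢ A.ε
      ne = outer-≢ε (cong proj₁ e) (cong proj₂ e)
      finish : _≡_ {A = Σ F.Index λ k → F.Point k × F.Point k} (k , p , q) (l , p′ , q′) →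
        mult (slot p′) h′ ≡ y ∘′ mult (slot q′) h′ →
        _≡_ {A = Σ Index λ k → Point k × Point k} (inj₁ (k , h) , p , q) (inj₁ (l , h′) , p′ , q′)
      finish refl e″ = cong (λ h → inj₁ (k , h) , p , q)
        (quotient-injective (λ s → difference-≢ ne (cong proj₁ e) (slot-injective s)) (cong proj₂ e) e″)
    go (inj₁ _) (inj₂ _) p q p′ q′ (_ , e) (_ , e′) = ⊥-elim (outer-≢ε (cong proj₁ e) (cong proj₂ e) (inner-≡ε (cong proj₁ e′)))
    go (inj₂ _) (inj₁ _) p q p′ q′ (_ , e) (_ , e′) = ⊥-elim (outer-≢ε (cong proj₁ e′) (cong proj₂ e′) (inner-≡ε (cong proj₁ e)))
    go (inj₂ k) (inj₂ l) p q p′ q′ (lab , e) (lab′ , e′) =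
      cong (λ (k , p , q) → inj₂ k , p , q) (F′.difference-injective d ne p q p′ q′ (lab , cong proj₂ e) (lab′ , cong proj₂ e′))
      where
      ne : y ≢ B.ε
      ne y≡ε = x≢ε (cong₂ _,_ (inner-≡ε (cong proj₁ e)) y≡ε)

  product : Family (G × H) (_∙_ ⊗ _∘′_) ε
  product = record
    { Index = Index
    ; count = F.count ℕ.* B.order ℕ.+ F′.count
    ; index = index
    ; size = size
    ; size-3-6 = size-3-6
    ; sizes-occur = sizes-occur
    ; Point = Point
    ; point = point
    ; label = λ {k} → label k
    ; pos = λ {k} → pos k
    ; pos≢ε = λ {k} → pos≢ε k
    ; pos-surjective = pos-surjective
    ; pos-injective = λ {k} {l} → pos-injective k l
    ; difference-surjective = difference-surjective
    ; difference-injective = λ d x≢ε {k} {l} → difference-injective d x≢ε k l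
    }

-- The design

module Design {G : Set} {_∙_ : G → G → G} (A : FiniteAbelianGroup G _∙_)
              (F : Family G _∙_ (FiniteAbelianGroup.ε A)) where
  private
    module A = FiniteAbelianGroup A
    module Γ′ = FiniteAbelianGroup (cyclic 2 ⊗-group A)
  open Family F
  open FamilyProperties A F

  Pt : Set
  Pt = Fin 3 × G

  infixl 6 _◇_
  _◇_ : Pt → Pt → Pt
  _◇_ = addFin ⊗ _∙_

  full : ∀ {k} → Point k → Pt
  full p = label p , pos p

  -- inj₁ g is the coset Fin 3 × {g}, inj₂ (k , γ) the translate by γ of the k-th block.
  Block : Set
  Block = G ⊎ Index × Pt

  On : Block → Pt → Set
  On (inj₁ g) x = proj₂ x ≡ g
  On (inj₂ (k , γ)) x = ∃ λ (p : Point k) → full p ◇ γ ≡ x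

  -- The component of the translation in `Fin 3` is ignored, so a class contains all three such
  -- translates of each block. The positions of the base blocks partition the nonidentity elements
  -- of G, and the three translates supply every label at each of these positions; the coset covers
  -- the identity.
  class-of : Block → G
  class-of (inj₁ g) = g
  class-of (inj₂ (_ , _ , g)) = g

  translate : Pt → Block → Block
  translate γ (inj₁ g) = inj₁ (g ∙ proj₂ γ)
  translate γ (inj₂ (k , δ)) = inj₂ (k , δ ◇ γ)

  full-injective : ∀ {k} {p q : Point k} {γ x} → full p ◇ γ ≡ x → full q ◇ γ ≡ x → p ≡ q
  full-injective {p = p} {q} {γ} e e′ = point-equal (cong proj₂ (Γ′.∙-cancelʳ γ (full p) (full q) (trans e (sym e′))))

  pair-on : ∀ x y → x ≢ y → ∃ λ j → On j x × On j y
  pair-on x y x≢y = case proj₂ x A.≟ proj₂ y of λ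
    { (yes e) → inj₁ (proj₂ y) , e , refl
    ; (no ne) → through (difference-surjective (proj₁ δ) (λ δ≡ε → ne (A.x∙y⁻¹≡ε⇒x≡y δ≡ε))) }
    where
    δ : Pt
    δ = x ◇ (y Γ′.⁻¹)
    through : (∃ λ k → ∃₂ λ (p q : Point k) → Difference (proj₁ δ) (proj₂ δ) p q) → ∃ λ j → On j x × On j y
    through (k , p , q , l , e) = inj₂ (k , γ) , (p , p-on) , (q , q-on)
      where
      open ≡-Reasoning
      γ : Pt
      γ = (full q Γ′.⁻¹) ◇ y
      q-on : full q ◇ γ ≡ y
      q-on = Γ′.\\-leftDividesˡ (full q) y
      p-on : full p ◇ γ ≡ x
      p-on = begin
        full p ◇ γ          ≡⟨ cong (_◇ γ) (cong₂ _,_ l e) ⟩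
        δ ◇ full q ◇ γ      ≡⟨ Γ′.assoc δ (full q) γ ⟩
        δ ◇ (full q ◇ γ)    ≡⟨ cong (δ ◇_) q-on ⟩
        δ ◇ y               ≡⟨ Γ′.//-rightDividesˡ y x ⟩
        x                   ∎

  on-difference : ∀ {k γ x y} {p q : Point k} → full p ◇ γ ≡ x → full q ◇ γ ≡ y →
                  full p ≡ (x ◇ (y Γ′.⁻¹)) ◇ full q
  on-difference {k} {γ} {x} {y} {p} {q} refl refl = Γ′.∙-cancelʳ γ (full p) ((x ◇ (y Γ′.⁻¹)) ◇ full q) (begin
    x                                    ≡⟨ Γ′.//-rightDividesˡ y x ⟨
    x ◇ (y Γ′.⁻¹) ◇ (full q ◇ γ)         ≡⟨ Γ′.assoc (x ◇ (y Γ′.⁻¹)) (full q) γ ⟨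
    x ◇ (y Γ′.⁻¹) ◇ full q ◇ γ           ∎)
    where open ≡-Reasoning

  pair-determines : ∀ x y → x ≢ y → ∀ j j′ → On j x → On j y → On j′ x → On j′ y → j ≡ j′
  pair-determines x y x≢y (inj₁ g) (inj₁ g′) e _ e′ _ = cong inj₁ (trans (sym e) e′)
  pair-determines x y x≢y (inj₁ g) (inj₂ (k , γ)) e e′ (p , f) (q , f′) = ⊥-elim (x≢y (trans (sym f) (trans (cong (λ p → full p ◇ γ) p≡q) f′)))
    where
    p≡q : p ≡ q
    p≡q = point-equal (A.∙-cancelʳ (proj₂ γ) _ _ (trans (cong proj₂ f) (trans e (trans (sym e′) (sym (cong proj₂ f′))))))
  pair-determines x y x≢y j@(inj₂ _) j′@(inj₁ _) e e′ f f′ = sym (pair-determines x y x≢y j′ j f f′ e e′)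
  pair-determines x y x≢y (inj₂ (k , γ)) (inj₂ (l , γ′)) (p , e) (q , e′) (p′ , f) (q′ , f′) =
    finish (difference-injective (proj₁ δ) δ≢ε p q p′ q′ (split (on-difference e e′)) (split (on-difference f f′))) e f
    where
    δ : Pt
    δ = x ◇ (y Γ′.⁻¹)
    split : ∀ {k} {p q : Point k} → full p ≡ δ ◇ full q → Difference (proj₁ δ) (proj₂ δ) p q
    split eq = cong proj₁ eq , cong proj₂ eq
    p≢q : p ≢ q
    p≢q refl = x≢y (trans (sym e) e′)
    δ≢ε : proj₂ δ ≢ A.ε
    δ≢ε = difference-≢ε p≢q (cong proj₂ (on-difference {p = p} {q = q} e e′))
    finish : _≡_ {A = Σ Index λ k → Point k × Point k} (k , p , q) (l , p′ , q′) →
             full p ◇ γ ≡ x → full p′ ◇ γ′ ≡ x → _≡_ {A = Block} (inj₂ (k , γ)) (inj₂ (l , γ′))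
    finish refl e f = cong (λ γ → inj₂ (k , γ)) (Γ′.∙-cancelˡ (full p) γ γ′ (trans e (sym f)))

  class-covering : ∀ c x → ∃ λ j → class-of j ≡ c × On j x
  class-covering c x = case proj₂ x A.≟ c of λ
    { (yes e) → inj₁ c , refl , e
    ; (no ne) → through (pos-surjective (λ e → ne (A.x∙y⁻¹≡ε⇒x≡y e))) }
    where
    through : (∃ λ k → ∃ λ (p : Point k) → pos p ≡ proj₂ x ∙ (c A.⁻¹)) → ∃ λ j → class-of j ≡ c × On j x
    through (k , p , e) = inj₂ (k , (z , c)) , refl , p , cong₂ _,_ (C.\\-leftDividesˡ (label p) (proj₁ x))
      (trans (cong (_∙ c) e) (A.//-rightDividesˡ c (proj₂ x)))
      where
      module C = FiniteAbelianGroup (cyclic 2)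
      z : Fin 3
      z = addFin (label p C.⁻¹) (proj₁ x)

  class-separates : ∀ x j j′ → class-of j ≡ class-of j′ → On j x → On j′ x → j ≡ j′
  class-separates x (inj₁ _) (inj₁ _) e _ _ = cong inj₁ e
  class-separates x (inj₁ g) (inj₂ (k , z , _)) refl e (p , f) = ⊥-elim (pos≢ε p (A.x∙y≡y⇒x≡ε (trans (cong proj₂ f) e)))
  class-separates x (inj₂ (k , z , _)) (inj₁ g) refl (p , f) e = ⊥-elim (pos≢ε p (A.x∙y≡y⇒x≡ε (trans (cong proj₂ f) e)))
  class-separates x (inj₂ (k , z , g)) (inj₂ (l , z′ , g)) refl (p , e) (q , f) =
    finish (pos-injective p q (A.∙-cancelʳ g _ _ (trans (cong proj₂ e) (sym (cong proj₂ f))))) e f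
    where
    finish : _≡_ {A = Σ Index Point} (k , p) (l , q) → full p ◇ (z , g) ≡ x → full q ◇ (z′ , g) ≡ x →
             _≡_ {A = Block} (inj₂ (k , z , g)) (inj₂ (l , z′ , g))
    finish refl e f = cong (λ γ → inj₂ (k , γ)) (Γ′.∙-cancelˡ (full p) (z , g) (z′ , g) (trans e (sym f)))

  translate-on : ∀ γ j x → On j x ⇔ On (translate γ j) (x ◇ γ)
  translate-on γ (inj₁ g) x = mk⇔ (cong (_∙ proj₂ γ)) (A.∙-cancelʳ (proj₂ γ) (proj₂ x) g)
  translate-on γ (inj₂ (k , δ)) x = mk⇔
    (λ (p , e) → p , trans (sym (Γ′.assoc (full p) δ γ)) (cong (_◇ γ) e))
    (λ (p , e) → p , Γ′.∙-cancelʳ γ (full p ◇ δ) x (trans (Γ′.assoc (full p) δ γ) e))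

  class-translate : ∀ γ j → class-of (translate γ j) ≡ class-of j ∙ proj₂ γ
  class-translate γ (inj₁ _) = refl
  class-translate γ (inj₂ _) = refl

  block-size : Block → ℕ
  block-size (inj₁ _) = 3
  block-size (inj₂ (k , _)) = size k

  nth-point : ∀ j → Fin (block-size j) → Pt
  nth-point (inj₁ g) z = z , g
  nth-point (inj₂ (k , γ)) i = full (Inverse.from (point k) i) ◇ γ

  nth-point-injective : ∀ j {i i′} → nth-point j i ≡ nth-point j i′ → i ≡ i′
  nth-point-injective (inj₁ _) e = cong proj₁ e
  nth-point-injective (inj₂ (k , γ)) {i} {i′} e = trans (sym (Inverse.inverseˡ (point k) refl))
    (trans (cong (Inverse.to (point k)) (full-injective e refl)) (Inverse.inverseˡ (point k) refl))

  points : Block → List Pt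
  points j = List.tabulate (nth-point j)

  ∈⇔On : ∀ j x → x ∈ points j ⇔ On j x
  ∈⇔On j x = mk⇔ (λ x∈ → let i , e = ∈-tabulate⁻ x∈ in to j i (sym e)) (from j)
    where
    to : ∀ j i → nth-point j i ≡ x → On j x
    to (inj₁ g) i e = sym (cong proj₂ e)
    to (inj₂ (k , γ)) i e = Inverse.from (point k) i , e
    from : ∀ j → On j x → x ∈ points j
    from (inj₁ g) refl = ∈-tabulate⁺ {f = nth-point (inj₁ g)} (proj₁ x)
    from (inj₂ (k , γ)) (p , e) = subst (_∈ points (inj₂ (k , γ))) (trans (cong (λ p → full p ◇ γ) (Inverse.inverseʳ (point k) refl)) e)
      (∈-tabulate⁺ {f = nth-point (inj₂ (k , γ))} (Inverse.to (point k) p))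

  count-blocks : ℕ
  count-blocks = A.order ℕ.+ count ℕ.* Γ′.order

  blocks : Block ↔ Fin count-blocks
  blocks = ↔-trans (A.enum ⊎-↔ ↔-trans (index ×-↔ Γ′.enum) (↔-sym (Fin.*↔× {count} {Γ′.order})))
    (↔-sym (Fin.+↔⊎ {A.order} {count ℕ.* Γ′.order}))

  module _ {x : G} (x≢ε : x ≢ A.ε) where
    private
      at : Fin count-blocks → Block
      at = Inverse.from blocks

      at-to : ∀ j → at (Inverse.to blocks j) ≡ j
      at-to j = Inverse.inverseʳ blocks refl

      at-injective : ∀ {i j} → at i ≡ at j → i ≡ j
      at-injective e = trans (sym (Inverse.inverseˡ blocks refl)) (trans (cong (Inverse.to blocks) e) (Inverse.inverseˡ blocks refl))

      cls : Fin count-blocks → Fin A.order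
      cls = Inverse.to A.enum ∘ class-of ∘ at

      cls-injective : ∀ {i j} → cls i ≡ cls j → class-of (at i) ≡ class-of (at j)
      cls-injective e = trans (sym (Inverse.inverseʳ A.enum refl)) (trans (cong (Inverse.from A.enum) e) (Inverse.inverseʳ A.enum refl))

      on : ∀ {j x} → x ∈ points (at j) → On (at j) x
      on {j} {x} = Equivalence.to (∈⇔On (at j) x)

      mem : ∀ j {x} → On j x → x ∈ points (at (Inverse.to blocks j))
      mem j {x} x-on = Equivalence.from (∈⇔On _ x) (subst (λ j → On j x) (sym (at-to j)) x-on)

      size-occurs : ∀ {n} → (∃ λ k → size k ≡ n) → ∃ λ j → List.length (points (at j)) ≡ n
      size-occurs (k , e) = Inverse.to blocks (inj₂ (k , Γ′.ε)) ,
        trans (cong (List.length ∘ points) (at-to (inj₂ (k , Γ′.ε)))) (trans (length-tabulate (nth-point (inj₂ (k , Γ′.ε)))) e)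

      points-size : ∀ j → block-size j ≡ 3 ⊎ block-size j ≡ 6
      points-size (inj₁ _) = inj₁ refl
      points-size (inj₂ (k , _)) = size-3-6 k

    design : HarmoniousS236 Pt _◇_
    design = record
      { nb = count-blocks
      ; nc = A.order
      ; blk = points ∘ at
      ; cls = cls
      ; blk-unique = λ j → Unique.tabulate⁺ (nth-point-injective (at j))
      ; blk-size = λ j → subst (λ n → n ≡ 3 ⊎ n ≡ 6) (sym (length-tabulate (nth-point (at j)))) (points-size (at j))
      ; size3-occurs = size-occurs (proj₁ (sizes-occur x≢ε))
      ; size6-occurs = size-occurs (proj₂ (sizes-occur x≢ε))
      ; pair-exists = λ x y x≢y → let j , x-on , y-on = pair-on x y x≢y in Inverse.to blocks j , mem j x-on , mem j y-on
      ; pair-unique = λ x y x≢y i j x∈i y∈i x∈j y∈j → at-injective (pair-determines x y x≢y (at i) (at j) (on x∈i) (on y∈i) (on x∈j) (on y∈j))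
      ; class-covers = λ c x → let j , e , x-on = class-covering (Inverse.from A.enum c) x in
          Inverse.to blocks j , trans (cong (Inverse.to A.enum) (trans (cong class-of (at-to j)) e)) (Inverse.inverseˡ A.enum refl) , mem j x-on
      ; class-disjoint = λ x i j e x∈i x∈j → at-injective (class-separates x (at i) (at j) (cls-injective e) (on x∈i) (on x∈j))
      ; σ = λ γ j → Inverse.to blocks (translate γ (at j))
      ; ρ = λ γ c → Inverse.to A.enum (Inverse.from A.enum c ∙ proj₂ γ)
      ; σ-blocks = λ γ j x → mk⇔
          (λ x∈ → mem (translate γ (at j)) (Equivalence.to (translate-on γ (at j) x) (on x∈)))
          (λ x∈ → Equivalence.from (∈⇔On (at j) x) (Equivalence.from (translate-on γ (at j) x)
             (subst (λ j → On j (x ◇ γ)) (at-to (translate γ (at j))) (on x∈))))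
      ; σ-classes = λ γ j → cong (Inverse.to A.enum) (trans (cong class-of (at-to (translate γ (at j)))) (trans (class-translate γ (at j))
          (cong (_∙ proj₂ γ) (sym (Inverse.inverseʳ A.enum refl)))))
      ; ρ-transitive = λ c c′ → (0F , (Inverse.from A.enum c A.⁻¹) ∙ Inverse.from A.enum c′) ,
          trans (cong (Inverse.to A.enum) (A.\\-leftDividesˡ (Inverse.from A.enum c) (Inverse.from A.enum c′))) (Inverse.inverseˡ A.enum refl)
      }

-- Prime fields and their cubic extensions

module FiniteDomain {F : Set} {_+_ _*_ : F → F → F} { -_ : F → F} {0# 1# : F}
                    (isCommutativeRing : IsCommutativeRing _≡_ _+_ _*_ -_ 0# 1#) {n : ℕ} (enum : F ↔ Fin n)
                    (zero-product : ∀ {x y} → x * y ≡ 0# → x ≡ 0# ⊎ y ≡ 0#) where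
  private
    R : CommutativeRing 0ℓ 0ℓ
    R = record { isCommutativeRing = isCommutativeRing }
  open Algebra.Properties.Group (CommutativeRing.+-group R) using (x∙y⁻¹≈ε⇒x≈y; x≈y⇒x∙y⁻¹≈ε)
  open import Algebra.Properties.Ring (CommutativeRing.ring R) using (x[y-z]≈xy-xz)

  *-injective : ∀ {x} → x ≢ 0# → ∀ {y z} → x * y ≡ x * z → y ≡ z
  *-injective {x} x≢0 {y} {z} e =
    [ (λ x≡0 → ⊥-elim (x≢0 x≡0)) , x∙y⁻¹≈ε⇒x≈y y z ]′ (zero-product (trans (x[y-z]≈xy-xz x y z) (x≈y⇒x∙y⁻¹≈ε e)))

  -- On a finite set the injective multiplication by x is surjective, so it attains `1#`.
  inverse : ∀ x → x ≢ 0# → ∃ λ y → x * y ≡ 1#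
  inverse x x≢0 = Inverse.from enum i , trans (sym (Inverse.inverseʳ enum refl))
    (trans (cong (Inverse.from enum) i-maps) (Inverse.inverseʳ enum refl))
    where
    scale : Fin n → Fin n
    scale i = Inverse.to enum (x * Inverse.from enum i)
    scale-injective : ∀ {i j} → scale i ≡ scale j → i ≡ j
    scale-injective {i} {j} e = trans (sym (Inverse.inverseˡ enum refl)) (trans
      (cong (Inverse.to enum) (*-injective x≢0 (trans (sym (Inverse.inverseʳ enum refl)) (trans (cong (Inverse.from enum) e) (Inverse.inverseʳ enum refl)))))
      (Inverse.inverseˡ enum refl))
    i : Fin n
    i = proj₁ (injective⇒surjective scale scale-injective (Inverse.to enum 1#))
    i-maps : scale i ≡ Inverse.to enum 1#
    i-maps = proj₂ (injective⇒surjective scale scale-injective (Inverse.to enum 1#))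

prime-field : ∀ n → Prime (suc (suc n)) → FiniteField
prime-field n p-prime = record
  { isCommutativeRing = isCommutativeRing
  ; 1≢0 = λ ()
  ; inverse = FiniteDomain.inverse isCommutativeRing fin zero-product
  ; enum = fin
  }
  where
  open ModularRing (suc n)
  p : ℕ
  p = suc (suc n)
  fin : Fin p ↔ Fin p
  fin = mk↔ₛ′ id id (λ _ → refl) (λ _ → refl)
  small-multiple : ∀ (a : Fin p) → p ∣ toℕ a → a ≡ zero
  small-multiple zero _ = refl
  small-multiple (suc a) p∣a = ⊥-elim (>⇒∤ (s≤s (Fin.toℕ<n a)) p∣a)
  zero-product : ∀ {a b} → mulFin a b ≡ zero → a ≡ zero ⊎ b ≡ zero
  zero-product {a} {b} e = Sum.map (small-multiple a) (small-multiple b)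
    (euclidsLemma (toℕ a) (toℕ b) p-prime (m%n≡0⇒n∣m (toℕ a ℕ.* toℕ b) p (trans (sym (toℕ-residue (toℕ a ℕ.* toℕ b))) (cong toℕ e))))

NonCube : (K : FiniteField) → FiniteField.Carrier K → Set
NonCube K x = ∀ y → y * y * y ≢ x
  where open FiniteField K

module CubicExtension (K : FiniteField) (ω : FiniteField.Carrier K) (noncube : NonCube K ω) where
  open ≡-Reasoning
  open FieldProperties K

  L : Set
  L = Vec Carrier 3

  infixl 7 _✶_
  infixl 6 _⊹_
  _⊹_ : L → L → L
  _⊹_ = Vec.zipWith _+_

  -- a ∷ b ∷ c ∷ [] stands for a + b ξ + c ξ², where ξ³ = ω.
  _✶_ : L → L → L
  (a ∷ b ∷ c ∷ []) ✶ (a′ ∷ b′ ∷ c′ ∷ []) =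
    (a * a′ + ω * (b * c′ + c * b′)) ∷ (a * b′ + b * a′ + ω * (c * c′)) ∷ (a * c′ + b * b′ + c * a′) ∷ []

  𝟘 𝟙 : L
  𝟘 = Vec.replicate 3 0#
  𝟙 = 1# ∷ 0# ∷ 0# ∷ []

  triple-cong : ∀ {a a′ b b′ c c′ : Carrier} → a ≡ a′ → b ≡ b′ → c ≡ c′ → _≡_ {A = L} (a ∷ b ∷ c ∷ []) (a′ ∷ b′ ∷ c′ ∷ [])
  triple-cong refl refl refl = refl

  ✶-assoc : ∀ x y z → (x ✶ y) ✶ z ≡ x ✶ (y ✶ z)
  ✶-assoc (a ∷ b ∷ c ∷ []) (a′ ∷ b′ ∷ c′ ∷ []) (a″ ∷ b″ ∷ c″ ∷ []) = triple-cong
    (solve 10 (λ w a b c d e f g h i →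
      (a :* d :+ w :* (b :* f :+ c :* e)) :* g :+ w :* ((a :* e :+ b :* d :+ w :* (c :* f)) :* i :+ (a :* f :+ b :* e :+ c :* d) :* h)
      := a :* (d :* g :+ w :* (e :* i :+ f :* h)) :+ w :* (b :* (d :* i :+ e :* h :+ f :* g) :+ c :* (d :* h :+ e :* g :+ w :* (f :* i))))
      refl ω a b c a′ b′ c′ a″ b″ c″)
    (solve 10 (λ w a b c d e f g h i →
      (a :* d :+ w :* (b :* f :+ c :* e)) :* h :+ (a :* e :+ b :* d :+ w :* (c :* f)) :* g :+ w :* ((a :* f :+ b :* e :+ c :* d) :* i)
      := a :* (d :* h :+ e :* g :+ w :* (f :* i)) :+ b :* (d :* g :+ w :* (e :* i :+ f :* h)) :+ w :* (c :* (d :* i :+ e :* h :+ f :* g)))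
      refl ω a b c a′ b′ c′ a″ b″ c″)
    (solve 10 (λ w a b c d e f g h i →
      (a :* d :+ w :* (b :* f :+ c :* e)) :* i :+ (a :* e :+ b :* d :+ w :* (c :* f)) :* h :+ (a :* f :+ b :* e :+ c :* d) :* g
      := a :* (d :* i :+ e :* h :+ f :* g) :+ b :* (d :* h :+ e :* g :+ w :* (f :* i)) :+ c :* (d :* g :+ w :* (e :* i :+ f :* h)))
      refl ω a b c a′ b′ c′ a″ b″ c″)

  ✶-comm : ∀ x y → x ✶ y ≡ y ✶ x
  ✶-comm (a ∷ b ∷ c ∷ []) (a′ ∷ b′ ∷ c′ ∷ []) = triple-cong
    (solve 7 (λ w a b c d e f → a :* d :+ w :* (b :* f :+ c :* e) := d :* a :+ w :* (e :* c :+ f :* b)) refl ω a b c a′ b′ c′)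
    (solve 7 (λ w a b c d e f → a :* e :+ b :* d :+ w :* (c :* f) := d :* b :+ e :* a :+ w :* (f :* c)) refl ω a b c a′ b′ c′)
    (solve 7 (λ w a b c d e f → a :* f :+ b :* e :+ c :* d := d :* c :+ e :* b :+ f :* a) refl ω a b c a′ b′ c′)

  ✶-identityˡ : ∀ x → 𝟙 ✶ x ≡ x
  ✶-identityˡ (a ∷ b ∷ c ∷ []) = triple-cong
    (solve 4 (λ w a b c → :1 :* a :+ w :* (:0 :* c :+ :0 :* b) := a) refl ω a b c)
    (solve 4 (λ w a b c → :1 :* b :+ :0 :* a :+ w :* (:0 :* c) := b) refl ω a b c)
    (solve 4 (λ w a b c → :1 :* c :+ :0 :* b :+ :0 :* a := c) refl ω a b c)

  ✶-distribˡ : ∀ x y z → x ✶ (y ⊹ z) ≡ x ✶ y ⊹ x ✶ z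
  ✶-distribˡ (a ∷ b ∷ c ∷ []) (a′ ∷ b′ ∷ c′ ∷ []) (a″ ∷ b″ ∷ c″ ∷ []) = triple-cong
    (solve 10 (λ w a b c d e f g h i → a :* (d :+ g) :+ w :* (b :* (f :+ i) :+ c :* (e :+ h))
      := (a :* d :+ w :* (b :* f :+ c :* e)) :+ (a :* g :+ w :* (b :* i :+ c :* h))) refl ω a b c a′ b′ c′ a″ b″ c″)
    (solve 10 (λ w a b c d e f g h i → a :* (e :+ h) :+ b :* (d :+ g) :+ w :* (c :* (f :+ i))
      := (a :* e :+ b :* d :+ w :* (c :* f)) :+ (a :* h :+ b :* g :+ w :* (c :* i))) refl ω a b c a′ b′ c′ a″ b″ c″)
    (solve 10 (λ w a b c d e f g h i → a :* (f :+ i) :+ b :* (e :+ h) :+ c :* (d :+ g)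
      := (a :* f :+ b :* e :+ c :* d) :+ (a :* i :+ b :* h :+ c :* g)) refl ω a b c a′ b′ c′ a″ b″ c″)

  isExtensionRing : IsCommutativeRing _≡_ _⊹_ _✶_ (Vec.map (λ x → - x)) 𝟘 𝟙
  isExtensionRing = record
    { isRing = record
      { +-isAbelianGroup = record
        { isGroup = record
          { isMonoid = record
            { isSemigroup = record
              { isMagma = record { isEquivalence = ≡.isEquivalence ; ∙-cong = cong₂ _⊹_ }
              ; assoc = Vec.zipWith-assoc +-assoc }
            ; identity = Vec.zipWith-identityˡ +-identityˡ , Vec.zipWith-identityʳ +-identityʳ }
          ; inverse = Vec.zipWith-inverseˡ -‿inverseˡ , Vec.zipWith-inverseʳ -‿inverseʳ
          ; ⁻¹-cong = cong (Vec.map (λ x → - x)) }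
        ; comm = Vec.zipWith-comm +-comm }
      ; *-cong = cong₂ _✶_
      ; *-assoc = ✶-assoc
      ; *-identity = ✶-identityˡ , λ x → trans (✶-comm x 𝟙) (✶-identityˡ x)
      ; distrib = ✶-distribˡ , λ x y z → trans (✶-comm (y ⊹ z) x) (trans (✶-distribˡ x y z) (cong₂ _⊹_ (✶-comm x y) (✶-comm x z))) }
    ; *-comm = ✶-comm }

  -- This is the norm of u + v ξ. If it vanished with v ≢ 0, then ω would be the cube of - u / v.
  norm≢0 : ∀ u v → ¬ (u ≡ 0# × v ≡ 0#) → u * u * u + ω * (v * v * v) ≢ 0#
  norm≢0 u v uv≢0 eq = case v ≟ 0# of λ
    { (yes v≡0) → *-nonzero (*-nonzero (u≢0 v≡0) (u≢0 v≡0)) (u≢0 v≡0) (trans (at-zero v≡0) eq)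
    ; (no v≢0) → noncube (- (u * inv v)) (begin
        - (u * inv v) * - (u * inv v) * - (u * inv v)
          ≡⟨ solve 4 (λ u v i w → (:- (u :* i)) :* (:- (u :* i)) :* (:- (u :* i))
               := w :* ((v :* i) :* (v :* i) :* (v :* i)) :+ (:- ((u :* u :* u :+ w :* (v :* v :* v)) :* (i :* i :* i)))) refl u v (inv v) ω ⟩
        ω * ((v * inv v) * (v * inv v) * (v * inv v)) + - ((u * u * u + ω * (v * v * v)) * (inv v * inv v * inv v))
          ≡⟨ cong₂ (λ x y → ω * (x * x * x) + - (y * (inv v * inv v * inv v))) (*-inverseʳ v≢0) eq ⟩
        ω * (1# * 1# * 1#) + - (0# * (inv v * inv v * inv v))
          ≡⟨ solve 2 (λ w i → w :* (:1 :* :1 :* :1) :+ (:- (:0 :* i)) := w) refl ω (inv v * inv v * inv v) ⟩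
        ω ∎) }
    where
    u≢0 : v ≡ 0# → u ≢ 0#
    u≢0 v≡0 u≡0 = uv≢0 (u≡0 , v≡0)
    at-zero : v ≡ 0# → u * u * u ≡ u * u * u + ω * (v * v * v)
    at-zero refl = solve 2 (λ u w → u :* u :* u := u :* u :* u :+ w :* (:0 :* :0 :* :0)) refl u ω

  -- (u + v ξ) (u² − u v ξ + v² ξ²) = u³ + ω v³.
  linear-inverse : ∀ u v → ¬ (u ≡ 0# × v ≡ 0#) → ∃ λ y → (u ∷ v ∷ 0# ∷ []) ✶ y ≡ 𝟙
  linear-inverse u v uv≢0 = (u * u * i ∷ - (u * v) * i ∷ v * v * i ∷ []) , triple-cong
    (trans (solve 4 (λ u v i w → u :* (u :* u :* i) :+ w :* (v :* (v :* v :* i) :+ :0 :* ((:- (u :* v)) :* i))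
       := (u :* u :* u :+ w :* (v :* v :* v)) :* i) refl u v i ω) (*-inverseʳ (norm≢0 u v uv≢0)))
    (solve 4 (λ u v i w → u :* ((:- (u :* v)) :* i) :+ v :* (u :* u :* i) :+ w :* (:0 :* (v :* v :* i)) := :0) refl u v i ω)
    (solve 3 (λ u v i → u :* (v :* v :* i) :+ v :* ((:- (u :* v)) :* i) :+ :0 :* (u :* u :* i) := :0) refl u v i)
    where
    i : Carrier
    i = inv (u * u * u + ω * (v * v * v))

  -- For c ≢ 0#, multiplication by c ξ − b makes a + b ξ + c ξ² linear.
  extension-inverse : ∀ x → x ≢ 𝟘 → ∃ λ y → x ✶ y ≡ 𝟙
  extension-inverse (a ∷ b ∷ c ∷ []) x≢0 = case c ≟ 0# of λ { (yes c≡0) → linear c≡0 ; (no c≢0) → quadratic c≢0 }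
    where
    linear : c ≡ 0# → ∃ λ y → (a ∷ b ∷ c ∷ []) ✶ y ≡ 𝟙
    linear refl = linear-inverse a b (λ (a≡0 , b≡0) → x≢0 (triple-cong a≡0 b≡0 refl))
    quadratic : c ≢ 0# → ∃ λ y → (a ∷ b ∷ c ∷ []) ✶ y ≡ 𝟙
    quadratic c≢0 = conclude (linear-inverse (ω * (c * c) - a * b) (a * c - b * b) linear≢0)
      where
      reduced : (a ∷ b ∷ c ∷ []) ✶ (- b ∷ c ∷ 0# ∷ []) ≡ (ω * (c * c) - a * b) ∷ (a * c - b * b) ∷ 0# ∷ []
      reduced = triple-cong
        (solve 4 (λ w a b c → a :* (:- b) :+ w :* (b :* :0 :+ c :* c) := w :* (c :* c) :- a :* b) refl ω a b c)
        (solve 4 (λ w a b c → a :* c :+ b :* (:- b) :+ w :* (c :* :0) := a :* c :- b :* b) refl ω a b c)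
        (solve 3 (λ a b c → a :* :0 :+ b :* c :+ c :* (:- b) := :0) refl a b c)
      -- From ωc² = ab and ac = b² follows ωc³ = abc = b³, and b / c would be a cube root of ω.
      linear≢0 : ¬ (ω * (c * c) - a * b ≡ 0# × a * c - b * b ≡ 0#)
      linear≢0 (e₁ , e₂) = noncube (b * inv c) (begin
        b * inv c * (b * inv c) * (b * inv c)
          ≡⟨ solve 5 (λ w a b c i → b :* i :* (b :* i) :* (b :* i)
               := w :* ((c :* i) :* (c :* i) :* (c :* i)) :+ (:- ((w :* (c :* c) :- a :* b) :* (c :* (i :* i :* i)) :+ (a :* c :- b :* b) :* (b :* (i :* i :* i))))) refl ω a b c (inv c) ⟩
        ω * ((c * inv c) * (c * inv c) * (c * inv c)) + - ((ω * (c * c) - a * b) * (c * i³) + (a * c - b * b) * (b * i³))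
          ≡⟨ cong₂ (λ x y → ω * (x * x * x) + - y) (*-inverseʳ c≢0) (cong₂ (λ x y → x * (c * i³) + y * (b * i³)) e₁ e₂) ⟩
        ω * (1# * 1# * 1#) + - (0# * (c * i³) + 0# * (b * i³))
          ≡⟨ solve 3 (λ w x y → w :* (:1 :* :1 :* :1) :+ (:- (:0 :* x :+ :0 :* y)) := w) refl ω (c * i³) (b * i³) ⟩
        ω ∎)
        where
        i³ : Carrier
        i³ = inv c * inv c * inv c
      conclude : (∃ λ y → ((ω * (c * c) - a * b) ∷ (a * c - b * b) ∷ 0# ∷ []) ✶ y ≡ 𝟙) → ∃ λ y → (a ∷ b ∷ c ∷ []) ✶ y ≡ 𝟙
      conclude (y , e) = (- b ∷ c ∷ 0# ∷ []) ✶ y , (begin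
        (a ∷ b ∷ c ∷ []) ✶ ((- b ∷ c ∷ 0# ∷ []) ✶ y)    ≡⟨ ✶-assoc (a ∷ b ∷ c ∷ []) (- b ∷ c ∷ 0# ∷ []) y ⟨
        (a ∷ b ∷ c ∷ []) ✶ (- b ∷ c ∷ 0# ∷ []) ✶ y      ≡⟨ cong (_✶ y) reduced ⟩
        ((ω * (c * c) - a * b) ∷ (a * c - b * b) ∷ 0# ∷ []) ✶ y ≡⟨ e ⟩
        𝟙                                                ∎)

  extension : FiniteField
  extension = record
    { isCommutativeRing = isExtensionRing
    ; 1≢0 = λ e → 1≢0 (cong Vec.head e)
    ; inverse = extension-inverse
    ; order = order ℕ.* (order ℕ.* order)
    ; enum = ↔-trans (mk↔ₛ′ coordinates (λ (a , b , c) → a ∷ b ∷ c ∷ []) (λ _ → refl) (λ { (_ ∷ _ ∷ _ ∷ []) → refl }))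
        (↔-trans (enum ×-↔ ↔-trans (enum ×-↔ enum) (↔-sym (Fin.*↔× {order} {order}))) (↔-sym (Fin.*↔× {order} {order ℕ.* order})))
    }
    where
    coordinates : L → Carrier × Carrier × Carrier
    coordinates (a ∷ b ∷ c ∷ []) = a , b , c

-- 3 but not 9 divides order − 1, so a cube root of unity other than 1 is no cube.
noncube : ∀ (K : FiniteField) j r → FiniteField.order K ≡ suc (3 ℕ.* (r ℕ.+ 3 ℕ.* j)) → r ≡ 1 ⊎ r ≡ 2 → ∃ (NonCube K)
noncube K j r order≡ r-small = from-nonresidue (nonresidue {3} {f} (s≤s (s≤s z≤n)) (1≤f r-small) order≡)
  where
  open ≡-Reasoning
  open FieldProperties K
  open PowerResidues K
  f : ℕ
  f = r ℕ.+ 3 ℕ.* j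
  1≤f : r ≡ 1 ⊎ r ≡ 2 → 1 ≤ f
  1≤f (inj₁ refl) = s≤s z≤n
  1≤f (inj₂ refl) = s≤s z≤n
  from-nonresidue : (∃ λ x → x ≢ 0# × x ^ f ≢ 1#) → ∃ (NonCube K)
  from-nonresidue (x , x≢0 , ω≢1) = x ^ f , λ y e → ω≢1 (case-r r-small (power y e))
    where
    ω : Carrier
    ω = x ^ f
    ω³≡1 : ω ^ 3 ≡ 1#
    ω³≡1 = trans (^-assocʳ x f 3) (trans (cong (x ^_) (ℕ.*-comm f 3)) (fermat-pred order≡ x≢0))
    ω≢0 : ω ≢ 0#
    ω≢0 = ^-nonzero f x≢0
    -- The power `ω ^ f` is computed twice: it is `ω ^ r` because ω³ = 1 and f = r + 3j, and it is
    -- y^(3f) = 1 by Fermat's theorem.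
    power : ∀ y → y * y * y ≡ ω → ω ^ r ≡ 1#
    power y e = begin
      ω ^ r                    ≡⟨ *-identityʳ (ω ^ r) ⟨
      ω ^ r * 1#               ≡⟨ cong (ω ^ r *_) (trans (sym (^-assocʳ ω 3 j)) (trans (cong (_^ j) ω³≡1) (1^ j))) ⟨
      ω ^ r * ω ^ (3 ℕ.* j)    ≡⟨ ^-homo-* ω r (3 ℕ.* j) ⟨
      ω ^ f                    ≡⟨ cong (_^ f) (trans (solve 1 (λ y → y :* (y :* (y :* :1)) := y :* y :* y) refl y) e) ⟨
      (y ^ 3) ^ f              ≡⟨ ^-assocʳ y 3 f ⟩
      y ^ (3 ℕ.* f)            ≡⟨ fermat-pred order≡ y≢0 ⟩
      1#                       ∎
      where
      y≢0 : y ≢ 0#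
      y≢0 refl = ω≢0 (trans (sym e) (zeroʳ _))
    case-r : r ≡ 1 ⊎ r ≡ 2 → ω ^ r ≡ 1# → ω ≡ 1#
    case-r (inj₁ refl) e = trans (sym (*-identityʳ ω)) e
    case-r (inj₂ refl) e = trans (sym (*-identityʳ ω)) (trans (cong (ω *_) (sym e)) ω³≡1)

-- Assembling the components

record Harmonic (G : Set) (_∙_ : G → G → G) : Set₁ where
  field
    group : FiniteAbelianGroup G _∙_
    matrix : DifferenceMatrix G _∙_
    family : Family G _∙_ (FiniteAbelianGroup.ε group)

_⊗-harmonic_ : ∀ {G H _∙_ _∘′_} → Harmonic G _∙_ → Harmonic H _∘′_ → Harmonic (G × H) (_∙_ ⊗ _∘′_)
A ⊗-harmonic B = record
  { group = A.group ⊗-group B.group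
  ; matrix = A.matrix ⊗-matrix B.matrix
  ; family = ProductFamily.product A.group B.group B.matrix A.family B.family
  }
  where
  module A = Harmonic A
  module B = Harmonic B

-- Over a field, any six distinct nonzero multipliers form a difference matrix. The six
-- representatives of the sextic classes are at hand for this.
field-harmonic : (K : FiniteField) → FiniteField.order K % 36 ≡ 19 → Harmonic (FiniteField.Carrier K) (FiniteField._+_ K)
field-harmonic K order% = record
  { group = record
    { isAbelianGroup = IsCommutativeRing.+-isAbelianGroup isCommutativeRing ; order = order ; enum = enum }
  ; matrix = record
    { mult = λ i h → rep i * h
    ; mult-surjective = λ i y → inv (rep i) * y , x*[x⁻¹*y] (nonzero i) y
    ; mult-injective = λ i → *-cancelˡ (nonzero i)
    ; quotient-surjective = λ {i} {j} i≢j y → inv (rep i - rep j) * y , move-right (x*[x⁻¹*y] (rep-difference≢0 i≢j) y)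
    ; quotient-injective = λ i≢j e e′ → *-cancelˡ (rep-difference≢0 i≢j) (trans (move-left e) (sym (move-left e′)))
    }
  ; family = family
  }
  where
  open FieldProperties K
  m : ℕ
  m = order ℕ./ 36
  order≡ : order ≡ 19 ℕ.+ 36 ℕ.* m
  order≡ = trans (ℕ.m≡m%n+[m/n]*n order 36) (cong₂ ℕ._+_ order% (ℕ.*-comm m 36))
  open BaseFamily K m order≡ using (family; rep; rep-system; module ClassSystem)
  open SexticClasses K m order≡ using (class)
  open ClassSystem rep-system
  rep-difference≢0 : ∀ {i j} → i ≢ j → rep i - rep j ≢ 0#
  rep-difference≢0 i≢j e = i≢j (class-injective (cong class (x-y≡0⇒x≡y e)))
  move-right : ∀ {a b h y} → (a - b) * h ≡ y → a * h ≡ y + b * h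
  move-right {a} {b} {h} e = trans (solve 3 (λ a b h → a :* h := (a :- b) :* h :+ b :* h) refl a b h) (cong (_+ b * h) e)
  move-left : ∀ {a b h y} → a * h ≡ y + b * h → (a - b) * h ≡ y
  move-left {a} {b} {h} {y} e = trans (solve 3 (λ a b h → (a :- b) :* h := a :* h :- b :* h) refl a b h)
    (trans (cong (_- b * h) e) (solve 3 (λ y b h → y :+ b :* h :- b :* h := y) refl y b h))

-- The empty family over the trivial group starts the products. It has no blocks, which is why
-- `sizes-occur` is conditional on a nonidentity element.
trivial-harmonic : Harmonic ⊤ (λ _ _ → tt)
trivial-harmonic = record
  { group = record
    { ε = tt
    ; _⁻¹ = λ _ → tt
    ; isAbelianGroup = record
      { isGroup = record
        { isMonoid = record
          { isSemigroup = record
            { isMagma = record { isEquivalence = ≡.isEquivalence ; ∙-cong = λ _ _ → refl }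
            ; assoc = λ _ _ _ → refl }
          ; identity = (λ _ → refl) , (λ _ → refl) }
        ; inverse = (λ _ → refl) , (λ _ → refl)
        ; ⁻¹-cong = λ _ → refl }
      ; comm = λ _ _ → refl }
    ; order = 1
    ; enum = mk↔ₛ′ (λ _ → zero) (λ _ → tt) (λ { zero → refl }) (λ _ → refl)
    }
  ; matrix = record
    { mult = λ _ _ → tt
    ; mult-surjective = λ _ _ → tt , refl
    ; mult-injective = λ _ _ → refl
    ; quotient-surjective = λ _ _ → tt , refl
    ; quotient-injective = λ _ _ _ → refl
    }
  ; family = record
    { Index = Fin 0
    ; count = 0
    ; index = mk↔ₛ′ id id (λ _ → refl) (λ _ → refl)
    ; size = λ ()
    ; size-3-6 = λ ()
    ; sizes-occur = λ ne → ⊥-elim (ne refl)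
    ; Point = λ ()
    ; point = λ ()
    ; label = λ { {()} }
    ; pos = λ { {()} }
    ; pos≢ε = λ { {()} }
    ; pos-surjective = λ ne → ⊥-elim (ne refl)
    ; pos-injective = λ { {()} }
    ; difference-surjective = λ _ ne → ⊥-elim (ne refl)
    ; difference-injective = λ _ ne → ⊥-elim (ne refl)
    }
  }

module Transport {G H : Set} {_∙_ : G → G → G} {_∘′_ : H → H → H} (φ : G ↔ H)
                 (homo : ∀ x y → Inverse.to φ (x ∙ y) ≡ Inverse.to φ x ∘′ Inverse.to φ y) where
  open Inverse φ using (to; from)

  private
    to-from : ∀ y → to (from y) ≡ y
    to-from y = Inverse.inverseˡ φ refl

    from-to : ∀ x → from (to x) ≡ x
    from-to x = Inverse.inverseʳ φ refl

    from-injective : ∀ {x y} → from x ≡ from y → x ≡ y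
    from-injective e = trans (sym (to-from _)) (trans (cong to e) (to-from _))

    to-injective : ∀ {x y} → to x ≡ to y → x ≡ y
    to-injective e = trans (sym (from-to _)) (trans (cong from e) (from-to _))

    from-homo : ∀ x y → from (x ∘′ y) ≡ from x ∙ from y
    from-homo x y = to-injective (trans (to-from _) (sym (trans (homo (from x) (from y)) (cong₂ _∘′_ (to-from x) (to-from y)))))

  harmonic : Harmonic G _∙_ → Harmonic H _∘′_
  harmonic A = record
    { group = record
      { ε = to ε
      ; _⁻¹ = λ y → to (from y ⁻¹)
      ; isAbelianGroup = record
        { isGroup = record
          { isMonoid = record
            { isSemigroup = record
              { isMagma = record { isEquivalence = ≡.isEquivalence ; ∙-cong = cong₂ _∘′_ }
              ; assoc = λ x y z → from-injective (trans (from-homo _ z) (trans (cong (_∙ from z) (from-homo x y))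
                  (trans (assoc _ _ _) (sym (trans (from-homo x _) (cong (from x ∙_) (from-homo y z))))))) }
            ; identity = (λ x → from-injective (trans (from-homo _ x) (trans (cong (_∙ from x) (from-to ε)) (identityˡ (from x)))))
                       , (λ x → from-injective (trans (from-homo x _) (trans (cong (from x ∙_) (from-to ε)) (identityʳ (from x))))) }
          ; inverse = (λ x → from-injective (trans (from-homo _ x) (trans (cong (_∙ from x) (from-to (from x ⁻¹))) (trans (inverseˡ (from x)) (sym (from-to ε))))))
                    , (λ x → from-injective (trans (from-homo x _) (trans (cong (from x ∙_) (from-to (from x ⁻¹))) (trans (inverseʳ (from x)) (sym (from-to ε))))))
          ; ⁻¹-cong = λ { refl → refl } }
        ; comm = λ x y → from-injective (trans (from-homo x y) (trans (comm _ _) (sym (from-homo y x)))) }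
      ; order = order
      ; enum = ↔-trans (↔-sym φ) enum
      }
    ; matrix = record
      { mult = λ i y → to (mult i (from y))
      ; mult-surjective = λ i y → let h , e = mult-surjective i (from y) in
          to h , trans (cong (to ∘ mult i) (from-to h)) (trans (cong to e) (to-from y))
      ; mult-injective = λ i e → from-injective (mult-injective i (to-injective e))
      ; quotient-surjective = λ {i} {j} i≢j y → let h , e = quotient-surjective i≢j (from y) in
          to h , trans (cong (to ∘ mult i) (from-to h)) (trans (cong to e) (trans (homo (from y) (mult j h))
            (cong₂ _∘′_ (to-from y) (cong (to ∘ mult j) (sym (from-to h))))))
      ; quotient-injective = λ i≢j e e′ → from-injective (quotient-injective i≢j (pull e) (pull e′))
      }
    ; family = record
      { Index = Index
      ; count = count
      ; index = index
      ; size = size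
      ; size-3-6 = size-3-6
      ; sizes-occur = λ ne → sizes-occur (from-≢ε ne)
      ; Point = Point
      ; point = point
      ; label = label
      ; pos = to ∘ pos
      ; pos≢ε = λ p e → pos≢ε p (to-injective e)
      ; pos-surjective = λ {x} ne → let k , p , e = pos-surjective (from-≢ε ne) in k , p , trans (cong to e) (to-from x)
      ; pos-injective = λ p q e → pos-injective p q (to-injective e)
      ; difference-surjective = λ d {x} ne → let k , p , q , l , e = difference-surjective d (from-≢ε ne) in
          k , p , q , l , trans (cong to e) (trans (homo (from x) (pos q)) (cong (_∘′ to (pos q)) (to-from x)))
      ; difference-injective = λ d ne p q p′ q′ (l , e) (l′ , e′) →
          difference-injective d (from-≢ε ne) p q p′ q′ (l , pull e) (l′ , pull e′)
      }
    }
    where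
    open Harmonic A
    open FiniteAbelianGroup group
    open DifferenceMatrix matrix
    open Family family
    from-≢ε : ∀ {x} → x ≢ to ε → from x ≢ ε
    from-≢ε ne e = ne (trans (sym (to-from _)) (cong to e))
    pull : ∀ {x y z} → to x ≡ y ∘′ to z → x ≡ from y ∙ z
    pull {x} {y} {z} e = trans (sym (from-to x)) (trans (cong from e) (trans (from-homo y (to z)) (cong (from y ∙_) (from-to z))))

-- The additive group of order p^e is a power of that of order p or p³, so the product construction
-- replaces a field of order p^e.
repeat-harmonic : ∀ {A : Set} {_∙_ : A → A → A} {u} → Harmonic (Vec A u) (Vec.zipWith _∙_) →
                  ∀ k → Harmonic (Vec A (k ℕ.* u)) (Vec.zipWith _∙_)
repeat-harmonic V zero = Transport.harmonic
  (mk↔ₛ′ (λ _ → []) (λ _ → tt) (λ { [] → refl }) (λ _ → refl)) (λ _ _ → refl) trivial-harmonic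
repeat-harmonic {A} {_∙_} {u} V (suc k) = Transport.harmonic
  (mk↔ₛ′ (λ (x , y) → x Vec.++ y) (λ z → Vec.take u z , Vec.drop u z) (Vec.take++drop≡id u)
    (λ (x , y) → cong₂ _,_ (Vec.++-injectiveˡ (Vec.take u (x Vec.++ y)) x (Vec.take++drop≡id u (x Vec.++ y)))
                           (Vec.++-injectiveʳ (Vec.take u (x Vec.++ y)) x (Vec.take++drop≡id u (x Vec.++ y)))))
  (λ (x , y) (x′ , y′) → sym (Vec.zipWith-++ _∙_ x y x′ y′)) (V ⊗-harmonic repeat-harmonic V k)

open import Data.Nat using (_+_; _*_; _^_)

-- Prime powers congruent to 19 modulo 36

power-% : ∀ p e n .{{_ : NonZero n}} → (p ^ e) % n ≡ ((p % n) ^ e) % n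
power-% p zero n = refl
power-% p (suc e) n = begin
  (p * p ^ e) % n                              ≡⟨ ℕ.%-distribˡ-* p (p ^ e) n ⟩
  ((p % n) * ((p ^ e) % n)) % n                ≡⟨ cong (λ x → ((p % n) * x) % n) (power-% p e n) ⟩
  ((p % n) * (((p % n) ^ e) % n)) % n          ≡⟨ cong (λ x → (x * (((p % n) ^ e) % n)) % n) (ℕ.m%n%n≡m%n p n) ⟨
  (((p % n) % n) * (((p % n) ^ e) % n)) % n    ≡⟨ ℕ.%-distribˡ-* (p % n) ((p % n) ^ e) n ⟨
  ((p % n) * (p % n) ^ e) % n                  ∎
  where open ≡-Reasoning

-- The cube roots of 19 modulo 36 are 7, 19 and 31, and 19 is its own inverse. Even exponents do not
-- arise from a power congruent to 19, since 19 is no square modulo 4.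
Residue : ℕ → ℕ → Set
Residue r e = r ≡ 19 ⊎ ((r ≡ 7 ⊎ r ≡ 31) × e % 3 ≡ 0)

residue? : ∀ r e → Dec (Residue r e)
residue? r e = (r ℕ.≟ 19) ⊎-dec (((r ℕ.≟ 7) ⊎-dec (r ℕ.≟ 31)) ×-dec (e % 3 ℕ.≟ 0))

-- The units modulo 36 have exponent 6, so only the exponents e < 6 need to be inspected.
power-residue : ∀ (r : Fin 36) e → (toℕ r ^ e) % 36 ≡ 19 → Residue (toℕ r) e
power-residue r 0 ()
power-residue r 1 = toWitness {a? = Fin.all? λ r → ((toℕ {36} r ^ 1) % 36 ℕ.≟ 19) →-dec residue? (toℕ r) 1} tt r
power-residue r 2 = toWitness {a? = Fin.all? λ r → ((toℕ {36} r ^ 2) % 36 ℕ.≟ 19) →-dec residue? (toℕ r) 2} tt r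
power-residue r 3 = toWitness {a? = Fin.all? λ r → ((toℕ {36} r ^ 3) % 36 ℕ.≟ 19) →-dec residue? (toℕ r) 3} tt r
power-residue r 4 = toWitness {a? = Fin.all? λ r → ((toℕ {36} r ^ 4) % 36 ℕ.≟ 19) →-dec residue? (toℕ r) 4} tt r
power-residue r 5 = toWitness {a? = Fin.all? λ r → ((toℕ {36} r ^ 5) % 36 ℕ.≟ 19) →-dec residue? (toℕ r) 5} tt r
power-residue r (suc (suc (suc (suc (suc (suc e)))))) eq = power-residue r e (trans (sym (toℕ-s r e)) (exponent-6 r (s r e) (begin
    ((toℕ r ^ 6) % 36 * toℕ (s r e)) % 36              ≡⟨ cong (λ x → ((toℕ r ^ 6) % 36 * x) % 36) (toℕ-s r e) ⟩
    ((toℕ r ^ 6) % 36 * ((toℕ r ^ e) % 36)) % 36     ≡⟨ ℕ.%-distribˡ-* (toℕ r ^ 6) (toℕ r ^ e) 36 ⟨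
    (toℕ r ^ 6 * toℕ r ^ e) % 36                     ≡⟨ cong (_% 36) (ℕ.^-distribˡ-+-* (toℕ r) 6 e) ⟨
    (toℕ r ^ (6 + e)) % 36                             ≡⟨ eq ⟩
    19                                                     ∎)))
  where
  open ≡-Reasoning
  s : Fin 36 → ℕ → Fin 36
  s r e = (toℕ r ^ e) mod 36
  toℕ-s : ∀ r e → toℕ (s r e) ≡ (toℕ r ^ e) % 36
  toℕ-s r e = Fin.toℕ-fromℕ< (ℕ.m%n<n (toℕ r ^ e) 36)
  -- For a unit r the factor is 1; for any other r the product is no unit and cannot be 19.
  exponent-6 : ∀ (r s : Fin 36) → ((toℕ r ^ 6) % 36 * toℕ s) % 36 ≡ 19 → toℕ s ≡ 19
  exponent-6 = toWitness {a? = Fin.all? λ r → Fin.all? λ s → (((toℕ {36} r ^ 6) % 36 * toℕ {36} s) % 36 ℕ.≟ 19) →-dec (toℕ s ℕ.≟ 19)} tt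

component-residue : ∀ p e → (p ^ e) % 36 ≡ 19 → Residue (p % 36) e
component-residue p e eq = subst (λ r → Residue r e) toℕ-r
  (power-residue (p mod 36) e (trans (cong (λ x → (x ^ e) % 36) toℕ-r) (trans (sym (power-% p e 36)) eq)))
  where
  toℕ-r : toℕ (p mod 36) ≡ p % 36
  toℕ-r = Fin.toℕ-fromℕ< (ℕ.m%n<n p 36)

prime-power-harmonic : ∀ p e → Prime p → (p ^ e) % 36 ≡ 19 → Harmonic (Vec (Fin p) e) (Vec.zipWith addFin)
prime-power-harmonic 0 _ p-prime _ = ⊥-elim (¬prime[0] p-prime)
prime-power-harmonic 1 _ p-prime _ = ⊥-elim (¬prime[1] p-prime)
prime-power-harmonic p@(suc (suc n)) e p-prime eq = from-residue (component-residue p e eq)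
  where
  K : FiniteField
  K = prime-field n p-prime

  via-extension : ∀ j r → r ≡ 1 ⊎ r ≡ 2 → p ≡ suc (3 * (r + 3 * j)) → (p * (p * p)) % 36 ≡ 19 →
                  Harmonic (Vec (Fin p) 3) (Vec.zipWith addFin)
  via-extension j r r-small p≡ cube% = case noncube K j r p≡ r-small of λ
    { (ω , ω-noncube) → field-harmonic (CubicExtension.extension K ω ω-noncube) cube% }

  cube-% : (p * (p * p)) % 36 ≡ ((p % 36) * (((p % 36) * (p % 36)) % 36)) % 36
  cube-% = trans (ℕ.%-distribˡ-* p (p * p) 36) (cong (λ x → ((p % 36) * x) % 36) (ℕ.%-distribˡ-* p p 36))

  triples : p % 36 ≡ 7 ⊎ p % 36 ≡ 31 → Harmonic (Vec (Fin p) 3) (Vec.zipWith addFin)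
  -- With q = p / 36 (rounded down), (p - 1) / 3 is 2 + 12q here and 10 + 12q in the other case. It
  -- is thus 2 or 1 modulo 3, so that 9 does not divide p - 1.
  triples (inj₁ r) = via-extension (4 * (p ℕ./ 36)) 2 (inj₂ refl)
    (trans (ℕ.m≡m%n+[m/n]*n p 36) (trans (cong (ℕ._+ p ℕ./ 36 * 36) r) (arith (p ℕ./ 36))))
    (trans cube-% (cong (λ r → (r * ((r * r) % 36)) % 36) r))
    where
    arith : ∀ q → 7 + q * 36 ≡ suc (3 * (2 + 3 * (4 * q)))
    arith = solve-∀
  triples (inj₂ r) = via-extension (3 + 4 * (p ℕ./ 36)) 1 (inj₁ refl)
    (trans (ℕ.m≡m%n+[m/n]*n p 36) (trans (cong (ℕ._+ p ℕ./ 36 * 36) r) (arith (p ℕ./ 36))))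
    (trans cube-% (cong (λ r → (r * ((r * r) % 36)) % 36) r))
    where
    arith : ∀ q → 31 + q * 36 ≡ suc (3 * (1 + 3 * (3 + 4 * q)))
    arith = solve-∀

  from-residue : Residue (p % 36) e → Harmonic (Vec (Fin p) e) (Vec.zipWith addFin)
  from-residue (inj₁ r) = subst (λ e → Harmonic (Vec (Fin p) e) (Vec.zipWith addFin)) (ℕ.*-identityʳ e)
    (repeat-harmonic (Transport.harmonic (mk↔ₛ′ (λ x → x ∷ []) Vec.head (λ { (x ∷ []) → refl }) (λ _ → refl)) (λ _ _ → refl) (field-harmonic K r)) e)
  from-residue (inj₂ (r , 3∣e)) = subst (λ e → Harmonic (Vec (Fin p) e) (Vec.zipWith addFin))
    (sym (trans (ℕ.m≡m%n+[m/n]*n e 3) (cong (ℕ._+ e ℕ./ 3 * 3) 3∣e)))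
    (repeat-harmonic (triples r) (e ℕ./ 3))

Fv-harmonic : ∀ fs → All (λ pe → Prime (proj₁ pe) × 1 ≤ proj₂ pe) fs → All (λ pe → component pe % 36 ≡ 19) fs →
              Harmonic (Fv fs) (addFv fs)
Fv-harmonic [] _ _ = trivial-harmonic
Fv-harmonic ((p , e) ∷ fs) ((p-prime , _) ∷ primes) (eq ∷ eqs) = prime-power-harmonic p e p-prime eq ⊗-harmonic Fv-harmonic fs primes eqs

-- Here v > 1 enters: both block sizes occur as soon as the group is nontrivial.
nonidentity : ∀ fs → 1 < List.foldr ℕ._*_ 1 (List.map component fs) → All (λ pe → Prime (proj₁ pe) × 1 ≤ proj₂ pe) fs →
              ∀ (ε : Fv fs) → ∃ λ x → x ≢ ε
nonidentity [] (s≤s ()) _ _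
nonidentity ((0 , _) ∷ _) _ ((p-prime , _) ∷ _) _ = ⊥-elim (¬prime[0] p-prime)
nonidentity ((1 , _) ∷ _) _ ((p-prime , _) ∷ _) _ = ⊥-elim (¬prime[1] p-prime)
nonidentity ((suc (suc _) , 0) ∷ _) _ ((_ , ()) ∷ _) _
nonidentity ((suc (suc _) , suc _) ∷ fs) _ _ (zero ∷ xs , y) = (1F ∷ xs , y) , λ ()
nonidentity ((suc (suc _) , suc _) ∷ fs) _ _ (suc i ∷ xs , y) = (0F ∷ xs , y) , λ ()

theorem8p2 : (v : ℕ) (fs : List (ℕ × ℕ)) → 1 < v → IsComponentFactorisation v fs
    → All (λ pe → component pe % 36 ≡ 19) fs
    → HarmoniousS236 (Γ fs) _⊕_
theorem8p2 v fs 1<v (primes , _ , v≡) residues = Design.design group family (proj₂ (nonidentity fs (subst (1 <_) v≡ 1<v) primes ε))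
  where
  open Harmonic (Fv-harmonic fs primes residues)
  open FiniteAbelianGroup group using (ε)
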